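{- Let $G$ be a $K_4$-free regular graph on $n$ vertices. If every vertex set $S\subseteq V(G)$ of size $\lfloor n/2\rfloor$ spans at least $n^2/18$ edges of $G$, then $n$ is divisible by $6$ and $G\cong T_3(n)$.
   Context: All graphs are finite and simple, with at least one vertex. A graph is $K_4$-free if it does not contain $K_4$ as a subgraph. A vertex set $S$ spans $m$ edges if the induced subgraph $G[S]$ has exactly $m$ edges. $T_3(n)$ denotes the Turán graph, i.e. the complete $3$-partite graph on $n$ vertices in which the sizes of every two parts differ by at most one. -}

module Defs where

open import Data.Fin using (Fin; zero; suc; toℕ; _<?_)
open import Data.Fin.Properties using (_≟_)
open import Data.Fin.Subset using (Subset; ∣_∣)
open import Data.Fin.Subset.Properties using (_∈?_)
open import Data.List using (List; allFin; cartesianProduct; filter; length)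
open import Data.Nat using (ℕ; zero; suc; _≤_; z≤n; s≤s; _+_)
open import Data.Nat.DivMod using (_mod_)
open import Data.Product using (_×_; _,_; ∃-syntax; Σ-syntax)
open import Data.Vec using (tabulate)
open import Function using (_∘_; _⇔_; _↔_; Injective; Inverse)
open import Level using (0ℓ)
open import Relation.Binary using (Rel; Symmetric; Irreflexive; Decidable)
open import Relation.Binary.PropositionalEquality using (_≡_; _≢_; refl; sym; cong; subst₂)
open import Relation.Nullary using (¬_; does; ¬?)
open import Relation.Nullary.Decidable using (_×-dec_)

record Graph (n : ℕ) : Set₁ where
  field
    _~_      : Rel (Fin n) 0ℓ
    _~?_     : Decidable _~_
    ~-sym    : Symmetric _~_
    ~-irrefl : Irreflexive _≡_ _~_

module _ {n : ℕ} (G : Graph n) where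
  open Graph G

  neighbours : Fin n → Subset n
  neighbours v = tabulate (λ u → does (v ~? u))

  degree : Fin n → ℕ
  degree v = ∣ neighbours v ∣

  Regular : Set
  Regular = ∃[ d ] (∀ v → degree v ≡ d)

  -- Each edge {u , v} is listed once, as the pair with u < v.
  edges : List (Fin n × Fin n)
  edges = filter (λ (u , v) → u <? v ×-dec u ~? v)
                 (cartesianProduct (allFin n) (allFin n))

  -- The number of edges of the induced subgraph G[S].
  spannedEdges : Subset n → ℕ
  spannedEdges S = length (filter (λ (u , v) → u ∈? S ×-dec v ∈? S) edges)

-- Containment as a not necessarily induced subgraph, up to isomorphism.
_⊑_ : ∀ {m n} → Graph m → Graph n → Set
_⊑_ {m} {n} H G =
  Σ[ f ∈ (Fin m → Fin n) ] Injective _≡_ _≡_ f × (∀ {u v} → u H.~ v → f u G.~ f v)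
  where
  module H = Graph H
  module G = Graph G

_≅_ : ∀ {m n} → Graph m → Graph n → Set
_≅_ {m} {n} G H =
  Σ[ φ ∈ Fin m ↔ Fin n ] (∀ u v → (u G.~ v) ⇔ (Inverse.to φ u H.~ Inverse.to φ v))
  where
  module G = Graph G
  module H = Graph H

infix 4 _⊑_ _≅_

-- The parts are the fibres of c; a part may be empty.
completeMultipartite : ∀ {n r} → (Fin n → Fin r) → Graph n
completeMultipartite c = record
  { _~_      = λ u v → c u ≢ c v
  ; _~?_     = λ u v → ¬? (c u ≟ c v)
  ; ~-sym    = λ cu≢cv → cu≢cv ∘ sym
  ; ~-irrefl = λ u≡v cu≢cv → cu≢cv (cong c u≡v)
  }

K : ∀ r → Graph r
K r = completeMultipartite (λ v → v)

K₄-Free : ∀ {n} → Graph n → Set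
K₄-Free G = ¬ (K 4 ⊑ G)

part₃ : ∀ n → Fin n → Fin 3
part₃ n v = toℕ v mod 3

T₃ : ∀ n → Graph n
T₃ n = completeMultipartite (part₃ n)

partSize : ∀ {n r} → (Fin n → Fin r) → Fin r → ℕ
partSize c i = ∣ tabulate (λ v → does (c v ≟ i)) ∣

-- The residue classes are balanced, so T₃ n is the Turán graph.
T₃-balanced : ∀ n i j → partSize (part₃ n) i ≤ 1 + partSize (part₃ n) j
T₃-balanced 0 i j = z≤n
T₃-balanced 1 zero             j = s≤s z≤n
T₃-balanced 1 (suc zero)       j = z≤n
T₃-balanced 1 (suc (suc zero)) j = z≤n
T₃-balanced 2 zero             j = s≤s z≤n
T₃-balanced 2 (suc zero)       j = s≤s z≤n
T₃-balanced 2 (suc (suc zero)) j = z≤n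
T₃-balanced (suc (suc (suc n))) i j =
  subst₂ (λ a b → a ≤ 1 + b) (sym (step i)) (sym (step j)) (s≤s (T₃-balanced n i j))
  where
  step : ∀ k → partSize (part₃ (3 + n)) k ≡ suc (partSize (part₃ n) k)
  step zero             = refl
  step (suc zero)       = refl
  step (suc (suc zero)) = refl

{-# OPTIONS --safe #-}
module Submission where

-- Write B(x, y) = xᵀ A y for the adjacency matrix A of the d-regular graph G. Since B is concave along
-- differences of unit vectors, the hypothesis on halves rounds up to a fractional one:
--   9 B(x, x) ≥ (4n² − 9dn) L²  for all x : V → [−L, L] with ∑ x = 0.
-- Testing it with combinations of 1, N(w) and N(w) ∩ N(v) shows that N(w) spans many edges.
-- Suppose 3d < 2n. Among all vertices w choose disjoint independent sets 𝒜, 𝒞 ⊆ N(w) of maximal total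
-- size, and let 𝒟 be the rest of N(w). Candidates are N(w) ∩ N(u), N(w) ∩ N(v) for a triangle uvw; so
-- maximality bounds |𝒟| and, through the count of the vertices seen by a triangle, bounds all codegrees
-- from below. By K₄-freeness the vertices of 𝒟 then have small degree in N(w), and few neighbours in
-- one of 𝒜 and 𝒞. Testing with the cut that separates 𝒜 from 𝒞 and splits 𝒟 by majority gives a
-- polynomial inequality in n, d and |𝒟| that is false. For 2d < n the cut 1_𝒜 − 1_𝒞 suffices.
-- If 3d ≥ 2n, every vertex is adjacent to exactly two vertices of each triangle, so G is complete
-- tripartite with equal parts, and n odd would make one part together with half of another too sparse.

-- The complete tripartite graph with equal parts gives equality both in the lower bound for the
-- edges inside `N(w)` and in the upper bound from maximality, so nothing may be lost at `3d = 2n`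
-- with `𝒟` empty; numerical slack appears only in the closing polynomial. With `k = 2n - 3d` and
-- `D = |𝒟|` that polynomial gains `48nk³` and loses a linear term led by `64n²kD`, so a nonempty
-- `𝒟` would be fatal for small `k`. The rescue is that a vertex of `𝒟` has at least `2d - n + D`
-- neighbours in `N(w)`, while `k - D` bounds this number from above even with its neighbours in `𝒟`
-- counted twice. Hence `6D ≤ 5k - n`, and `𝒟` is empty unless `k > n/5`. Maximality ranges over all
-- base vertices, because the codegree bound for an edge `xy` inside `N(w)` compares with a
-- configuration based at `y`. The scale `L` of the test vectors keeps them integral: in place of
-- division, positive factors are cancelled from integer inequalities.

-- Polynomial identities over the integers, by reflection.

module IntegerIdentities where

  open import Data.Bool using (Bool; true; false; _∧_)
  open import Data.Fin using (Fin; zero; suc)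
  import Data.Integer as ℤ
  open import Data.Integer hiding (suc; _*_)
  open import Data.Integer.Properties
  open import Data.Integer.Tactic.RingSolver using (solve-∀)
  open import Data.List using (List; []; _∷_)
  open import Data.Nat as ℕ using (ℕ; zero; suc)
  open import Data.Vec as Vec using (Vec; lookup; tabulate)
  open import Relation.Binary.PropositionalEquality

  infixl 7 _*_

  -- Integer multiplication unfolds even on neutral arguments and then duplicates them; opacity keeps
  -- conversion checking of polynomial terms linear in their size.
  opaque
    _*_ : ℤ → ℤ → ℤ
    _*_ = ℤ._*_

  opaque
    unfolding _*_

    *≡ : ∀ x y → x * y ≡ x ℤ.* y
    *≡ x y = refl

  infixl 6 _:+_ _:-_
  infixl 7 _:*_
  infix 9 #_
  infix 8 :-_
  infix 4 _:=_

  data Expr (k : ℕ) : Set where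
    var  : Fin k → Expr k
    con  : ℤ → Expr k
    _:+_ _:-_ _:*_ : Expr k → Expr k → Expr k
    :-_  : Expr k → Expr k

  #_ : ∀ {k} → ℕ → Expr k
  # m = con (+ m)

  data Equation (k : ℕ) : Set where
    _:=_ : Expr k → Expr k → Equation k

  ⟦_⟧ : ∀ {k} → Expr k → Vec ℤ k → ℤ
  ⟦ var i ⟧ ρ = lookup ρ i
  ⟦ con c ⟧ ρ = c
  ⟦ e :+ f ⟧ ρ = ⟦ e ⟧ ρ + ⟦ f ⟧ ρ
  ⟦ e :- f ⟧ ρ = ⟦ e ⟧ ρ - ⟦ f ⟧ ρ
  ⟦ e :* f ⟧ ρ = ⟦ e ⟧ ρ * ⟦ f ⟧ ρ
  ⟦ :- e ⟧ ρ = - ⟦ e ⟧ ρ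

  ⟦_⟧ₑ : ∀ {k} → Equation k → Vec ℤ k → Set
  ⟦ e := f ⟧ₑ ρ = ⟦ e ⟧ ρ ≡ ⟦ f ⟧ ρ

  -- Dense polynomials in k variables: coefficient lists in the first variable.
  Poly : ℕ → Set
  Poly zero    = ℤ
  Poly (suc k) = List (Poly k)

  eval : ∀ k → Poly k → Vec ℤ k → ℤ
  eval zero    c        ρ           = c
  eval (suc k) []       ρ           = 0ℤ
  eval (suc k) (p ∷ ps) (x Vec.∷ ρ) = eval k p ρ + x ℤ.* eval (suc k) ps (x Vec.∷ ρ)

  const : ∀ k → ℤ → Poly k
  const zero    c = c
  const (suc k) c = const k c ∷ []

  varᵖ : ∀ {k} → Fin k → Poly k
  varᵖ {suc k} zero    = const k 0ℤ ∷ const k 1ℤ ∷ []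
  varᵖ {suc k} (suc i) = varᵖ i ∷ []

  add : ∀ k → Poly k → Poly k → Poly k
  add zero    c        d        = c + d
  add (suc k) []       qs       = qs
  add (suc k) (p ∷ ps) []       = p ∷ ps
  add (suc k) (p ∷ ps) (q ∷ qs) = add k p q ∷ add (suc k) ps qs

  mutual
    mul : ∀ k → Poly k → Poly k → Poly k
    mul zero    c        d  = c ℤ.* d
    mul (suc k) []       qs = []
    mul (suc k) (p ∷ ps) qs = add (suc k) (scale k p qs) (const k 0ℤ ∷ mul (suc k) ps qs)

    scale : ∀ k → Poly k → Poly (suc k) → Poly (suc k)
    scale k p []       = []
    scale k p (q ∷ qs) = mul k p q ∷ scale k p qs

  -- Coefficient lists may carry trailing zeros, so equal polynomials need not have equal normal
  -- forms. An identity is therefore tested on the difference of its sides, all of whose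
  -- coefficients must vanish.
  isZero : ∀ k → Poly k → Bool
  isZero zero    (+ zero)   = true
  isZero zero    _          = false
  isZero (suc k) []         = true
  isZero (suc k) (p ∷ ps)   = isZero k p ∧ isZero (suc k) ps

  norm : ∀ {k} → Expr k → Poly k
  norm         (var i)  = varᵖ i
  norm {k}     (con c)  = const k c
  norm {k}     (e :+ f) = add k (norm e) (norm f)
  norm {k}     (e :- f) = add k (norm e) (mul k (const k -1ℤ) (norm f))
  norm {k}     (e :* f) = mul k (norm e) (norm f)
  norm {k}     (:- e)   = mul k (const k -1ℤ) (norm e)

  eval-const : ∀ k c ρ → eval k (const k c) ρ ≡ c
  eval-const zero    c ρ           = refl
  eval-const (suc k) c (x Vec.∷ ρ) rewrite eval-const k c ρ = lem c x
    where
    lem : ∀ c x → c + x ℤ.* 0ℤ ≡ c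
    lem = solve-∀

  eval-var : ∀ {k} (i : Fin k) ρ → eval k (varᵖ i) ρ ≡ lookup ρ i
  eval-var {suc k} zero    (x Vec.∷ ρ) rewrite eval-const k 0ℤ ρ | eval-const k 1ℤ ρ = lem x
    where
    lem : ∀ x → 0ℤ + x ℤ.* (1ℤ + x ℤ.* 0ℤ) ≡ x
    lem = solve-∀
  eval-var {suc k} (suc i) (x Vec.∷ ρ) rewrite eval-var i ρ = lem (lookup ρ i) x
    where
    lem : ∀ c x → c + x ℤ.* 0ℤ ≡ c
    lem = solve-∀

  eval-add : ∀ k p q ρ → eval k (add k p q) ρ ≡ eval k p ρ + eval k q ρ
  eval-add zero    c        d        ρ = refl
  eval-add (suc k) []       qs       ρ = sym (+-identityˡ _)
  eval-add (suc k) (p ∷ ps) []       ρ = sym (+-identityʳ _)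
  eval-add (suc k) (p ∷ ps) (q ∷ qs) (x Vec.∷ ρ)
    rewrite eval-add k p q ρ | eval-add (suc k) ps qs (x Vec.∷ ρ) =
    lem (eval k p ρ) (eval k q ρ) x (eval (suc k) ps (x Vec.∷ ρ)) (eval (suc k) qs (x Vec.∷ ρ))
    where
    lem : ∀ a b x c d → a + b + x ℤ.* (c + d) ≡ a + x ℤ.* c + (b + x ℤ.* d)
    lem = solve-∀

  mutual
    eval-mul : ∀ k p q ρ → eval k (mul k p q) ρ ≡ eval k p ρ ℤ.* eval k q ρ
    eval-mul zero    c        d  ρ = refl
    eval-mul (suc k) []       qs ρ = refl
    eval-mul (suc k) (p ∷ ps) qs (x Vec.∷ ρ)
      rewrite eval-add (suc k) (scale k p qs) (const k 0ℤ ∷ mul (suc k) ps qs) (x Vec.∷ ρ)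
            | eval-scale k p qs x ρ | eval-const k 0ℤ ρ | eval-mul (suc k) ps qs (x Vec.∷ ρ) =
      lem (eval k p ρ) x (eval (suc k) ps (x Vec.∷ ρ)) (eval (suc k) qs (x Vec.∷ ρ))
      where
      lem : ∀ a x b c → a ℤ.* c + (0ℤ + x ℤ.* (b ℤ.* c)) ≡ (a + x ℤ.* b) ℤ.* c
      lem = solve-∀

    eval-scale : ∀ k p qs x ρ →
      eval (suc k) (scale k p qs) (x Vec.∷ ρ) ≡ eval k p ρ ℤ.* eval (suc k) qs (x Vec.∷ ρ)
    eval-scale k p []       x ρ = sym (*-zeroʳ (eval k p ρ))
    eval-scale k p (q ∷ qs) x ρ rewrite eval-mul k p q ρ | eval-scale k p qs x ρ =
      lem (eval k p ρ) (eval k q ρ) x (eval (suc k) qs (x Vec.∷ ρ))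
      where
      lem : ∀ a b x c → a ℤ.* b + x ℤ.* (a ℤ.* c) ≡ a ℤ.* (b + x ℤ.* c)
      lem = solve-∀

  eval-isZero : ∀ k p ρ → isZero k p ≡ true → eval k p ρ ≡ 0ℤ
  eval-isZero zero    (+ zero) ρ           z = refl
  eval-isZero (suc k) []       ρ           z = refl
  eval-isZero (suc k) (p ∷ ps) (x Vec.∷ ρ) z with isZero k p in z₁
  ... | true rewrite eval-isZero k p ρ z₁ | eval-isZero (suc k) ps (x Vec.∷ ρ) z = lem x
    where
    lem : ∀ x → 0ℤ + x ℤ.* 0ℤ ≡ 0ℤ
    lem = solve-∀

  eval-norm : ∀ {k} (e : Expr k) ρ → eval k (norm e) ρ ≡ ⟦ e ⟧ ρ
  eval-norm     (var i)  ρ = eval-var i ρ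
  eval-norm {k} (con c)  ρ = eval-const k c ρ
  eval-norm {k} (e :+ f) ρ rewrite eval-add k (norm e) (norm f) ρ =
    cong₂ _+_ (eval-norm e ρ) (eval-norm f ρ)
  eval-norm {k} (e :- f) ρ
    rewrite eval-add k (norm e) (mul k (const k -1ℤ) (norm f)) ρ
          | eval-mul k (const k -1ℤ) (norm f) ρ | eval-const k -1ℤ ρ =
    cong₂ _+_ (eval-norm e ρ) (trans (-1*i≡-i _) (cong -_ (eval-norm f ρ)))
  eval-norm {k} (e :* f) ρ rewrite eval-mul k (norm e) (norm f) ρ =
    trans (cong₂ ℤ._*_ (eval-norm e ρ) (eval-norm f ρ)) (sym (*≡ _ _))
  eval-norm {k} (:- e)   ρ
    rewrite eval-mul k (const k -1ℤ) (norm e) ρ | eval-const k -1ℤ ρ =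
    trans (-1*i≡-i _) (cong -_ (eval-norm e ρ))

  valid : ∀ {k} → Equation k → Bool
  valid {k} (e := f) = isZero k (norm (e :- f))

  valid-sound : ∀ {k} (eq : Equation k) → valid eq ≡ true → ∀ ρ → ⟦ eq ⟧ₑ ρ
  valid-sound (e := f) z ρ =
    i-j≡0⇒i≡j _ _ (trans (sym (eval-norm (e :- f) ρ)) (eval-isZero _ (norm (e :- f)) ρ z))

  Curried : ℕ → Set → Set → Set
  Curried zero    A C = C
  Curried (suc k) A C = A → Curried k A C

  apply : ∀ {A C} k → Curried k A C → Vec A k → C
  apply zero    f Vec.[]       = f
  apply (suc k) f (x Vec.∷ xs) = apply k (f x) xs

  Π : ∀ k → (Vec ℤ k → Set) → Set
  Π zero    P = P Vec.[]
  Π (suc k) P = ∀ x → Π k (λ ρ → P (x Vec.∷ ρ))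

  Π-intro : ∀ k {P : Vec ℤ k → Set} → (∀ ρ → P ρ) → Π k P
  Π-intro zero    p = p Vec.[]
  Π-intro (suc k) p = λ x → Π-intro k (λ ρ → p (x Vec.∷ ρ))

  -- Both sides are closed expressions in formal variables, so the premise is a computation and
  -- `refl` proves it.
  solve : ∀ k (f : Curried k (Expr k) (Equation k)) →
    valid (apply k f (tabulate var)) ≡ true → Π k ⟦ apply k f (tabulate var) ⟧ₑ
  solve k f z = Π-intro k (valid-sound (apply k f (tabulate var)) z)

-- Order reasoning and the closing polynomial inequalities.

module Inequalities where

  open import Data.Empty using (⊥; ⊥-elim)
  open import Data.Integer hiding (suc; _*_; pos)
  open import Data.Integer.Properties
  import Data.Nat as ℕ
  open import Data.Product using (_×_; _,_) renaming (map₂ to map₂′)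
  open import Data.Sum using (_⊎_; inj₁; inj₂; map₂)
  open import Relation.Binary.PropositionalEquality
  open import Relation.Nullary using (yes; no)
  open IntegerIdentities

  infixl 6 _⊕_
  infixl 7 _⊗_

  opaque
    unfolding _*_

    _⊗_ : ∀ {x y} → 0ℤ ≤ x → 0ℤ ≤ y → 0ℤ ≤ x * y
    _⊗_ {x} {y} p q = *-monoʳ-≤-nonNeg y {{nonNegative q}} p

    *-pos : ∀ {x y} → 0ℤ < x → 0ℤ < y → 0ℤ < x * y
    *-pos {x} {y} p q = *-monoʳ-<-pos y {{positive q}} p

    sq≥0 : ∀ x → 0ℤ ≤ x * x
    sq≥0 (+ m)    = nonNeg⊗ {+ m} (+≤+ ℕ.z≤n)
      where
      nonNeg⊗ : ∀ {x} → 0ℤ ≤ x → 0ℤ ≤ x * x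
      nonNeg⊗ {x} p = *-monoʳ-≤-nonNeg x {{nonNegative p}} p
    sq≥0 -[1+ m ] = +≤+ ℕ.z≤n

  _⊕_ : ∀ {x y} → 0ℤ ≤ x → 0ℤ ≤ y → 0ℤ ≤ x + y
  _⊕_ = +-mono-≤

  _⊕⁺_ : ∀ {x y} → 0ℤ ≤ x → 0ℤ < y → 0ℤ < x + y
  _⊕⁺_ = +-mono-≤-<

  infixl 6 _⊕⁺_

  nn : ∀ {m} → 0ℤ ≤ + m
  nn = +≤+ ℕ.z≤n

  pos : ∀ {m} → 0ℤ < +[1+ m ]
  pos = +<+ (ℕ.s≤s ℕ.z≤n)

  -- The pattern of most estimates: `x` is assembled from products of known nonnegative quantities,
  -- and the equation is a polynomial identity.
  by : ∀ {x y} → 0ℤ ≤ x → x ≡ y → 0ℤ ≤ y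
  by p refl = p

  by⁺ : ∀ {x y} → 0ℤ < x → x ≡ y → 0ℤ < y
  by⁺ p refl = p

  -- Refutations are Positivstellensatz certificates: a nonnegative and a positive combination of
  -- the assumptions that cancel identically.
  clash : ∀ {x y} → 0ℤ ≤ x → 0ℤ < y → x + y ≡ 0ℤ → ⊥
  clash p q e = <-irrefl (sym e) (+-mono-≤-< p q)

  0≤-by-contradiction : ∀ {x} → (0ℤ < - x → ⊥) → 0ℤ ≤ x
  0≤-by-contradiction {x} f with 0ℤ ≤? x
  ... | yes p = p
  ... | no p  = ⊥-elim (f (neg-mono-< (≰⇒> p)))

  0<-by-contradiction : ∀ {x} → (0ℤ ≤ - x → ⊥) → 0ℤ < x
  0<-by-contradiction {x} f with 0ℤ <? x
  ... | yes p = p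
  ... | no p  = ⊥-elim (f (neg-mono-≤ (≮⇒≥ p)))

  cancel-pos : ∀ {x y} → 0ℤ < x → 0ℤ ≤ x * y → 0ℤ ≤ y
  cancel-pos {x} {y} p q = 0≤-by-contradiction λ r →
    clash q (*-pos p r) (solve 2 (λ x y → x :* y :+ x :* (:- y) := # 0) refl x y)

  cancel-pos⁺ : ∀ {x y} → 0ℤ < x → 0ℤ < x * y → 0ℤ < y
  cancel-pos⁺ {x} {y} p q = 0<-by-contradiction λ r →
    clash (<⇒≤ p ⊗ r) q (solve 2 (λ x y → x :* (:- y) :+ x :* y := # 0) refl x y)

  -- The two assumptions come from testing `N(w)` against its complement and from the cut between
  -- `𝒜` and `𝒞`. Weights 5 and `n` cancel `T` and leave the negative quantity
  -- `-n(n - 2d)(23(n - 2d) + n)`.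
  low-degree-arithmetic : ∀ n d T → 0ℤ < n → 0ℤ < n - + 2 * d →
    0ℤ ≤ + 9 * n * T - (+ 9 * d * d * d - (+ 9 * d - + 4 * n) * (n - d) * (n - d)) →
    0ℤ ≤ + 9 * d * n - + 4 * n * n - + 9 * (+ 5 * T - + 2 * d * d) → ⊥
  low-degree-arithmetic n d T n>0 u A B =
    clash (<⇒≤ n>0 ⊗ B ⊕ nn {5} ⊗ A) (*-pos (*-pos n>0 u) (nn {23} ⊗ <⇒≤ u ⊕⁺ n>0))
    (solve 3 (λ n d T →
        n :* (# 9 :* d :* n :- # 4 :* n :* n :- # 9 :* (# 5 :* T :- # 2 :* d :* d))
        :+ # 5 :* (# 9 :* n :* T :- (# 9 :* d :* d :* d :- (# 9 :* d :- # 4 :* n) :* (n :- d) :* (n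
        :- d))) :+ n :* (n :- # 2 :* d) :* (# 23 :* (n :- # 2 :* d) :+ n)
        := # 0) refl n d T)

  -- With k = 2n − 3d and D = |𝒟|: what remains of the final inequality after eliminating the number of
  -- edges inside N(w).
  P₃ : ℤ → ℤ → ℤ → ℤ
  P₃ n k D = + 48 * n * k * k * k - k * (+ 64 * n * n + + 24 * n * k + + 104 * k * k) * D
           + + 3 * (n + k) * (+ 128 * n - + 451 * k) * D * D + + 945 * (n + k) * D * D * D

  -- `cap` says that `D` is at most `k(n - k)/(3(n + k))`. The maximum of this, `(3 - 2√2)n/3` at
  -- `k = (√2 - 1)n`, is just below `n/17`; the square uses 7/17 as an approximation of `√2 - 1`.
  17D≤n : ∀ n k D → 0ℤ < n → 0ℤ ≤ n + k →
    0ℤ ≤ n * k - k * k - + 3 * (n + k) * D → 0ℤ ≤ n - + 17 * D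
  17D≤n n k D n>0 n+k≥0 cap = 0≤-by-contradiction λ r → clash
    (nn {289} ⊗ cap ⊕ nn {51} ⊗ n+k≥0 ⊗ <⇒≤ r ⊕ sq≥0 (+ 17 * k - + 7 * n))
    (*-pos (*-pos (pos {1}) n>0) n>0)
    (solve 3 (λ n k D →
        # 289 :* (n :* k :- k :* k :- # 3 :* (n :+ k) :* D)
        :+ # 51 :* (n :+ k) :* (:- (n :- # 17 :* D))
        :+ (# 17 :* k :- # 7 :* n) :* (# 17 :* k :- # 7 :* n)
        :+ # 2 :* n :* n := # 0) refl n k D)

  -- The bound on `6D` is substituted into the term linear in `D`, the only negative one here, since
  -- `128n - 451k` is positive in this range. What is left expands in `6n - 25k` and `k` with
  -- positive coefficients.
  P₃>0-small-k : ∀ n k D → 0ℤ < n → 0ℤ < k → 0ℤ ≤ D → 0ℤ ≤ + 6 * n - + 25 * k →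
    0ℤ ≤ + 5 * k - n - + 6 * D → 0ℤ < P₃ n k D
  P₃>0-small-k n k D n>0 k>0 D≥0 a≥0 e≥0 = cancel-pos⁺ (pos {1295}) (by⁺
    (k≥0 ⊗ (nn {40992} ⊗ a≥0 ⊗ k≥0 ⊗ k≥0 ⊕ nn {3024} ⊗ a≥0 ⊗ a≥0 ⊗ k≥0 ⊕ nn {64} ⊗ a≥0 ⊗ a≥0 ⊗ a≥0)
      ⊕ nn {216} ⊗ k≥0 ⊗ (nn {64} ⊗ n≥0 ⊗ n≥0 ⊕ nn {24} ⊗ n≥0 ⊗ k≥0 ⊕ nn {104} ⊗ k≥0 ⊗ k≥0) ⊗ e≥0
      ⊕ nn {1296} ⊗ (nn {3} ⊗ (n≥0 ⊕ k≥0) ⊗ c≥0 ⊗ D≥0 ⊗ D≥0 ⊕ nn {945} ⊗ (n≥0 ⊕ k≥0) ⊗ D≥0 ⊗ D≥0 ⊗ D≥0)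
      ⊕⁺ *-pos (*-pos (*-pos (*-pos (pos {22479}) k>0) k>0) k>0) k>0)
    (solve 3 (λ n k D →
        k :* (# 40992 :* (# 6 :* n :- # 25 :* k) :* k :* k :+ # 3024 :* (# 6 :* n :- # 25 :* k) :* (# 6 :* n
        :- # 25 :* k) :* k :+ # 64 :* (# 6 :* n :- # 25 :* k) :* (# 6 :* n :- # 25 :* k) :* (# 6 :* n
        :- # 25 :* k)) :+ # 216 :* k :* (# 64 :* n :* n :+ # 24 :* n :* k :+ # 104 :* k :* k) :* (# 5 :* k
        :- n :- # 6 :* D) :+ # 1296 :* (# 3 :* (n :+ k) :* (# 21 :* (# 6 :* n :- # 25 :* k) :+ # 2 :* n
        :+ # 74 :* k) :* D :* D :+ # 945 :* (n :+ k) :* D :* D :* D)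
        :+ # 22480 :* k :* k :* k :* k
        := # 1296 :* (# 48 :* n :* k :* k :* k :- k :* (# 64 :* n :* n :+ # 24 :* n :* k :+ # 104 :* k :* k) :* D
        :+ # 3 :* (n :+ k) :* (# 128 :* n :- # 451 :* k) :* D :* D :+ # 945 :* (n :+ k) :* D :* D :* D)) refl n k D))
    where
    k≥0 = <⇒≤ k>0
    n≥0 = <⇒≤ n>0
    c≥0 : 0ℤ ≤ + 21 * (+ 6 * n - + 25 * k) + + 2 * n + + 74 * k
    c≥0 = nn {21} ⊗ a≥0 ⊕ nn {2} ⊗ n≥0 ⊕ nn {74} ⊗ k≥0

  bernstein₁ bernstein₂ : ℤ → ℤ → ℤ
  bernstein₁ n k = + 18336 * k * k * k - + 288 * n * k * k - + 803 * n * n * k - + 35 * n * n * n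
  bernstein₂ n k = + 145248 * k * k * k - + 21132 * n * k * k - + 24019 * n * n * k + + 5273 * n * n * n

  bernstein₁>0 : ∀ n k → 0ℤ < n → 0ℤ ≤ + 25 * k - + 6 * n → 0ℤ < bernstein₁ n k
  bernstein₁>0 n k n>0 a≥0 = cancel-pos⁺ (pos {15624}) (by⁺
    (nn {18336} ⊗ a≥0 ⊗ a≥0 ⊗ a≥0 ⊕ nn {322848} ⊗ a≥0 ⊗ a≥0 ⊗ n≥0 ⊕ nn {1392013} ⊗ a≥0 ⊗ n≥0 ⊗ n≥0
      ⊕⁺ *-pos (*-pos (*-pos (pos {143250}) n>0) n>0) n>0)
    (solve 2 (λ n k →
        # 18336 :* (# 25 :* k :- # 6 :* n) :* (# 25 :* k :- # 6 :* n) :* (# 25 :* k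
        :- # 6 :* n) :+ # 322848 :* (# 25 :* k :- # 6 :* n) :* (# 25 :* k :- # 6 :* n) :* n
        :+ # 1392013 :* (# 25 :* k :- # 6 :* n) :* n :* n
        :+ # 143251 :* n :* n :* n
        := # 15625 :* (# 18336 :* k :* k :* k :- # 288 :* n :* k :* k :- # 803 :* n :* n :* k
        :- # 35 :* n :* n :* n)) refl n k))
    where n≥0 = <⇒≤ n>0

  -- The square vanishes at `k/n = 23/80`, close to where the cubic is smallest for positive `k`.
  bernstein₂>0 : ∀ n k → 0ℤ < n → 0ℤ ≤ k → 0ℤ ≤ n - + 2 * k → 0ℤ < bernstein₂ n k
  bernstein₂>0 n k n>0 k≥0 n≥2k = cancel-pos⁺ (pos {6399}) (by⁺
    ((nn {145248} ⊗ k≥0 ⊕ nn {62385} ⊗ n≥0) ⊗ sq≥0 (+ 80 * k - + 23 * n) ⊕ nn {3840} ⊗ n≥0 ⊗ k≥0 ⊗ k≥0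
      ⊕ nn {490496} ⊗ n≥2k ⊗ n≥0 ⊗ n≥0 ⊕⁺ *-pos (*-pos (*-pos (pos {255038}) n>0) n>0) n>0)
    (solve 2 (λ n k →
        (# 145248 :* k :+ # 62385 :* n) :* ((# 80 :* k :- # 23 :* n) :* (# 80 :* k :- # 23 :* n))
        :+ # 3840 :* n :* k :* k :+ # 490496 :* (n :- # 2 :* k) :* n :* n
        :+ # 255039 :* n :* n :* n
        := # 6400 :* (# 145248 :* k :* k :* k :- # 21132 :* n :* k :* k :- # 24019 :* n :* n :* k
        :+ # 5273 :* n :* n :* n)) refl n k))
    where n≥0 = <⇒≤ n>0

  -- D (18 D − n)² ≥ 0 bounds D³ below by a quadratic in D; bernstein₁ and bernstein₂ are Bernstein
  -- coefficients of that quadratic on 0 ≤ D ≤ n / 17.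
  P₃>0-large-k : ∀ n k D → 0ℤ < n → 0ℤ < k → 0ℤ < D → 0ℤ ≤ + 25 * k - + 6 * n →
    0ℤ ≤ n - + 2 * k → 0ℤ ≤ n - + 17 * D → 0ℤ < P₃ n k D
  P₃>0-large-k n k D n>0 k>0 D>0 a≥0 n≥2k v≥0 = 0<-by-contradiction λ r → clash
    (nn {576} ⊗ k≥0 ⊗ k≥0 ⊗ k≥0 ⊗ v≥0 ⊗ v≥0 ⊕ <⇒≤ (bernstein₁>0 n k n>0 a≥0) ⊗ v≥0 ⊗ D≥0
      ⊕ nn {35} ⊗ n≥0 ⊗ (n≥0 ⊕ k≥0) ⊗ D≥0 ⊗ sq≥0 (+ 18 * D - n) ⊕ nn {12} ⊗ n≥0 ⊗ r)
    (*-pos (*-pos (bernstein₂>0 n k n>0 k≥0 n≥2k) D>0) D>0)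
    (solve 3 (λ n k D →
        # 576 :* k :* k :* k :* (n :- # 17 :* D) :* (n :- # 17 :* D)
        :+ (# 18336 :* k :* k :* k :- # 288 :* n :* k :* k :- # 803 :* n :* n :* k
        :- # 35 :* n :* n :* n) :* (n :- # 17 :* D) :* D
        :+ # 35 :* n :* (n :+ k) :* D :* ((# 18 :* D :- n) :* (# 18 :* D :- n))
        :+ # 12 :* n :* (:- (# 48 :* n :* k :* k :* k :- k :* (# 64 :* n :* n :+ # 24 :* n :* k
        :+ # 104 :* k :* k) :* D :+ # 3 :* (n :+ k) :* (# 128 :* n :- # 451 :* k) :* D :* D :+ # 945 :* (n
        :+ k) :* D :* D :* D)) :+ (# 145248 :* k :* k :* k :- # 21132 :* n :* k :* k
        :- # 24019 :* n :* n :* k :+ # 5273 :* n :* n :* n) :* D :* D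
        := # 0) refl n k D)
    where
    k≥0 = <⇒≤ k>0
    n≥0 = <⇒≤ n>0
    D≥0 = <⇒≤ D>0

  P₃>0 : ∀ n k D → 0ℤ < n → 0ℤ < k → 0ℤ ≤ n - + 2 * k →
    0ℤ ≤ n * k - k * k - + 3 * (n + k) * D →
    D ≡ 0ℤ ⊎ (0ℤ < D) × (0ℤ ≤ + 5 * k - n - + 6 * D) → 0ℤ < P₃ n k D
  P₃>0 n k _ n>0 k>0 n≥2k cap (inj₁ refl) =
    by⁺ (*-pos (*-pos (*-pos (*-pos (pos {47}) n>0) k>0) k>0) k>0)
    (solve 2 (λ n k →
        # 48 :* n :* k :* k :* k
        := # 48 :* n :* k :* k :* k :- k :* (# 64 :* n :* n :+ # 24 :* n :* k
        :+ # 104 :* k :* k) :* # 0 :+ # 3 :* (n :+ k) :* (# 128 :* n :- # 451 :* k) :* # 0 :* # 0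
        :+ # 945 :* (n :+ k) :* # 0 :* # 0 :* # 0) refl n k)
  P₃>0 n k D n>0 k>0 n≥2k cap (inj₂ (D>0 , e≥0)) with 0ℤ ≤? + 6 * n - + 25 * k
  -- Below `k = 6n/25` the coefficient of `D²` is safely positive; beyond it the bound `D ≤ n/17`
  -- takes over.
  ... | yes a≥0 = P₃>0-small-k n k D n>0 k>0 (<⇒≤ D>0) a≥0 e≥0
  ... | no  a≱0 = P₃>0-large-k n k D n>0 k>0 D>0
    (by (<⇒≤ (neg-mono-< (≰⇒> a≱0))) (solve 2 (λ n k → :- (# 6 :* n :- # 25 :* k) := # 25 :* k :- # 6 :* n) refl n k))
    n≥2k (17D≤n n k D n>0 (<⇒≤ n>0 ⊕ <⇒≤ k>0) cap)

  -- `F₂` bounds `T` from below, and the weight `16K + 64D` matches the coefficient of `T` in `C₂`,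
  -- so `T` cancels and minus `P₃` remains. `G₂` and `F₂` together squeeze `T`, which after division
  -- by `d` caps `D`.
  high-degree-arithmetic : ∀ n d D T → 0ℤ < n → 0ℤ < d → 0ℤ ≤ D →
    0ℤ ≤ + 2 * d - n → 0ℤ < + 2 * n - + 3 * d → 0ℤ ≤ + 2 * n - + 3 * d - D → 0ℤ ≤ n - d →
    D ≡ 0ℤ ⊎ (0ℤ < D) × (0ℤ ≤ + 3 * n - + 5 * d - + 2 * D) →
    0ℤ ≤ + 9 * T * (n - d) - n * n * d →
    0ℤ ≤ d * (d - D) - + 2 * T →
    (let K = + 2 * n - + 3 * d - D in
     0ℤ ≤ + 9 * (D * (+ 8 * K * K + + 32 * (d - D) * (d - D) - + 64 * T + + 128 * D * K) + + 17 * K * D * D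
                - + 16 * K * T) - + 16 * K * (+ 4 * n * n - + 9 * d * n)) → ⊥
  high-degree-arithmetic n d D T n>0 d>0 D≥0 2d≥n k>0 K≥0 z≥0 D-cases F₂ G₂ C₂ =
    clash (nn {3} ⊗ (z≥0 ⊗ C₂ ⊕ (nn {16} ⊗ K≥0 ⊕ nn {64} ⊗ D≥0) ⊗ F₂))
      (P₃>0 n (+ 2 * n - + 3 * d) D n>0 k>0
        (by (nn {3} ⊗ 2d≥n) (solve 2 (λ n d → # 3 :* (# 2 :* d :- n) := n :- # 2 :* (# 2 :* n :- # 3 :* d)) refl n d))
        (cancel-pos d>0 (by (nn {9} ⊗ z≥0 ⊗ G₂ ⊕ nn {2} ⊗ F₂)
          (solve 4 (λ n d D T →
              # 9 :* (n :- d) :* (d :* (d :- D) :- # 2 :* T)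
              :+ # 2 :* (# 9 :* T :* (n :- d) :- n :* n :* d)
              := d :* (n :* (# 2 :* n :- # 3 :* d) :- (# 2 :* n :- # 3 :* d) :* (# 2 :* n :- # 3 :* d)
              :- # 3 :* (n :+ (# 2 :* n :- # 3 :* d)) :* D)) refl n d D T)))
        (map₂ (map₂′ λ e → by (nn {3} ⊗ e)
          (solve 3 (λ n d D →
              # 3 :* (# 3 :* n :- # 5 :* d :- # 2 :* D)
              := # 5 :* (# 2 :* n :- # 3 :* d) :- n :- # 6 :* D) refl n d D)) D-cases))
    (solve 4 (λ n d D T →
        # 3 :* ((n :- d) :* (# 9 :* (D :* (# 8 :* (# 2 :* n :- # 3 :* d :- D) :* (# 2 :* n :- # 3 :* d
        :- D) :+ # 32 :* (d :- D) :* (d :- D) :- # 64 :* T :+ # 128 :* D :* (# 2 :* n :- # 3 :* d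
        :- D)) :+ # 17 :* (# 2 :* n :- # 3 :* d :- D) :* D :* D :- # 16 :* (# 2 :* n :- # 3 :* d
        :- D) :* T) :- # 16 :* (# 2 :* n :- # 3 :* d :- D) :* (# 4 :* n :* n :- # 9 :* d :* n))
        :+ (# 16 :* (# 2 :* n :- # 3 :* d :- D) :+ # 64 :* D) :* (# 9 :* T :* (n :- d) :- n :* n :* d))
        :+ (# 48 :* n :* (# 2 :* n :- # 3 :* d) :* (# 2 :* n :- # 3 :* d) :* (# 2 :* n :- # 3 :* d)
        :- (# 2 :* n :- # 3 :* d) :* (# 64 :* n :* n :+ # 24 :* n :* (# 2 :* n :- # 3 :* d) :+ # 104 :* (# 2 :* n
        :- # 3 :* d) :* (# 2 :* n :- # 3 :* d)) :* D :+ # 3 :* (n :+ (# 2 :* n :- # 3 :* d)) :* (# 128 :* n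
        :- # 451 :* (# 2 :* n :- # 3 :* d)) :* D :* D :+ # 945 :* (n :+ (# 2 :* n :- # 3 :* d)) :* D :* D :* D)
        := # 0) refl n d D T)

-- Finite sums, Cauchy-Schwarz and symmetric bilinear forms.

module QuadraticForms where

  open import Data.Empty using (⊥-elim)
  open import Data.Fin as Fin using (Fin; zero; suc)
  open import Data.Integer hiding (suc; _*_; pos)
  open import Data.Integer.Properties hiding (_≟_)
  import Data.Nat as ℕ
  open ℕ using (ℕ)
  open import Data.Product using (_,_)
  open import Function using (_∘_)
  open import Relation.Binary.PropositionalEquality
  open IntegerIdentities
  open Inequalities

  open import Algebra.Properties.CommutativeMonoid.Sum +-0-commutativeMonoid public
    using (sum; sum-cong-≗; ∑-distrib-+; ∑-comm)

  private variable n : ℕ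

  sum-*ˡ : ∀ c (f : Fin n → ℤ) → sum (λ i → c * f i) ≡ c * sum f
  sum-*ˡ {ℕ.zero}  c f = (solve 1 (λ c → # 0 := c :* # 0) refl c)
  sum-*ˡ {ℕ.suc n} c f = trans (cong (λ t → c * f zero + t) (sum-*ˡ c (f ∘ suc)))
    let x = f zero; y = sum (f ∘ suc) in (solve 3 (λ c x y → c :* x :+ c :* y := c :* (x :+ y)) refl c x y)

  sum-*ʳ : ∀ c (f : Fin n → ℤ) → sum (λ i → f i * c) ≡ sum f * c
  sum-*ʳ c f = trans (sum-cong-≗ λ i → *-swap (f i) c) (trans (sum-*ˡ c f) (*-swap c (sum f)))
    where
    *-swap : ∀ x y → x * y ≡ y * x
    *-swap = solve 2 (λ x y → x :* y := y :* x) refl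

  sum-≥0 : (f : Fin n → ℤ) → (∀ i → 0ℤ ≤ f i) → 0ℤ ≤ sum f
  sum-≥0 {ℕ.zero}  f p = ≤-refl
  sum-≥0 {ℕ.suc n} f p = p zero ⊕ sum-≥0 (f ∘ suc) (p ∘ suc)

  sum-const : ∀ n c → sum {n} (λ _ → c) ≡ + n * c
  sum-const ℕ.zero c = (solve 1 (λ c → # 0 := # 0 :* c) refl c)
  sum-const (ℕ.suc n) c = trans (cong (λ t → c + t) (sum-const n c)) (lem (+ n))
    where
    lem : ∀ m → c + m * c ≡ (1ℤ + m) * c
    lem m = (solve 2 (λ m c → c :+ m :* c := (# 1 :+ m) :* c) refl m c)

  -- Every test vector is a combination of at most three functions; shorter ones are padded with the
  -- coefficient `0ℤ`, longer sums nest.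
  sum-lin : ∀ x y z (f g h : Fin n → ℤ) →
    sum (λ i → x * f i + y * g i + z * h i) ≡ x * sum f + y * sum g + z * sum h
  sum-lin x y z f g h = trans (∑-distrib-+ (λ i → x * f i + y * g i) (λ i → z * h i))
    (cong₂ _+_ (trans (∑-distrib-+ (λ i → x * f i) (λ i → y * g i)) (cong₂ _+_ (sum-*ˡ x f) (sum-*ˡ y g)))
               (sum-*ˡ z h))

  sum-diff : (f g : Fin n → ℤ) → sum (λ i → g i - f i) ≡ sum g - sum f
  sum-diff f g = trans (sum-cong-≗ λ i → lem₁ (f i) (g i))
    (trans (sum-lin 1ℤ -1ℤ 0ℤ g f f) (lem₂ (sum f) (sum g)))
    where
    lem₁ : ∀ x y → y - x ≡ 1ℤ * y + -1ℤ * x + 0ℤ * x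
    lem₁ = solve 2 (λ x y → y :- x := # 1 :* y :+ (:- # 1) :* x :+ # 0 :* x) refl
    lem₂ : ∀ x y → 1ℤ * y + -1ℤ * x + 0ℤ * x ≡ y - x
    lem₂ x y = sym (lem₁ x y)

  sum-mono : (f g : Fin n → ℤ) → (∀ i → 0ℤ ≤ g i - f i) → 0ℤ ≤ sum g - sum f
  sum-mono f g p = by (sum-≥0 _ p) (sum-diff f g)

  δ : Fin n → Fin n → ℤ
  δ zero    zero    = 1ℤ
  δ zero    (suc j) = 0ℤ
  δ (suc i) zero    = 0ℤ
  δ (suc i) (suc j) = δ i j

  δ-diag : (i : Fin n) → δ i i ≡ 1ℤ
  δ-diag zero    = refl
  δ-diag (suc i) = δ-diag i

  δ-off : {i j : Fin n} → i ≢ j → δ i j ≡ 0ℤ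
  δ-off {i = zero}  {zero}  p = ⊥-elim (p refl)
  δ-off {i = zero}  {suc j} p = refl
  δ-off {i = suc i} {zero}  p = refl
  δ-off {i = suc i} {suc j} p = δ-off (p ∘ cong suc)

  sum-δ : (i : Fin n) (f : Fin n → ℤ) → sum (λ j → δ i j * f j) ≡ f i
  sum-δ {ℕ.suc n} zero f = trans (cong (λ t → 1ℤ * f zero + t) (trans (sum-*ˡ 0ℤ (f ∘ suc)) (lem₀ (sum (f ∘ suc))))) (lem (f zero))
    where
    lem₀ : ∀ x → 0ℤ * x ≡ 0ℤ
    lem₀ = solve 1 (λ x → # 0 :* x := # 0) refl
    lem : ∀ x → 1ℤ * x + 0ℤ ≡ x
    lem = solve 1 (λ x → # 1 :* x :+ # 0 := x) refl
  sum-δ (suc i) f = trans (cong₂ _+_ (lem (f zero)) (sum-δ i (f ∘ suc))) (+-identityˡ _)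
    where
    lem : ∀ x → 0ℤ * x ≡ 0ℤ
    lem = solve 1 (λ x → # 0 :* x := # 0) refl

  ⟨_,_⟩ : (Fin n → ℤ) → (Fin n → ℤ) → ℤ
  ⟨ f , g ⟩ = sum λ v → f v * g v

  ⟨⟩-comm : (f g : Fin n → ℤ) → ⟨ f , g ⟩ ≡ ⟨ g , f ⟩
  ⟨⟩-comm f g = sum-cong-≗ λ v → lem (f v) (g v)
    where
    lem : ∀ x y → x * y ≡ y * x
    lem = solve 2 (λ x y → x :* y := y :* x) refl

  ⟨⟩-cong : {f f′ g g′ : Fin n → ℤ} → (∀ v → f v ≡ f′ v) → (∀ v → g v ≡ g′ v) → ⟨ f , g ⟩ ≡ ⟨ f′ , g′ ⟩
  ⟨⟩-cong p q = sum-cong-≗ λ v → cong₂ _*_ (p v) (q v)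

  ⟨⟩-linˡ : ∀ x y z (f g h k : Fin n → ℤ) →
    ⟨ (λ v → x * f v + y * g v + z * h v) , k ⟩ ≡ x * ⟨ f , k ⟩ + y * ⟨ g , k ⟩ + z * ⟨ h , k ⟩
  ⟨⟩-linˡ x y z f g h k = trans (sum-cong-≗ λ v → lem (f v) (g v) (h v) (k v))
    (sum-lin x y z (λ v → f v * k v) (λ v → g v * k v) (λ v → h v * k v))
    where
    lem : ∀ f g h k → (x * f + y * g + z * h) * k ≡ x * (f * k) + y * (g * k) + z * (h * k)
    lem f g h k = (solve 7 (λ x y z f g h k →
        (x :* f :+ y :* g :+ z :* h) :* k
        := x :* (f :* k) :+ y :* (g :* k) :+ z :* (h :* k)) refl x y z f g h k)

  𝟏 : Fin n → ℤ
  𝟏 _ = 1ℤ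

  ⟨⟩-𝟏 : (f : Fin n → ℤ) → ⟨ f , 𝟏 ⟩ ≡ sum f
  ⟨⟩-𝟏 f = sum-cong-≗ λ v → lem (f v)
    where
    lem : ∀ x → x * 1ℤ ≡ x
    lem = solve 1 (λ x → x :* # 1 := x) refl

  -- This is the expansion of the weighted sum of `(H g - N)²`. Keeping the outer factor `sum h`
  -- avoids assuming that the total weight is positive.
  cauchy-schwarz : (h g : Fin n → ℤ) → (∀ v → 0ℤ ≤ h v) →
    0ℤ ≤ sum h * (sum h * ⟨ h , (λ v → g v * g v) ⟩ - ⟨ h , g ⟩ * ⟨ h , g ⟩)
  cauchy-schwarz h g h≥0 = by (sum-≥0 _ λ v → h≥0 v ⊗ sq≥0 (H * g v - N))
    (trans (sum-cong-≗ λ v → lem₁ (h v) (g v)) (trans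
      (sum-lin (H * H) (- (+ 2 * H * N)) (N * N) (λ v → h v * (g v * g v)) (λ v → h v * g v) h) lem₂))
    where
    H = sum h
    N = ⟨ h , g ⟩
    Q = ⟨ h , (λ v → g v * g v) ⟩
    lem₁ : ∀ h g → h * ((H * g - N) * (H * g - N)) ≡ H * H * (h * (g * g)) + (- (+ 2 * H * N)) * (h * g) + N * N * h
    lem₁ h g = (solve 4 (λ H N h g →
        h :* ((H :* g :- N) :* (H :* g :- N))
        := H :* H :* (h :* (g :* g)) :+ (:- (# 2 :* H :* N)) :* (h :* g)
        :+ N :* N :* h) refl H N h g)
    lem₂ : H * H * Q + (- (+ 2 * H * N)) * N + N * N * H ≡ H * (H * Q - N * N)
    lem₂ = (solve 3 (λ H N Q →
        H :* H :* Q :+ (:- (# 2 :* H :* N)) :* N :+ N :* N :* H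
        := H :* (H :* Q :- N :* N)) refl H N Q)

  module Form {n} (a : Fin n → Fin n → ℤ) (a-sym : ∀ u v → a u v ≡ a v u) where

    𝐀 : (Fin n → ℤ) → Fin n → ℤ
    𝐀 f v = sum λ u → a v u * f u

    -- For an adjacency matrix and the indicator of a set, `B` counts each spanned edge twice, so
    -- the density hypothesis becomes `9 B ≥ n²`.
    B : (Fin n → ℤ) → (Fin n → ℤ) → ℤ
    B f g = ⟨ f , 𝐀 g ⟩

    B-sym : ∀ f g → B f g ≡ B g f
    B-sym f g = trans (sum-cong-≗ λ u → sym (sum-*ˡ (f u) (λ v → a u v * g v)))
      (trans (∑-comm λ u v → f u * (a u v * g v))
        (sum-cong-≗ λ v → trans (sum-cong-≗ λ u → trans (cong (λ w → f u * (w * g v)) (a-sym u v))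
          (lem (f u) (a v u) (g v))) (sum-*ˡ (g v) (λ u → a v u * f u))))
      where
      lem : ∀ x y z → x * (y * z) ≡ z * (y * x)
      lem = solve 3 (λ x y z → x :* (y :* z) := z :* (y :* x)) refl

    𝐀-cong : ∀ {f g} → (∀ v → f v ≡ g v) → ∀ v → 𝐀 f v ≡ 𝐀 g v
    𝐀-cong p v = sum-cong-≗ λ u → cong (a v u *_) (p u)

    𝐀-lin : ∀ x y z f g h v → 𝐀 (λ w → x * f w + y * g w + z * h w) v ≡ x * 𝐀 f v + y * 𝐀 g v + z * 𝐀 h v
    𝐀-lin x y z f g h v = trans (sum-cong-≗ λ u → lem (a v u) (f u) (g u) (h u))
      (sum-lin x y z (λ u → a v u * f u) (λ u → a v u * g u) (λ u → a v u * h u))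
      where
      lem : ∀ k f g h → k * (x * f + y * g + z * h) ≡ x * (k * f) + y * (k * g) + z * (k * h)
      lem k f g h = (solve 7 (λ x y z f g h k →
          k :* (x :* f :+ y :* g :+ z :* h)
          := x :* (k :* f) :+ y :* (k :* g) :+ z :* (k :* h)) refl x y z f g h k)

    B-cong : ∀ {f f′ g g′} → (∀ v → f v ≡ f′ v) → (∀ v → g v ≡ g′ v) → B f g ≡ B f′ g′
    B-cong p q = ⟨⟩-cong p (𝐀-cong q)

    B-linˡ : ∀ x y z f g h k →
      B (λ v → x * f v + y * g v + z * h v) k ≡ x * B f k + y * B g k + z * B h k
    B-linˡ x y z f g h k = ⟨⟩-linˡ x y z f g h (𝐀 k)

    B-linʳ : ∀ x y z f g h k →
      B k (λ v → x * f v + y * g v + z * h v) ≡ x * B k f + y * B k g + z * B k h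
    B-linʳ x y z f g h k = trans (B-sym k _) (trans (B-linˡ x y z f g h k)
      (cong₂ _+_ (cong₂ _+_ (cong (x *_) (B-sym f k)) (cong (y *_) (B-sym g k))) (cong (z *_) (B-sym h k))))

    B-square : ∀ x y z f g h → let w = λ v → x * f v + y * g v + z * h v in
      B w w ≡ x * x * B f f + y * y * B g g + z * z * B h h
              + + 2 * x * y * B f g + + 2 * x * z * B f h + + 2 * y * z * B g h
    B-square x y z f g h = trans (B-linˡ x y z f g h _)
      (trans (cong₂ _+_ (cong₂ _+_ (cong (x *_) (B-linʳ x y z f g h f)) (cong (y *_)
          (trans (B-linʳ x y z f g h g) (cong (λ t → x * t + y * B g g + z * B g h) (B-sym g f)))))
          (cong (z *_) (trans (B-linʳ x y z f g h h)
            (cong₂ (λ s t → x * s + y * t + z * B h h) (B-sym h f) (B-sym h g)))))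
        (lem (B f f) (B g g) (B h h) (B f g) (B f h) (B g h)))
      where
      lem : ∀ p q r s t u → x * (x * p + y * s + z * t) + y * (x * s + y * q + z * u) + z * (x * t + y * u + z * r)
        ≡ x * x * p + y * y * q + z * z * r + + 2 * x * y * s + + 2 * x * z * t + + 2 * y * z * u
      lem p q r s t u = (solve 9 (λ x y z p q r s t u →
          x :* (x :* p :+ y :* s :+ z :* t) :+ y :* (x :* s :+ y :* q :+ z :* u)
          :+ z :* (x :* t :+ y :* u :+ z :* r)
          := x :* x :* p :+ y :* y :* q :+ z :* z :* r
          :+ # 2 :* x :* y :* s :+ # 2 :* x :* z :* t
          :+ # 2 :* y :* z :* u) refl x y z p q r s t u)

    B-square-at : ∀ x y z f g h {p q r s t u} → B f f ≡ p → B g g ≡ q → B h h ≡ r →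
      B f g ≡ s → B f h ≡ t → B g h ≡ u → let w = λ v → x * f v + y * g v + z * h v in
      B w w ≡ x * x * p + y * y * q + z * z * r + + 2 * x * y * s + + 2 * x * z * t + + 2 * y * z * u
    B-square-at x y z f g h refl refl refl refl refl refl = B-square x y z f g h

-- From sets of half the vertices to fractional vectors.

module Halves where

  open import Data.Bool using (Bool; true; false; if_then_else_)
  open import Data.Empty using (⊥; ⊥-elim)
  open import Data.Fin as Fin using (Fin; zero; suc)
  import Data.Fin.Properties as Fin
  open import Data.Integer hiding (suc; _*_; pos)
  open import Data.Integer.Properties
  open import Data.Nat as ℕ using (ℕ; ⌊_/2⌋)
  import Data.Nat.Properties as ℕ
  open import Data.Product using (_×_; _,_; ∃-syntax; proj₁; proj₂)
  open import Data.Sum using (_⊎_; inj₁; inj₂)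
  open import Function using (_∘_)
  open import Relation.Binary.PropositionalEquality
  open import Relation.Nullary using (¬_; Dec; yes; no; does)
  open import Relation.Nullary.Decidable using (_×-dec_; ¬?; dec-true; dec-false)
  open IntegerIdentities
  open Inequalities
  open QuadraticForms

  ind : Bool → ℤ
  ind true  = 1ℤ
  ind false = 0ℤ

  count : ∀ {n} → (Fin n → Bool) → ℕ
  count {ℕ.zero}  b = 0
  count {ℕ.suc n} b = (if b zero then 1 else 0) ℕ.+ count (b ∘ suc)

  sum-ind : ∀ {n} (b : Fin n → Bool) → sum (ind ∘ b) ≡ + count b
  sum-ind {ℕ.zero}  b = refl
  sum-ind {ℕ.suc n} b with b zero
  ... | true  = cong (λ t → 1ℤ + t) (sum-ind (b ∘ suc))
  ... | false = trans (+-identityˡ _) (sum-ind (b ∘ suc))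

  ≤-by : ∀ {x y} → 0ℤ ≤ y - x → x ≤ y
  ≤-by {x} {y} = 0≤i-j⇒j≤i

  half-unique : ∀ m s → 0ℤ ≤ + m - + 2 * + s → 0ℤ < + 2 - (+ m - + 2 * + s) → s ≡ ⌊ m /2⌋
  half-unique m s p q with ℕ.m≤n⇒m<n∨m≡n 2s≤m
    where
    2s≤m : s ℕ.+ s ℕ.≤ m
    2s≤m = drop‿+≤+ (≤-by (by p (let M = + m; S = + s in (solve 2 (λ M S → M :- # 2 :* S := M :- (S :+ S)) refl M S))))
  ... | inj₂ e = trans (ℕ.n≡⌊n+n/2⌋ s) (cong ⌊_/2⌋ e)
  ... | inj₁ l = trans (ℕ.n≡⌈n+n/2⌉ s) (cong ⌊_/2⌋ (ℕ.≤-antisym l m≤1+2s))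
    where
    m≤1+2s : m ℕ.≤ ℕ.suc (s ℕ.+ s)
    m≤1+2s = ℕ.≤-pred (drop‿+<+ (≤-<-trans (≤-by (by ≤-refl (let M = + m in (solve 1 (λ M → # 0 := M :- M) refl M))))
      (subst (+ m <_) (let M = + m; S = + s in (solve 2 (λ M S → M :+ (# 2 :- (M :- # 2 :* S)) := # 1 :+ (# 1 :+ (S :+ S))) refl M S))
        (subst (_< + m + (+ 2 - (+ m - + 2 * + s))) (+-identityʳ (+ m)) (+-monoʳ-< (+ m) q)))))

  module Rounding {n} (a : Fin n → Fin n → ℤ) (a-sym : ∀ u v → a u v ≡ a v u)
    (a≥0 : ∀ u v → 0ℤ ≤ a u v) (a-irrefl : ∀ u → a u u ≡ 0ℤ)
    (d : ℤ) (regular : ∀ u → sum (a u) ≡ d) where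

    open Form a a-sym public

    N : ℤ
    N = + n

    𝐀-𝟏 : ∀ v → 𝐀 𝟏 v ≡ d
    𝐀-𝟏 v = trans (⟨⟩-𝟏 (a v)) (regular v)

    B-𝟏 : ∀ f → B f 𝟏 ≡ d * sum f
    B-𝟏 f = trans (⟨⟩-cong {f = f} (λ _ → refl) 𝐀-𝟏) (trans (sum-*ʳ d f) (lem (sum f)))
      where
      lem : ∀ s → s * d ≡ d * s
      lem s = (solve 2 (λ s d → s :* d := d :* s) refl s d)

    sum-𝟏 : sum {n} 𝟏 ≡ N
    sum-𝟏 = trans (sum-const n 1ℤ) (lem N)
      where
      lem : ∀ x → x * 1ℤ ≡ x
      lem = solve 1 (λ x → x :* # 1 := x) refl

    -- The difference splits into `g (𝐀 g - 𝐀 f)` and `(g - f) 𝐀 f`, both nonnegative because the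
    -- matrix has nonnegative entries.
    B-mono : ∀ f g → (∀ v → 0ℤ ≤ f v) → (∀ v → 0ℤ ≤ g v - f v) → 0ℤ ≤ B g g - B f f
    B-mono f g p q = sum-mono _ _ λ v →
      by (((q v ⊕ p v) ⊗ (sum-mono _ _ λ u → by (a≥0 v u ⊗ q u) (lem₁ (a v u) (f u) (g u)))) ⊕
          (q v ⊗ sum-≥0 _ λ u → a≥0 v u ⊗ p u)) (lem₂ (f v) (g v) (𝐀 f v) (𝐀 g v))
      where
      lem₁ : ∀ a x y → a * (y - x) ≡ a * y - a * x
      lem₁ = solve 3 (λ a x y → a :* (y :- x) := a :* y :- a :* x) refl
      lem₂ : ∀ f g F G → (g - f + f) * (G - F) + (g - f) * F ≡ g * G - f * F
      lem₂ = solve 4 (λ f g F G → (g :- f :+ f) :* (G :- F) :+ (g :- f) :* F := g :* G :- f :* F) refl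

    B-δ : ∀ i f → B (δ i) f ≡ 𝐀 f i
    B-δ i f = sum-δ i (𝐀 f)

    B-δδ : ∀ i j → B (δ i) (δ j) ≡ a i j
    B-δδ i j = trans (B-δ i (δ j)) (trans (⟨⟩-comm (a i) (δ j)) (sum-δ j (a i)))

    module _ (sparse : ∀ (b : Fin n → Bool) → count b ≡ ⌊ n /2⌋ →
                0ℤ ≤ + 9 * B (ind ∘ b) (ind ∘ b) - N * N)
             (L : ℤ) (L>0 : 0ℤ < L) where

      Admissible : (Fin n → ℤ) → Set
      Admissible x = (∀ v → 0ℤ ≤ L - x v) × (∀ v → 0ℤ ≤ L + x v) × sum x ≡ 0ℤ

      -- For even `n` and `x = L(2s - 1)` with `s` the indicator of a half, regularity gives
      -- `B x x = L²(4 B s s - dn)`, so the left side is exactly `4L²(9 B s s - n²)`.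
      Goal : (Fin n → ℤ) → Set
      Goal x = 0ℤ ≤ + 9 * B x x + + 9 * d * N * L * L - + 4 * N * N * L * L

      Fractional : ℤ → Set
      Fractional t = (t ≢ L) × (t ≢ - L)

      fractional? : ∀ t → Dec (Fractional t)
      fractional? t = ¬? (t ≟ L) ×-dec ¬? (t ≟ - L)

      frac : ℤ → ℤ
      frac t = ind (does (fractional? t))

      frac≥0 : ∀ t → 0ℤ ≤ frac t
      frac≥0 t with does (fractional? t)
      ... | true  = nn
      ... | false = nn

      frac-yes : ∀ {t} → Fractional t → frac t ≡ 1ℤ
      frac-yes {t} p = cong ind (dec-true (fractional? t) p)

      frac-no : ∀ {t} → ¬ Fractional t → frac t ≡ 0ℤ
      frac-no {t} p = cong ind (dec-false (fractional? t) p)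

      frac≤1 : ∀ t → 0ℤ ≤ 1ℤ - frac t
      frac≤1 t with does (fractional? t)
      ... | true  = nn
      ... | false = nn

      -- B is concave along δ i − δ j, so weight can be shifted between two fractional vertices until
      -- one of them is extreme.
      shift : (Fin n → ℤ) → ℤ → Fin n → Fin n → Fin n → ℤ
      shift x τ i j v = 1ℤ * x v + τ * δ i v + (- τ) * δ j v

      module Shift (x : Fin n → ℤ) (τ : ℤ) (i j : Fin n) (i≢j : i ≢ j) where

        at-i : shift x τ i j i ≡ x i + τ
        at-i rewrite δ-diag i | δ-off (i≢j ∘ sym) = lem (x i)
          where
          lem : ∀ y → 1ℤ * y + τ * 1ℤ + (- τ) * 0ℤ ≡ y + τ
          lem y = (solve 2 (λ y τ → # 1 :* y :+ τ :* # 1 :+ (:- τ) :* # 0 := y :+ τ) refl y τ)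

        at-j : shift x τ i j j ≡ x j - τ
        at-j rewrite δ-diag j | δ-off i≢j = lem (x j)
          where
          lem : ∀ y → 1ℤ * y + τ * 0ℤ + (- τ) * 1ℤ ≡ y - τ
          lem y = (solve 2 (λ y τ → # 1 :* y :+ τ :* # 0 :+ (:- τ) :* # 1 := y :- τ) refl y τ)

        elsewhere : ∀ {v} → i ≢ v → j ≢ v → shift x τ i j v ≡ x v
        elsewhere {v} p q rewrite δ-off p | δ-off q = lem (x v)
          where
          lem : ∀ y → 1ℤ * y + τ * 0ℤ + (- τ) * 0ℤ ≡ y
          lem y = (solve 2 (λ y τ → # 1 :* y :+ τ :* # 0 :+ (:- τ) :* # 0 := y) refl y τ)

        cases : (P : Fin n → ℤ → Set) → P i (x i + τ) → P j (x j - τ) →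
          (∀ {v} → i ≢ v → j ≢ v → P v (x v)) → ∀ v → P v (shift x τ i j v)
        cases P p q r v with i Fin.≟ v | j Fin.≟ v
        ... | yes refl | _        = subst (P i) (sym at-i) p
        ... | no _     | yes refl = subst (P j) (sym at-j) q
        ... | no s     | no t     = subst (P v) (sym (elsewhere s t)) (r s t)

        sum-shift : sum (shift x τ i j) ≡ sum x
        sum-shift = trans (sum-lin 1ℤ τ (- τ) x (δ i) (δ j))
          (trans (cong₂ (λ s t → 1ℤ * sum x + τ * s + (- τ) * t) (sum-δ₁ i) (sum-δ₁ j)) (lem (sum x)))
          where
          sum-δ₁ : ∀ k → sum (δ k) ≡ 1ℤ
          sum-δ₁ k = trans (sym (⟨⟩-𝟏 (δ k))) (sum-δ k 𝟏)
          lem : ∀ y → 1ℤ * y + τ * 1ℤ + (- τ) * 1ℤ ≡ y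
          lem y = (solve 2 (λ y τ → # 1 :* y :+ τ :* # 1 :+ (:- τ) :* # 1 := y) refl y τ)

        -- The form changes by `2τ(𝐀 x i - 𝐀 x j) - 2τ² a i j`, as the diagonal of `a` vanishes.
        -- Only the linear part depends on the direction of the shift, so one of the two directions
        -- always works.
        B-shift : 0ℤ ≤ τ → 0ℤ ≤ 𝐀 x j - 𝐀 x i → 0ℤ ≤ B x x - B (shift x τ i j) (shift x τ i j)
        B-shift τ≥0 p = by (nn {2} ⊗ τ≥0 ⊗ p ⊕ nn {2} ⊗ τ≥0 ⊗ τ≥0 ⊗ a≥0 i j)
          (trans (lem (B x x) (𝐀 x i) (𝐀 x j) (a i j)) (cong (λ t → B x x - t) (sym eq)))
          where
          eq : B (shift x τ i j) (shift x τ i j) ≡ 1ℤ * 1ℤ * B x x + τ * τ * 0ℤ + (- τ) * (- τ) * 0ℤ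
                + + 2 * 1ℤ * τ * 𝐀 x i + + 2 * 1ℤ * (- τ) * 𝐀 x j + + 2 * τ * (- τ) * a i j
          eq = B-square-at 1ℤ τ (- τ) x (δ i) (δ j) refl (trans (B-δδ i i) (a-irrefl i))
            (trans (B-δδ j j) (a-irrefl j)) (trans (B-sym x (δ i)) (B-δ i x))
            (trans (B-sym x (δ j)) (B-δ j x)) (B-δδ i j)
          lem : ∀ b p q r → + 2 * τ * (q - p) + + 2 * τ * τ * r ≡ b - (1ℤ * 1ℤ * b + τ * τ * 0ℤ + (- τ) * (- τ) * 0ℤ
                + + 2 * 1ℤ * τ * p + + 2 * 1ℤ * (- τ) * q + + 2 * τ * (- τ) * r)
          lem b p q r = (solve 5 (λ τ b p q r →
              # 2 :* τ :* (q :- p) :+ # 2 :* τ :* τ :* r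
              := b :- (# 1 :* # 1 :* b :+ τ :* τ :* # 0 :+ (:- τ) :* (:- τ) :* # 0
              :+ # 2 :* # 1 :* τ :* p :+ # 2 :* # 1 :* (:- τ) :* q :+ # 2 :* τ :* (:- τ) :* r)) refl τ b p q r)

        -- Coordinates other than `i` and `j` keep their status, and the one that becomes extreme,
        -- `e`, accounts for the 1.
        frac-drop : Fractional (x i) → Fractional (x j) → ¬ Fractional (x i + τ) ⊎ ¬ Fractional (x j - τ) →
          0ℤ ≤ sum (frac ∘ x) - (1ℤ + sum (frac ∘ shift x τ i j))
        frac-drop fi fj tight = by (sum-mono (λ v → 1ℤ * δ e v + 1ℤ * frac (shift x τ i j v) + 0ℤ * 0ℤ) (frac ∘ x)
            (cases (λ v t → 0ℤ ≤ frac (x v) - (1ℤ * δ e v + 1ℤ * frac t + 0ℤ * 0ℤ)) (pi tight) (pj tight) pv))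
          (cong (λ t → sum (frac ∘ x) - t) (trans (sum-lin 1ℤ 1ℤ 0ℤ (δ e) (frac ∘ shift x τ i j) (λ _ → 0ℤ))
            (trans (cong (λ t → 1ℤ * t + 1ℤ * sum (frac ∘ shift x τ i j) + 0ℤ * sum {n} (λ _ → 0ℤ))
              (trans (sym (⟨⟩-𝟏 (δ e))) (sum-δ e 𝟏))) (lem₀ (sum (frac ∘ shift x τ i j)) (sum {n} (λ _ → 0ℤ))))))
          where
          pick : ¬ Fractional (x i + τ) ⊎ ¬ Fractional (x j - τ) → Fin n
          pick (inj₁ _) = i
          pick (inj₂ _) = j
          e = pick tight
          lem₀ : ∀ s z → 1ℤ * 1ℤ + 1ℤ * s + 0ℤ * z ≡ 1ℤ + s
          lem₀ = solve 2 (λ s z → # 1 :* # 1 :+ # 1 :* s :+ # 0 :* z := # 1 :+ s) refl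
          tight-case : ∀ {p q r} → p ≡ 1ℤ → q ≡ 1ℤ → r ≡ 0ℤ → 0ℤ ≤ p - (1ℤ * q + 1ℤ * r + 0ℤ * 0ℤ)
          tight-case refl refl refl = by ≤-refl lem₁
            where
            lem₁ : 0ℤ ≡ 1ℤ - (1ℤ * 1ℤ + 1ℤ * 0ℤ + 0ℤ * 0ℤ)
            lem₁ = (solve 0 (# 0 := # 1 :- (# 1 :* # 1 :+ # 1 :* # 0 :+ # 0 :* # 0)) refl)
          loose-case : ∀ {p q r} → p ≡ 1ℤ → q ≡ 0ℤ → 0ℤ ≤ 1ℤ - r → 0ℤ ≤ p - (1ℤ * q + 1ℤ * r + 0ℤ * 0ℤ)
          loose-case {r = r} refl refl l = by l (solve 1 (λ r → # 1 :- r := # 1 :- (# 1 :* # 0 :+ # 1 :* r :+ # 0 :* # 0)) refl r)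
          pi : ∀ c → 0ℤ ≤ frac (x i) - (1ℤ * δ (pick c) i + 1ℤ * frac (x i + τ) + 0ℤ * 0ℤ)
          pi (inj₁ c) = tight-case (frac-yes fi) (δ-diag i) (frac-no c)
          pi (inj₂ c) = loose-case (frac-yes fi) (δ-off (i≢j ∘ sym)) (frac≤1 (x i + τ))
          pj : ∀ c → 0ℤ ≤ frac (x j) - (1ℤ * δ (pick c) j + 1ℤ * frac (x j - τ) + 0ℤ * 0ℤ)
          pj (inj₁ c) = loose-case (frac-yes fj) (δ-off i≢j) (frac≤1 (x j - τ))
          pj (inj₂ c) = tight-case (frac-yes fj) (δ-diag j) (frac-no c)
          pick-≢ : ∀ {v} c → i ≢ v → j ≢ v → pick c ≢ v
          pick-≢ (inj₁ _) p q = p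
          pick-≢ (inj₂ _) p q = q
          pv : ∀ {v} → i ≢ v → j ≢ v → 0ℤ ≤ frac (x v) - (1ℤ * δ e v + 1ℤ * frac (x v) + 0ℤ * 0ℤ)
          pv {v} p q rewrite δ-off (pick-≢ tight p q) = by ≤-refl (lem₂ (frac (x v)))
            where
            lem₂ : ∀ t → 0ℤ ≡ t - (1ℤ * 0ℤ + 1ℤ * t + 0ℤ * 0ℤ)
            lem₂ = solve 1 (λ t → # 0 := t :- (# 1 :* # 0 :+ # 1 :* t :+ # 0 :* # 0)) refl

      Rounds : (Fin n → ℤ) → (Fin n → ℤ) → Set
      Rounds x y = Admissible y × (0ℤ ≤ B x x - B y y) × (0ℤ ≤ sum (frac ∘ x) - (1ℤ + sum (frac ∘ y)))

      ≢⇒0<- : ∀ {y} → y ≢ L → 0ℤ ≤ L - y → 0ℤ < L - y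
      ≢⇒0<- {y} p q = ≤∧≢⇒< q λ z → p (sym (i-j≡0⇒i≡j L y (sym z)))

      shift-by : ∀ x → Admissible x → ∀ τ i j → i ≢ j → Fractional (x i) → Fractional (x j) →
        0ℤ ≤ τ → 0ℤ ≤ L - x i - τ → 0ℤ ≤ L + x j - τ → 0ℤ ≤ 𝐀 x j - 𝐀 x i →
        ¬ Fractional (x i + τ) ⊎ ¬ Fractional (x j - τ) → Rounds x (shift x τ i j)
      shift-by x (≤L , ≥-L , Σ0) τ i j i≢j fi fj τ≥0 pi pj order tight =
        ( cases (λ _ t → 0ℤ ≤ L - t) (by pi (lem₁ (x i))) (by (≤L j ⊕ τ≥0) (lem₂ (x j))) (λ {v} _ _ → ≤L v)
        , cases (λ _ t → 0ℤ ≤ L + t) (by (≥-L i ⊕ τ≥0) (lem₃ (x i))) (by pj (lem₄ (x j))) (λ {v} _ _ → ≥-L v)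
        , trans sum-shift Σ0 )
        , B-shift τ≥0 order , frac-drop fi fj tight
        where
        open Shift x τ i j i≢j
        lem₁ : ∀ y → L - y - τ ≡ L - (y + τ)
        lem₁ y = (solve 3 (λ L y τ → L :- y :- τ := L :- (y :+ τ)) refl L y τ)
        lem₂ : ∀ y → L - y + τ ≡ L - (y - τ)
        lem₂ y = (solve 3 (λ L y τ → L :- y :+ τ := L :- (y :- τ)) refl L y τ)
        lem₃ : ∀ y → L + y + τ ≡ L + (y + τ)
        lem₃ y = (solve 3 (λ L y τ → L :+ y :+ τ := L :+ (y :+ τ)) refl L y τ)
        lem₄ : ∀ y → L + y - τ ≡ L + (y - τ)
        lem₄ y = (solve 3 (λ L y τ → L :+ y :- τ := L :+ (y :- τ)) refl L y τ)

      -- The shift is the smaller of the two margins `L - x i` and `L + x j`, so one coordinate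
      -- lands on its bound and the other stays admissible.
      round-oriented : ∀ x → Admissible x → ∀ i j → i ≢ j → Fractional (x i) → Fractional (x j) →
        0ℤ ≤ 𝐀 x j - 𝐀 x i → ∃[ y ] Rounds x y
      round-oriented x adm@(≤L , ≥-L , _) i j i≢j fi fj order with 0ℤ ≤? L + x j - (L - x i)
      ... | yes p = _ , shift-by x adm (L - x i) i j i≢j fi fj (≤L i)
        (by ≤-refl (let y = x i in (solve 2 (λ L y → # 0 := L :- y :- (L :- y)) refl L y))) p order
        (inj₁ λ f → proj₁ f (let y = x i in (solve 2 (λ L y → y :+ (L :- y) := L) refl L y)))
      ... | no p = _ , shift-by x adm (L + x j) i j i≢j fi fj (≥-L j)
        (by (<⇒≤ (neg-mono-< (≰⇒> p))) (let y = x i; z = x j in (solve 3 (λ L y z → :- (L :+ z :- (L :- y)) := L :- y :- (L :+ z)) refl L y z)))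
        (by ≤-refl (let z = x j in (solve 2 (λ L z → # 0 := L :+ z :- (L :+ z)) refl L z))) order
        (inj₂ λ f → proj₂ f (let z = x j in (solve 2 (λ L z → z :- (L :+ z) := :- L) refl L z)))

      round-step : ∀ x → Admissible x → ∀ i j → i ≢ j → Fractional (x i) → Fractional (x j) →
        ∃[ y ] Rounds x y
      round-step x adm i j i≢j fi fj with 0ℤ ≤? 𝐀 x j - 𝐀 x i
      ... | yes p = round-oriented x adm i j i≢j fi fj p
      ... | no  p = round-oriented x adm j i (i≢j ∘ sym) fj fi
        (by (<⇒≤ (neg-mono-< (≰⇒> p))) (let y = 𝐀 x i; z = 𝐀 x j in (solve 2 (λ y z → :- (z :- y) := y :- z) refl y z)))

      module Terminal (x : Fin n → ℤ) (adm : Admissible x)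
        (almost : ∀ i j → i ≢ j → Fractional (x i) → Fractional (x j) → ⊥) where

        b : Fin n → Bool
        b v = does (x v ≟ L)

        -- Up to the factor `2L`, `w` has entries in the unit interval, `s` rounds them down, and
        -- `r` is the loss, which is concentrated on the fractional coordinate if there is one.
        s w r : Fin n → ℤ
        s = ind ∘ b
        w v = x v + L
        r v = w v - + 2 * L * s v

        r-cases : ∀ v → (r v ≡ 0ℤ) ⊎ (Fractional (x v) × (r v ≡ x v + L))
        r-cases v with x v ≟ L | x v ≟ - L
        ... | yes p | _     = inj₁ (trans (cong (λ t → t + L - + 2 * L * 1ℤ) p) (solve 1 (λ L → L :+ L :- # 2 :* L :* # 1 := # 0) refl L))
        ... | no _  | yes q = inj₁ (trans (cong (λ t → t + L - + 2 * L * 0ℤ) q) (solve 1 (λ L → (:- L) :+ L :- # 2 :* L :* # 0 := # 0) refl L))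
        ... | no p  | no q  = inj₂ ((p , q) , (let y = x v in (solve 2 (λ y L → y :+ L :- # 2 :* L :* # 0 := y :+ L) refl y L)))

        r≥0 : ∀ v → 0ℤ ≤ r v
        r≥0 v with r-cases v
        ... | inj₁ e = subst (0ℤ ≤_) (sym e) ≤-refl
        ... | inj₂ (_ , e) = subst (0ℤ ≤_) (trans (+-comm L (x v)) (sym e)) (proj₁ (proj₂ adm) v)

        r<2L : ∀ v → 0ℤ < + 2 * L - r v
        r<2L v with r-cases v
        ... | inj₁ e = subst (λ t → 0ℤ < + 2 * L - t) (sym e) (by⁺ (*-pos (pos {1}) L>0) (solve 1 (λ L → # 2 :* L := # 2 :* L :- # 0) refl L))
        ... | inj₂ ((p , _) , e) = subst (λ t → 0ℤ < + 2 * L - t) (sym e) (by⁺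
          (≢⇒0<- p (proj₁ adm v))
          (let y = x v in (solve 2 (λ y L → L :- y := # 2 :* L :- (y :+ L)) refl y L)))

        sum-r : sum r ≡ L * (N - + 2 * + count b)
        sum-r = trans (sum-cong-≗ λ v → lem₁ (x v) (s v))
          (trans (sum-lin 1ℤ L (- (+ 2 * L)) x 𝟏 s)
            (trans (cong₂ _+_ (cong₂ (λ p q → 1ℤ * p + L * q) (proj₂ (proj₂ adm)) sum-𝟏)
              (cong (- (+ 2 * L) *_) (sum-ind b))) (lem₂ N (+ count b))))
          where
          lem₁ : ∀ y t → y + L - + 2 * L * t ≡ 1ℤ * y + L * 1ℤ + (- (+ 2 * L)) * t
          lem₁ y t = (solve 3 (λ L y t →
              y :+ L :- # 2 :* L :* t
              := # 1 :* y :+ L :* # 1 :+ (:- (# 2 :* L)) :* t) refl L y t)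
          lem₂ : ∀ m c → 1ℤ * 0ℤ + L * m + (- (+ 2 * L)) * c ≡ L * (m - + 2 * c)
          lem₂ m c = (solve 3 (λ L m c → # 1 :* # 0 :+ L :* m :+ (:- (# 2 :* L)) :* c := L :* (m :- # 2 :* c)) refl L m c)

        sum-r<2L : 0ℤ < + 2 * L - sum r
        sum-r<2L with Fin.any? (λ v → fractional? (x v))
        ... | yes (i , fi) = subst (λ t → 0ℤ < + 2 * L - t) (trans (sym (sum-δ i r)) (sum-cong-≗ concentrated)) (r<2L i)
          where
          concentrated : ∀ v → δ i v * r v ≡ r v
          concentrated v with i Fin.≟ v
          ... | yes refl = trans (cong (_* r i) (δ-diag i)) (let t = r i in (solve 1 (λ t → # 1 :* t := t) refl t))
          ... | no i≢v with r-cases v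
          ...   | inj₁ e = trans (cong (δ i v *_) e) (trans (let t = δ i v in (solve 1 (λ t → t :* # 0 := # 0) refl t)) (sym e))
          ...   | inj₂ (fv , _) = ⊥-elim (almost i v i≢v fi fv)
        ... | no none = subst (λ t → 0ℤ < + 2 * L - t) (sym (trans (sum-cong-≗ vanish) (trans (sum-const n 0ℤ)
              (let m = N in (solve 1 (λ m → m :* # 0 := # 0) refl m))))) (by⁺ (*-pos (pos {1}) L>0) (solve 1 (λ L → # 2 :* L := # 2 :* L :- # 0) refl L))
          where
          vanish : ∀ v → r v ≡ 0ℤ
          vanish v with r-cases v
          ... | inj₁ e = e
          ... | inj₂ (fv , _) = ⊥-elim (none (v , fv))

        -- At most one entry of `r` is nonzero and it is below `2L`, so `n - 2|b|` lies in `[0, 2)`.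
        -- This handles both parities of `n`.
        count-half : count b ≡ ⌊ n /2⌋
        count-half = half-unique n (count b)
          (cancel-pos L>0 (subst (0ℤ ≤_) sum-r (sum-≥0 r r≥0)))
          (cancel-pos⁺ L>0 (by⁺ (subst (λ t → 0ℤ < + 2 * L - t) sum-r sum-r<2L)
            (let m = N - + 2 * + count b in (solve 2 (λ L m → # 2 :* L :- L :* m := L :* (# 2 :- m)) refl L m))))

        B-w : B w w ≡ B x x + L * L * (d * N)
        B-w = trans (B-cong eq eq) (trans (B-square 1ℤ L 0ℤ x 𝟏 𝟏)
          (trans (cong₂ (λ p q → 1ℤ * 1ℤ * B x x + L * L * p + 0ℤ * 0ℤ * p + + 2 * 1ℤ * L * q + + 2 * 1ℤ * 0ℤ * q + + 2 * L * 0ℤ * p)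
            (trans (B-𝟏 𝟏) (cong (d *_) sum-𝟏)) (trans (B-𝟏 x) (cong (d *_) (proj₂ (proj₂ adm))))) (lem₂ (B x x) N)))
          where
          eq : ∀ v → w v ≡ 1ℤ * x v + L * 1ℤ + 0ℤ * 1ℤ
          eq v = let y = x v in (solve 2 (λ y L → y :+ L := # 1 :* y :+ L :* # 1 :+ # 0 :* # 1) refl y L)
          lem₂ : ∀ b m → 1ℤ * 1ℤ * b + L * L * (d * m) + 0ℤ * 0ℤ * (d * m) + + 2 * 1ℤ * L * (d * 0ℤ) + + 2 * 1ℤ * 0ℤ * (d * 0ℤ) + + 2 * L * 0ℤ * (d * m)
            ≡ b + L * L * (d * m)
          lem₂ b m = (solve 4 (λ L d b m →
              # 1 :* # 1 :* b :+ L :* L :* (d :* m) :+ # 0 :* # 0 :* (d :* m)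
              :+ # 2 :* # 1 :* L :* (d :* # 0) :+ # 2 :* # 1 :* # 0 :* (d :* # 0)
              :+ # 2 :* L :* # 0 :* (d :* m)
              := b :+ L :* L :* (d :* m)) refl L d b m)

        B-2Ls : B (λ v → + 2 * L * s v) (λ v → + 2 * L * s v) ≡ + 4 * L * L * B s s
        B-2Ls = trans (B-cong eq eq) (trans (B-square (+ 2 * L) 0ℤ 0ℤ s s s) (lem (B s s)))
          where
          eq : ∀ v → + 2 * L * s v ≡ + 2 * L * s v + 0ℤ * s v + 0ℤ * s v
          eq v = let y = s v in (solve 2 (λ y L → # 2 :* L :* y := # 2 :* L :* y :+ # 0 :* y :+ # 0 :* y) refl y L)
          lem : ∀ b → + 2 * L * (+ 2 * L) * b + 0ℤ * 0ℤ * b + 0ℤ * 0ℤ * b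
              + + 2 * (+ 2 * L) * 0ℤ * b + + 2 * (+ 2 * L) * 0ℤ * b + + 2 * 0ℤ * 0ℤ * b ≡ + 4 * L * L * b
          lem b = (solve 2 (λ L b →
              # 2 :* L :* (# 2 :* L) :* b :+ # 0 :* # 0 :* b
              :+ # 0 :* # 0 :* b :+ # 2 :* (# 2 :* L) :* # 0 :* b
              :+ # 2 :* (# 2 :* L) :* # 0 :* b :+ # 2 :* # 0 :* # 0 :* b
              := # 4 :* L :* L :* b) refl L b)

        s≥0 : ∀ v → 0ℤ ≤ s v
        s≥0 v with b v
        ... | true  = nn
        ... | false = nn

        -- Rounding `x + L` down to `2L s` cannot increase the form, by monotonicity, and the
        -- hypothesis applies to `s`. The shift by `L` costs only `L²dn`, because `x` sums to 0.
        goal : Goal x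
        goal = by (nn {9} ⊗ B-mono (λ v → + 2 * L * s v) w (λ v → nn {2} ⊗ <⇒≤ L>0 ⊗ s≥0 v) r≥0
            ⊕ nn {4} ⊗ <⇒≤ L>0 ⊗ <⇒≤ L>0 ⊗ sparse b count-half)
          (trans (cong₂ (λ p q → + 9 * (p - q) + + 4 * L * L * (+ 9 * B s s - N * N)) B-w B-2Ls) (lem (B x x) (B s s) N))
          where
          lem : ∀ p q m → + 9 * (p + L * L * (d * m) - + 4 * L * L * q) + + 4 * L * L * (+ 9 * q - m * m)
            ≡ + 9 * p + + 9 * d * m * L * L - + 4 * m * m * L * L
          lem p q m = (solve 5 (λ L d p q m →
              # 9 :* (p :+ L :* L :* (d :* m) :- # 4 :* L :* L :* q)
              :+ # 4 :* L :* L :* (# 9 :* q :- m :* m)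
              := # 9 :* p :+ # 9 :* d :* m :* L :* L :- # 4 :* m :* m :* L :* L) refl L d p q m)

      -- Recursion on a bound `k` for the number of fractional coordinates, which every rounding
      -- step lowers.
      round : ∀ k x → Admissible x → 0ℤ ≤ + k - sum (frac ∘ x) → Goal x
      round k x adm bound
        with Fin.any? (λ i → Fin.any? λ j → ¬? (i Fin.≟ j) ×-dec fractional? (x i) ×-dec fractional? (x j))
      ... | no none = Terminal.goal x adm λ i j p fi fj → none (i , j , p , fi , fj)
      round k x adm bound | yes (i , j , i≢j , fi , fj) with round-step x adm i j i≢j fi fj
      round ℕ.zero x adm bound | yes _ | y , adm-y , le , drop =
        ⊥-elim (clash (bound ⊕ drop ⊕ sum-≥0 _ (frac≥0 ∘ y)) (pos {0})
          (let p = sum (frac ∘ x); q = sum (frac ∘ y) in (solve 2 (λ p q → # 0 :- p :+ (p :- (# 1 :+ q)) :+ q :+ # 1 := # 0) refl p q)))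
      round (ℕ.suc k) x adm bound | yes _ | y , adm-y , le , drop =
        by (round k y adm-y (by (bound ⊕ drop) (lem₁ (+ k) (sum (frac ∘ x)) (sum (frac ∘ y)))) ⊕ nn {9} ⊗ le)
          (lem₂ (B x x) (B y y) N)
        where
        lem₁ : ∀ k p q → 1ℤ + k - p + (p - (1ℤ + q)) ≡ k - q
        lem₁ = solve 3 (λ k p q → # 1 :+ k :- p :+ (p :- (# 1 :+ q)) := k :- q) refl
        lem₂ : ∀ p q m → + 9 * q + + 9 * d * m * L * L - + 4 * m * m * L * L + + 9 * (p - q)
          ≡ + 9 * p + + 9 * d * m * L * L - + 4 * m * m * L * L
        lem₂ p q m = (solve 5 (λ L d p q m →
            # 9 :* q :+ # 9 :* d :* m :* L :* L :- # 4 :* m :* m :* L :* L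
            :+ # 9 :* (p :- q) := # 9 :* p :+ # 9 :* d :* m :* L :* L
            :- # 4 :* m :* m :* L :* L) refl L d p q m)

      fractional-bound : ∀ x → Admissible x → Goal x
      fractional-bound x adm = round n x adm (by (sum-mono (frac ∘ x) 𝟏 (frac≤1 ∘ x)) (cong (_- sum (frac ∘ x)) sum-𝟏))

-- Lower bound for the degree.

module MinimumDegree where

  open import Data.Bool using (Bool; true; false; if_then_else_)
  import Data.Bool.Properties as Bool
  open import Data.Empty using (⊥; ⊥-elim)
  open import Data.Fin as Fin using (Fin; zero; suc)
  import Data.Fin.Properties as Fin
  open import Data.Integer hiding (suc; _*_; pos)
  open import Data.Integer.Properties
  open import Data.Nat as ℕ using (ℕ; ⌊_/2⌋)
  open import Data.Product using (_×_; _,_; ∃-syntax; proj₁; proj₂)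
  open import Data.Sum using (_⊎_; inj₁; inj₂)
  open import Function using (_∘_)
  open import Relation.Binary.PropositionalEquality
  open import Relation.Nullary using (Dec; yes; no; does)
  open import Relation.Nullary.Decidable using (_×-dec_)
  open IntegerIdentities
  open Inequalities
  open QuadraticForms
  open Halves

  1*_ : ∀ x → 1ℤ * x ≡ x
  1*_ = solve 1 (λ x → # 1 :* x := x) refl

  0*_ : ∀ x → 0ℤ * x ≡ 0ℤ
  0*_ = solve 1 (λ x → # 0 :* x := # 0) refl

  *-comm′ : ∀ x y → x * y ≡ y * x
  *-comm′ = solve 2 (λ x y → x :* y := y :* x) refl

  ind≥0 : ∀ b → 0ℤ ≤ ind b
  ind≥0 true  = nn
  ind≥0 false = nn

  ind≤1 : ∀ b → 0ℤ ≤ 1ℤ - ind b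
  ind≤1 true  = nn
  ind≤1 false = nn

  sum-zero : ∀ {n} (f : Fin n → ℤ) → (∀ v → f v ≡ 0ℤ) → sum f ≡ 0ℤ
  sum-zero {n} f p = trans (sum-cong-≗ p) (trans (sum-const n 0ℤ) (let m = + n in (solve 1 (λ m → m :* # 0 := # 0) refl m)))

  via-≢ : {A : Set} {x y z : A} → x ≡ y → y ≢ z → x ≢ z
  via-≢ refl p = p

  module Regular {n} (adj : Fin n → Fin n → Bool) (adj-sym : ∀ u v → adj u v ≡ adj v u)
    (adj-irrefl : ∀ u → adj u u ≡ false)
    (K₄-free : ∀ {w x y z} → adj w x ≡ true → adj w y ≡ true → adj w z ≡ true →
       adj x y ≡ true → adj x z ≡ true → adj y z ≡ true → ⊥)
    (d : ℤ) (regular : ∀ u → sum (ind ∘ adj u) ≡ d) where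

    a : Fin n → Fin n → ℤ
    a u v = ind (adj u v)

    open Rounding a (λ u v → cong ind (adj-sym u v)) (λ u v → ind≥0 (adj u v))
      (λ u → cong ind (adj-irrefl u)) d regular public

    true≢false : ∀ {b} → b ≡ true → b ≡ false → ⊥
    true≢false refl ()

    symᵃ : ∀ {u v} → adj u v ≡ true → adj v u ≡ true
    symᵃ {u} {v} p = trans (adj-sym v u) p

    codeg : Fin n → Fin n → ℤ
    codeg u v = sum λ x → a u x * a v x

    𝐀≥0 : ∀ f → (∀ v → 0ℤ ≤ f v) → ∀ u → 0ℤ ≤ 𝐀 f u
    𝐀≥0 f p u = sum-≥0 _ λ v → ind≥0 (adj u v) ⊗ p v

    𝐀≤d : ∀ f → (∀ v → 0ℤ ≤ 1ℤ - f v) → ∀ u → 0ℤ ≤ d - 𝐀 f u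
    𝐀≤d f p u = by (sum-mono (λ v → a u v * f v) (a u) λ v →
        by (ind≥0 (adj u v) ⊗ p v) (lem (a u v) (f v))) (cong (_- 𝐀 f u) (regular u))
      where
      lem : ∀ x y → x * (1ℤ - y) ≡ x - x * y
      lem = solve 2 (λ x y → x :* (# 1 :- y) := x :- x :* y) refl

    B≤d : ∀ f → (∀ v → 0ℤ ≤ f v) → (∀ v → 0ℤ ≤ 1ℤ - f v) → 0ℤ ≤ d * sum f - B f f
    B≤d f p q = by (sum-mono (λ v → f v * 𝐀 f v) (λ v → d * f v) λ v →
        by (p v ⊗ 𝐀≤d f q v) (lem (f v) (𝐀 f v))) (cong (_- B f f) (sum-*ˡ d f))
      where
      lem : ∀ x y → x * (d - y) ≡ d * x - x * y
      lem x y = (solve 3 (λ d x y → x :* (d :- y) := d :* x :- x :* y) refl d x y)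

    -- Summed over the edges inside the set `f`, the hypothesis gives `2 ∑ deg² ≤ s ∑ deg`, and
    -- Cauchy-Schwarz bounds `∑ deg²` from below. For `s = sum f` this is the classical proof of
    -- Mantel's theorem.
    degree-sum : ∀ f s → (∀ v → (f v ≡ 0ℤ) ⊎ (f v ≡ 1ℤ)) → 0ℤ ≤ s →
      (∀ x y → f x ≡ 1ℤ → f y ≡ 1ℤ → adj x y ≡ true → 0ℤ ≤ s - 𝐀 f x - 𝐀 f y) →
      0ℤ ≤ sum f * s - + 2 * B f f
    degree-sum f s f01 s≥0 bound = 0≤-by-contradiction contra
      where
      H = sum f
      g = 𝐀 f
      Q = ⟨ f , (λ v → g v * g v) ⟩
      f≥0 : ∀ v → 0ℤ ≤ f v
      f≥0 v with f01 v
      ... | inj₁ e = subst (0ℤ ≤_) (sym e) ≤-refl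
      ... | inj₂ e = subst (0ℤ ≤_) (sym e) nn
      f≤1 : ∀ v → 0ℤ ≤ 1ℤ - f v
      f≤1 v with f01 v
      ... | inj₁ e = subst (λ t → 0ℤ ≤ 1ℤ - t) (sym e) nn
      ... | inj₂ e = subst (λ t → 0ℤ ≤ 1ℤ - t) (sym e) nn
      H≥0 : 0ℤ ≤ H
      H≥0 = sum-≥0 f f≥0
      edge-term : ∀ x y → 0ℤ ≤ f x * (a x y * (f y * (s - g x - g y)))
      edge-term x y with f01 x | f01 y | adj x y in e
      ... | inj₁ p | _ | b = subst (λ t → 0ℤ ≤ t * (ind b * (f y * (s - g x - g y)))) (sym p) (by ≤-refl (sym (0* (ind b * (f y * (s - g x - g y))))))
      ... | inj₂ p | _ | false = f≥0 x ⊗ by ≤-refl (sym (0* (f y * (s - g x - g y))))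
      ... | inj₂ p | inj₁ q | true = f≥0 x ⊗ (nn {1} ⊗ subst (λ t → 0ℤ ≤ t * (s - g x - g y)) (sym q) (by ≤-refl (sym (0* (s - g x - g y)))))
      ... | inj₂ p | inj₂ q | true = f≥0 x ⊗ (nn {1} ⊗ (f≥0 y ⊗ bound x y p q e))
      inner : ∀ x → sum (λ y → f x * (a x y * (f y * (s - g x - g y)))) ≡
        s * (f x * g x) + (- 1ℤ) * (f x * (g x * g x)) + (- 1ℤ) * (f x * 𝐀 (λ y → f y * g y) x)
      inner x = trans (sum-cong-≗ λ y → lem₁ (f x) (a x y) (f y) (g x) (g y))
        (trans (sum-lin (f x * (s - g x)) (- f x) 0ℤ (λ y → a x y * f y) (λ y → a x y * (f y * g y)) (λ y → 0ℤ))
          (lem₂ (f x) (g x) (𝐀 (λ y → f y * g y) x) (sum {n} λ y → 0ℤ)))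
        where
        lem₁ : ∀ p q r t u → p * (q * (r * (s - t - u))) ≡ p * (s - t) * (q * r) + (- p) * (q * (r * u)) + 0ℤ * 0ℤ
        lem₁ p q r t u = (solve 6 (λ s p q r t u →
            p :* (q :* (r :* (s :- t :- u)))
            := p :* (s :- t) :* (q :* r) :+ (:- p) :* (q :* (r :* u))
            :+ # 0 :* # 0) refl s p q r t u)
        lem₂ : ∀ p t u z → p * (s - t) * t + (- p) * u + 0ℤ * z ≡ s * (p * t) + (- 1ℤ) * (p * (t * t)) + (- 1ℤ) * (p * u)
        lem₂ p t u z = (solve 5 (λ s p t u z →
            p :* (s :- t) :* t :+ (:- p) :* u :+ # 0 :* z
            := s :* (p :* t) :+ (:- # 1) :* (p :* (t :* t))
            :+ (:- # 1) :* (p :* u)) refl s p t u z)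
      BQ : B f (λ y → f y * g y) ≡ Q
      BQ = trans (B-sym f (λ y → f y * g y)) (sum-cong-≗ λ v → lem (f v) (g v))
        where
        lem : ∀ p q → p * q * q ≡ p * (q * q)
        lem = solve 2 (λ p q → p :* q :* q := p :* (q :* q)) refl
      weighted : 0ℤ ≤ s * B f f - + 2 * Q
      weighted = by (sum-≥0 _ λ x → sum-≥0 _ (edge-term x))
        (trans (sum-cong-≗ inner) (trans (sum-lin s (- 1ℤ) (- 1ℤ) (λ x → f x * g x) (λ x → f x * (g x * g x)) (λ x → f x * 𝐀 (λ y → f y * g y) x))
          (trans (cong (λ t → s * B f f + (- 1ℤ) * Q + (- 1ℤ) * t) BQ) (lem (B f f) Q))))
        where
        lem : ∀ b q → s * b + (- 1ℤ) * q + (- 1ℤ) * q ≡ s * b - + 2 * q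
        lem b q = (solve 3 (λ s b q → s :* b :+ (:- # 1) :* q :+ (:- # 1) :* q := s :* b :- # 2 :* q) refl s b q)
      contra : 0ℤ < - (H * s - + 2 * B f f) → ⊥
      contra neg = clash (H≥0 ⊗ weighted ⊕ nn {2} ⊗ HQ≥N²) (*-pos N>0 neg)
        (let N = B f f in (solve 4 (λ H s N Q →
            H :* (s :* N :- # 2 :* Q) :+ # 2 :* (H :* Q :- N :* N)
            :+ N :* (:- (H :* s :- # 2 :* N))
            := # 0) refl H s N Q))
        where
        N>0 : 0ℤ < B f f
        N>0 = cancel-pos⁺ (pos {1}) (by⁺ (H≥0 ⊗ s≥0 ⊕⁺ neg) (let N = B f f in (solve 3 (λ H s N → H :* s :+ (:- (H :* s :- # 2 :* N)) := # 2 :* N) refl H s N)))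
        dH>0 : 0ℤ < d * H
        dH>0 = by⁺ (B≤d f f≥0 f≤1 ⊕⁺ N>0) (let N = B f f in (solve 3 (λ d H N → d :* H :- N :+ N := d :* H) refl d H N))
        H>0 : 0ℤ < H
        H>0 with H ≟ 0ℤ
        ... | yes e = ⊥-elim (<-irrefl (sym (trans (cong (d *_) e) (solve 1 (λ d → d :* # 0 := # 0) refl d))) dH>0)
        ... | no e  = ≤∧≢⇒< H≥0 (e ∘ sym)
        HQ≥N² : 0ℤ ≤ H * Q - B f f * B f f
        HQ≥N² = cancel-pos H>0 (cauchy-schwarz f g f≥0)

    -- The vertices adjacent to none or to all of `x`, `y`, `z` are counted by
    -- `(1-p)(1-q)(1-r) + pqr`, in which the cubic terms cancel and only degrees and codegrees
    -- remain.
    triangle-codeg : ∀ x y z → 0ℤ ≤ codeg x y + codeg z x + codeg z y - (+ 3 * d - N)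
    triangle-codeg x y z = by
      (sum-≥0 _ λ v → (ind≤1 (adj x v) ⊗ ind≤1 (adj y v) ⊗ ind≤1 (adj z v))
                    ⊕ (ind≥0 (adj x v) ⊗ ind≥0 (adj y v) ⊗ ind≥0 (adj z v)))
      (trans (sum-cong-≗ λ v → lem₁ (a x v) (a y v) (a z v))
        (trans (sum-lin 1ℤ 1ℤ 1ℤ (λ v → a x v * a y v) (λ v → a z v * a x v)
             (λ v → 1ℤ * (a z v * a y v) + (- 1ℤ) * (a x v + a y v + a z v) + 1ℤ * 1ℤ))
          (trans (cong (λ t → 1ℤ * codeg x y + 1ℤ * codeg z x + 1ℤ * t)
            (trans (sum-lin 1ℤ (- 1ℤ) 1ℤ (λ v → a z v * a y v) (λ v → a x v + a y v + a z v) 𝟏)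
              (cong₂ (λ s t → 1ℤ * codeg z y + (- 1ℤ) * s + 1ℤ * t)
                (trans (∑-distrib-+ (λ v → a x v + a y v) (a z)) (cong₂ _+_
                  (trans (∑-distrib-+ (a x) (a y)) (cong₂ _+_ (regular x) (regular y))) (regular z)))
                sum-𝟏)))
            (lem₂ (codeg x y) (codeg z x) (codeg z y) N))))
      where
      lem₁ : ∀ p q r → (1ℤ - p) * (1ℤ - q) * (1ℤ - r) + p * q * r
        ≡ 1ℤ * (p * q) + 1ℤ * (r * p) + 1ℤ * (1ℤ * (r * q) + (- 1ℤ) * (p + q + r) + 1ℤ * 1ℤ)
      lem₁ = solve 3 (λ p q r →
          (# 1 :- p) :* (# 1 :- q) :* (# 1 :- r) :+ p :* q :* r
          := # 1 :* (p :* q) :+ # 1 :* (r :* p) :+ # 1 :* (# 1 :* (r :* q) :+ (:- # 1) :* (p :+ q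
          :+ r) :+ # 1 :* # 1)) refl
      lem₂ : ∀ p q r m → 1ℤ * p + 1ℤ * q + 1ℤ * (1ℤ * r + (- 1ℤ) * (d + d + d) + 1ℤ * m) ≡ p + q + r - (+ 3 * d - m)
      lem₂ p q r m = (solve 5 (λ d p q r m →
          # 1 :* p :+ # 1 :* q :+ # 1 :* (# 1 :* r :+ (:- # 1) :* (d :+ d :+ d)
          :+ # 1 :* m) := p :+ q :+ r :- (# 3 :* d :- m)) refl d p q r m)

    -- A common neighbour of `x` and `y` inside `N(w)` would complete a `K₄`, so their
    -- neighbourhoods there are disjoint.
    disjoint-nbrs : ∀ {w x y} → adj w x ≡ true → adj w y ≡ true → adj x y ≡ true → ∀ f →
      (∀ v → 0ℤ ≤ f v) → (∀ v → adj w v ≡ false → f v ≡ 0ℤ) → 0ℤ ≤ sum f - 𝐀 f x - 𝐀 f y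
    disjoint-nbrs {w} {x} {y} wx wy xy f f≥0 supp = by (sum-≥0 _ term)
      (trans (sum-cong-≗ λ v → lem₁ (f v) (a x v * f v) (a y v * f v))
        (trans (sum-lin 1ℤ (- 1ℤ) (- 1ℤ) f (λ v → a x v * f v) (λ v → a y v * f v)) (lem₂ (sum f) (𝐀 f x) (𝐀 f y))))
      where
      lem₁ : ∀ p q r → p - q - r ≡ 1ℤ * p + (- 1ℤ) * q + (- 1ℤ) * r
      lem₁ = solve 3 (λ p q r → p :- q :- r := # 1 :* p :+ (:- # 1) :* q :+ (:- # 1) :* r) refl
      lem₂ : ∀ p q r → 1ℤ * p + (- 1ℤ) * q + (- 1ℤ) * r ≡ p - q - r
      lem₂ p q r = sym (lem₁ p q r)
      term : ∀ v → 0ℤ ≤ f v - a x v * f v - a y v * f v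
      term v with adj x v in xv | adj y v in yv
      ... | false | false = by (f≥0 v) (let t = f v in (solve 1 (λ t → t := t :- # 0 :* t :- # 0 :* t) refl t))
      ... | false | true  = by ≤-refl (let t = f v in (solve 1 (λ t → # 0 := t :- # 0 :* t :- # 1 :* t) refl t))
      ... | true  | false = by ≤-refl (let t = f v in (solve 1 (λ t → # 0 := t :- # 1 :* t :- # 0 :* t) refl t))
      ... | true  | true with adj w v in wv
      ...   | true  = ⊥-elim (K₄-free wx wy wv xy xv yv)
      ...   | false = subst (λ t → 0ℤ ≤ t - 1ℤ * t - 1ℤ * t) (sym (supp v wv))
                        (by ≤-refl (solve 0 (# 0 := # 0 :- # 1 :* # 0 :- # 1 :* # 0) refl))

    module Sparse (sparse : ∀ (b : Fin n → Bool) → count b ≡ ⌊ n /2⌋ →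
                     0ℤ ≤ + 9 * B (ind ∘ b) (ind ∘ b) - N * N)
                  (d>0 : 0ℤ < d) where

      quadratic-bound : ∀ L → 0ℤ < L → ∀ x → (∀ v → 0ℤ ≤ L - x v) → (∀ v → 0ℤ ≤ L + x v) → sum x ≡ 0ℤ →
        0ℤ ≤ + 9 * B x x + + 9 * d * N * L * L - + 4 * N * N * L * L
      quadratic-bound L L>0 x p q r = fractional-bound sparse L L>0 x (p , q , r)

      -- The vector y on the set u is balanced by the constant − (∑ y) / z on the complement of u.
      cut-bound : ∀ L → 0ℤ < L → ∀ u y → 0ℤ < N - sum u →
        (∀ v → (u v ≡ 1ℤ) × (0ℤ ≤ L - y v) × (0ℤ ≤ L + y v) ⊎ (u v ≡ 0ℤ) × (y v ≡ 0ℤ)) →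
        0ℤ ≤ (N - sum u) * L - sum y → 0ℤ ≤ (N - sum u) * L + sum y →
        0ℤ ≤ + 9 * (d * (N - sum u) * B y y + B y u * B y u) - d * (N - sum u) * L * L * (+ 4 * N * N - + 9 * d * N)
      cut-bound L L>0 u y z>0 cases s≤ s≥ = cancel-pos z>0
        -- The sum `s` of `y` must disappear from the result. `B≤d` discards the edges leaving `u`,
        -- and completing the square in `η - d s` replaces the remaining terms in `s` by `η²`.
        (by (nn {9} ⊗ (<⇒≤ z>0 ⊗ sq≥0 (η - d * s) ⊕ <⇒≤ d>0 ⊗ sq≥0 s ⊗ B≤d u u≥0 u≤1) ⊕ <⇒≤ d>0 ⊗ form)
          (lem N U s (B y y) (B u u) η))
        where
        U = sum u
        s = sum y
        z = N - U
        η = B y u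
        u≥0 : ∀ v → 0ℤ ≤ u v
        u≥0 v with cases v
        ... | inj₁ (e , _) = subst (0ℤ ≤_) (sym e) nn
        ... | inj₂ (e , _) = subst (0ℤ ≤_) (sym e) nn
        u≤1 : ∀ v → 0ℤ ≤ 1ℤ - u v
        u≤1 v with cases v
        ... | inj₁ (e , _) = subst (λ t → 0ℤ ≤ 1ℤ - t) (sym e) nn
        ... | inj₂ (e , _) = subst (λ t → 0ℤ ≤ 1ℤ - t) (sym e) nn
        x : Fin n → ℤ
        x v = z * y v + (- s) * 1ℤ + s * u v
        upper : ∀ v → 0ℤ ≤ z * L - x v
        upper v with cases v
        ... | inj₁ (e , p , _) = by (<⇒≤ z>0 ⊗ p) (trans (lem₁ z (y v)) (cong (λ t → z * L - (z * y v + (- s) * 1ℤ + s * t)) (sym e)))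
          where
          lem₁ : ∀ z y → z * (L - y) ≡ z * L - (z * y + (- s) * 1ℤ + s * 1ℤ)
          lem₁ z y = (solve 4 (λ L s z y → z :* (L :- y) := z :* L :- (z :* y :+ (:- s) :* # 1 :+ s :* # 1)) refl L s z y)
        ... | inj₂ (e , f) = by s≥ (trans (lem₁ z) (cong₂ (λ r t → z * L - (z * r + (- s) * 1ℤ + s * t)) (sym f) (sym e)))
          where
          lem₁ : ∀ z → z * L + s ≡ z * L - (z * 0ℤ + (- s) * 1ℤ + s * 0ℤ)
          lem₁ z = (solve 3 (λ L s z → z :* L :+ s := z :* L :- (z :* # 0 :+ (:- s) :* # 1 :+ s :* # 0)) refl L s z)
        lower : ∀ v → 0ℤ ≤ z * L + x v
        lower v with cases v
        ... | inj₁ (e , _ , p) = by (<⇒≤ z>0 ⊗ p) (trans (lem₁ z (y v)) (cong (λ t → z * L + (z * y v + (- s) * 1ℤ + s * t)) (sym e)))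
          where
          lem₁ : ∀ z y → z * (L + y) ≡ z * L + (z * y + (- s) * 1ℤ + s * 1ℤ)
          lem₁ z y = (solve 4 (λ L s z y → z :* (L :+ y) := z :* L :+ (z :* y :+ (:- s) :* # 1 :+ s :* # 1)) refl L s z y)
        ... | inj₂ (e , f) = by s≤ (trans (lem₁ z) (cong₂ (λ r t → z * L + (z * r + (- s) * 1ℤ + s * t)) (sym f) (sym e)))
          where
          lem₁ : ∀ z → z * L - s ≡ z * L + (z * 0ℤ + (- s) * 1ℤ + s * 0ℤ)
          lem₁ z = (solve 3 (λ L s z → z :* L :- s := z :* L :+ (z :* # 0 :+ (:- s) :* # 1 :+ s :* # 0)) refl L s z)
        balanced : sum x ≡ 0ℤ
        balanced = trans (sum-lin z (- s) s y 𝟏 u) (trans (cong (λ t → z * s + (- s) * t + s * U) sum-𝟏) (lem₁ N))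
          where
          lem₁ : ∀ m → (m - U) * s + (- s) * m + s * U ≡ 0ℤ
          lem₁ m = (solve 3 (λ U s m → (m :- U) :* s :+ (:- s) :* m :+ s :* U := # 0) refl U s m)
        form : 0ℤ ≤ + 9 * (z * z * B y y + (- s) * (- s) * (d * N) + s * s * B u u
                   + + 2 * z * (- s) * (d * s) + + 2 * z * s * η + + 2 * (- s) * s * (d * U))
                 + + 9 * d * N * (z * L) * (z * L) - + 4 * N * N * (z * L) * (z * L)
        form = by (quadratic-bound (z * L) (*-pos z>0 L>0) x upper lower balanced)
          (cong (λ t → + 9 * t + + 9 * d * N * (z * L) * (z * L) - + 4 * N * N * (z * L) * (z * L))
            (B-square-at z (- s) s y 𝟏 u refl (trans (B-𝟏 𝟏) (cong (d *_) sum-𝟏)) refl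
               (B-𝟏 y) refl (trans (B-sym 𝟏 u) (B-𝟏 u))))
        lem : ∀ m u s b c e →
          + 9 * ((m - u) * ((e - d * s) * (e - d * s)) + d * (s * s) * (d * u - c))
          + d * (+ 9 * ((m - u) * (m - u) * b + (- s) * (- s) * (d * m) + s * s * c
                   + + 2 * (m - u) * (- s) * (d * s) + + 2 * (m - u) * s * e + + 2 * (- s) * s * (d * u))
                 + + 9 * d * m * ((m - u) * L) * ((m - u) * L) - + 4 * m * m * ((m - u) * L) * ((m - u) * L))
          ≡ (m - u) * (+ 9 * (d * (m - u) * b + e * e) - d * (m - u) * L * L * (+ 4 * m * m - + 9 * d * m))
        lem m u s b c e = (solve 8 (λ d L m u s b c e →
            # 9 :* ((m :- u) :* ((e :- d :* s) :* (e :- d :* s)) :+ d :* (s :* s) :* (d :* u :- c))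
            :+ d :* (# 9 :* ((m :- u) :* (m :- u) :* b :+ (:- s) :* (:- s) :* (d :* m) :+ s :* s :* c
            :+ # 2 :* (m :- u) :* (:- s) :* (d :* s) :+ # 2 :* (m :- u) :* s :* e :+ # 2 :* (:- s) :* s :* (d :* u))
            :+ # 9 :* d :* m :* ((m :- u) :* L) :* ((m :- u) :* L) :- # 4 :* m :* m :* ((m :- u) :* L) :* ((m
            :- u) :* L)) := (m :- u) :* (# 9 :* (d :* (m :- u) :* b :+ e :* e)
            :- d :* (m :- u) :* L :* L :* (# 4 :* m :* m :- # 9 :* d :* m))) refl d L m u s b c e)

      -- Edges spanned by a neighbourhood.

      module Neighbourhood (w : Fin n) where

        h : Fin n → ℤ
        h = a w

        T : ℤ
        T = B h h

        B-h-𝟏 : B h 𝟏 ≡ d * d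
        B-h-𝟏 = trans (B-𝟏 h) (cong (d *_) (regular w))

        -- The test vector is the balanced multiple of `N(w)` against the rest, with values `n - d`
        -- and `-d`; the scale `n - d` bounds both because `2d ≤ n`.
        low-degree-triangles : 0ℤ ≤ N - + 2 * d →
          0ℤ ≤ + 9 * N * T - (+ 9 * d * d * d - (+ 9 * d - + 4 * N) * (N - d) * (N - d))
        low-degree-triangles low = cancel-pos N>0 (by
          (quadratic-bound (N - d) z>0 x upper lower balanced)
          (trans (cong (λ t → + 9 * t + + 9 * d * N * (N - d) * (N - d) - + 4 * N * N * (N - d) * (N - d))
            (B-square-at N (- d) 0ℤ h 𝟏 𝟏 refl B𝟏𝟏 B𝟏𝟏 B-h-𝟏 B-h-𝟏 B𝟏𝟏)) (lem N T)))
          where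
          B𝟏𝟏 = trans (B-𝟏 𝟏) (cong (d *_) sum-𝟏)
          z>0 : 0ℤ < N - d
          z>0 = by⁺ (low ⊕⁺ d>0) (let m = N in (solve 2 (λ d m → m :- # 2 :* d :+ d := m :- d) refl d m))
          N>0 : 0ℤ < N
          N>0 = by⁺ (<⇒≤ z>0 ⊕⁺ d>0) (let m = N in (solve 2 (λ d m → m :- d :+ d := m) refl d m))
          x : Fin n → ℤ
          x v = N * h v + (- d) * 1ℤ + 0ℤ * 1ℤ
          upper : ∀ v → 0ℤ ≤ N - d - x v
          upper v = by (<⇒≤ N>0 ⊗ ind≤1 (adj w v)) (let m = N; t = h v in (solve 3 (λ d m t → m :* (# 1 :- t) := m :- d :- (m :* t :+ (:- d) :* # 1 :+ # 0 :* # 1)) refl d m t))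
          lower : ∀ v → 0ℤ ≤ N - d + x v
          lower v = by (low ⊕ <⇒≤ N>0 ⊗ ind≥0 (adj w v)) (let m = N; t = h v in (solve 3 (λ d m t →
              m :- # 2 :* d :+ m :* t
              := m :- d :+ (m :* t :+ (:- d) :* # 1 :+ # 0 :* # 1)) refl d m t))
          balanced : sum x ≡ 0ℤ
          balanced = trans (sum-lin N (- d) 0ℤ h 𝟏 𝟏) (trans (cong₂ (λ p q → N * p + (- d) * q + 0ℤ * q) (regular w) sum-𝟏)
            (let m = N in (solve 2 (λ d m → m :* d :+ (:- d) :* m :+ # 0 :* m := # 0) refl d m)))
          lem : ∀ m t → + 9 * (m * m * t + (- d) * (- d) * (d * m) + 0ℤ * 0ℤ * (d * m) + + 2 * m * (- d) * (d * d) + + 2 * m * 0ℤ * (d * d) + + 2 * (- d) * 0ℤ * (d * m))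
              + + 9 * d * m * (m - d) * (m - d) - + 4 * m * m * (m - d) * (m - d)
            ≡ m * (+ 9 * m * t - (+ 9 * d * d * d - (+ 9 * d - + 4 * m) * (m - d) * (m - d)))
          lem m t = (solve 3 (λ d m t →
              # 9 :* (m :* m :* t :+ (:- d) :* (:- d) :* (d :* m) :+ # 0 :* # 0 :* (d :* m)
              :+ # 2 :* m :* (:- d) :* (d :* d) :+ # 2 :* m :* # 0 :* (d :* d) :+ # 2 :* (:- d) :* # 0 :* (d :* m))
              :+ # 9 :* d :* m :* (m :- d) :* (m :- d) :- # 4 :* m :* m :* (m :- d) :* (m
              :- d) := m :* (# 9 :* m :* t :- (# 9 :* d :* d :* d :- (# 9 :* d :- # 4 :* m) :* (m :- d) :* (m
              :- d)))) refl d m t)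


        codeg≥ : ∀ v → 0ℤ ≤ 𝐀 h v - (+ 2 * d - N)
        codeg≥ v = by (sum-≥0 _ λ x → ind≤1 (adj v x) ⊗ ind≤1 (adj w x))
          (trans (sum-cong-≗ λ x → lem₁ (a v x) (a w x))
            (trans (sum-lin 1ℤ (- 1ℤ) 1ℤ (λ x → a v x * h x) (λ x → a v x + a w x) 𝟏)
              (trans (cong₂ (λ p q → 1ℤ * 𝐀 h v + (- 1ℤ) * p + 1ℤ * q)
                 (trans (∑-distrib-+ (a v) (a w)) (cong₂ _+_ (regular v) (regular w))) sum-𝟏)
                (let p = 𝐀 h v; m = N in (solve 3 (λ d p m → # 1 :* p :+ (:- # 1) :* (d :+ d) :+ # 1 :* m := p :- (# 2 :* d :- m)) refl d p m)))))
          where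
          lem₁ : ∀ p q → (1ℤ - p) * (1ℤ - q) ≡ 1ℤ * (p * q) + (- 1ℤ) * (p + q) + 1ℤ * 1ℤ
          lem₁ = solve 2 (λ p q →
              (# 1 :- p) :* (# 1 :- q)
              := # 1 :* (p :* q) :+ (:- # 1) :* (p :+ q)
              :+ # 1 :* # 1) refl

        hg : Fin n → ℤ
        hg v = h v * 𝐀 h v

        -- Averaging over `N(w)`: the sum of `𝐀 hg v` is the sum `Q` of the squared codegrees, that
        -- of `𝐀 h v` is `T`, and Cauchy-Schwarz gives `dQ ≥ T²`. For the vertex found, its common
        -- neighbours with `w` have on average at least the mean codegree `T/d`.
        good-neighbour : ∃[ v ] (adj w v ≡ true) × (0ℤ ≤ d * 𝐀 hg v - T * 𝐀 h v)
        good-neighbour with Fin.any? (λ v → (adj w v Bool.≟ true) ×-dec (0ℤ ≤? d * 𝐀 hg v - T * 𝐀 h v))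
        ... | yes p = p
        ... | no none = ⊥-elim (clash (dQ-T² ⊕ sum-mono _ _ term) d>0
          (trans (cong₂ (λ p q → d * Q - T * T + (p - q) + d) (sum-zero {n} (λ _ → 0ℤ) (λ _ → refl)) total)
            (solve 3 (λ d Q T →
                d :* Q :- T :* T :+ (# 0 :- (d :* Q :+ (:- T) :* T :+ # 1 :* d))
                :+ d := # 0) refl d Q T)))
          where
          Q = ⟨ h , (λ v → 𝐀 h v * 𝐀 h v) ⟩
          dQ-T² : 0ℤ ≤ d * Q - T * T
          dQ-T² = cancel-pos d>0 (subst (λ s → 0ℤ ≤ s * (s * Q - T * T)) (regular w) (cauchy-schwarz h (𝐀 h) (λ v → ind≥0 (adj w v))))
          total : sum (λ v → d * (h v * 𝐀 hg v) + (- T) * (h v * 𝐀 h v) + 1ℤ * h v) ≡ d * Q + (- T) * T + 1ℤ * d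
          total = trans (sum-lin d (- T) 1ℤ (λ v → h v * 𝐀 hg v) (λ v → h v * 𝐀 h v) h)
            (cong₂ (λ p q → d * p + (- T) * T + 1ℤ * q) (trans (B-sym h hg) (sum-cong-≗ λ v → lem (h v) (𝐀 h v))) (regular w))
            where
            lem : ∀ p q → p * q * q ≡ p * (q * q)
            lem = solve 2 (λ p q → p :* q :* q := p :* (q :* q)) refl
          term : ∀ v → 0ℤ ≤ 0ℤ - (d * (h v * 𝐀 hg v) + (- T) * (h v * 𝐀 h v) + 1ℤ * h v)
          term v with adj w v in e
          ... | false = by ≤-refl (let s = 𝐀 hg v; g = 𝐀 h v in (solve 4 (λ d T s g → # 0 := # 0 :- (d :* (# 0 :* s) :+ (:- T) :* (# 0 :* g) :+ # 1 :* # 0)) refl d T s g))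
          -- By integrality each failing neighbour falls short by at least 1, a total of at least
          -- `d > 0`.
          ... | true  = by (i≤j⇒0≤j-i (i<j⇒suc[i]≤j (≰⇒> λ z → none (v , e , z))))
            (let s = 𝐀 hg v; g = 𝐀 h v in (solve 4 (λ d T s g →
                # 0 :- (# 1 :+ (d :* s :- T :* g))
                := # 0 :- (d :* (# 1 :* s) :+ (:- T) :* (# 1 :* g) :+ # 1 :* # 1)) refl d T s g))

        -- When `2d > n`, the indicator of `N(w)` is too heavy to be balanced within the bounds, so
        -- some weight is taken off the common neighbourhood `m` of `w` and a good neighbour `v`.
        -- `m` is independent by `K₄`-freeness, and the choice of `v` makes the cross term `B h m`
        -- large.
        high-degree-triangles : 0ℤ ≤ + 2 * d - N → 0ℤ ≤ + 9 * T * (N - d) - N * N * d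
        high-degree-triangles high with good-neighbour
        ... | v , wv , S-bound with 𝐀 h v ≟ 0ℤ
        -- Codegree 0 forces `n = 2d`, where the simpler test vector already gives the claim.
        ...   | yes c≡0 = cancel-pos (pos {1}) (subst (λ m → 0ℤ ≤ + 2 * (+ 9 * T * (m - d) - m * m * d)) (sym N≡2d)
                (by (subst (λ m → 0ℤ ≤ + 9 * m * T - (+ 9 * d * d * d - (+ 9 * d - + 4 * m) * (m - d) * (m - d))) N≡2d
                      (low-degree-triangles low))
                  (solve 2 (λ d T →
                      # 9 :* (# 2 :* d) :* T :- (# 9 :* d :* d :* d :- (# 9 :* d :- # 4 :* (# 2 :* d)) :* (# 2 :* d
                      :- d) :* (# 2 :* d :- d))
                      := # 2 :* (# 9 :* T :* (# 2 :* d :- d) :- # 2 :* d :* (# 2 :* d) :* d)) refl d T)))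
          where
          low : 0ℤ ≤ N - + 2 * d
          low = by (codeg≥ v) (trans (cong (_- (+ 2 * d - N)) c≡0) (let m = N in (solve 2 (λ d m → # 0 :- (# 2 :* d :- m) := m :- # 2 :* d) refl d m)))
          N≡2d : N ≡ + 2 * d
          N≡2d = ≤-antisym (0≤i-j⇒j≤i high) (0≤i-j⇒j≤i low)
        ...   | no c≢0 = cancel-pos c>0 (by (<⇒≤ d>0 ⊗ tested ⊕ nn {9} ⊗ high ⊗ S-bound)
            (let m = N in (solve 5 (λ d T c S m →
                d :* (# 9 :* (c :* T :- (# 2 :* d :- m) :* S) :- m :* m :* c)
                :+ # 9 :* (# 2 :* d :- m) :* (d :* S :- T :* c)
                := c :* (# 9 :* T :* (m :- d) :- m :* m :* d)) refl d T c S m)))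
          where
          c = 𝐀 h v
          k = + 2 * d - N
          S = 𝐀 hg v
          c≥0 : 0ℤ ≤ c
          c≥0 = by (codeg≥ v ⊕ high) (solve 2 (λ c k → c :- k :+ k := c) refl c k)
          c>0 : 0ℤ < c
          c>0 = ≤∧≢⇒< c≥0 (c≢0 ∘ sym)
          m : Fin n → ℤ
          m u = a v u * h u
          -- The values are `c` on `N(w)` outside `N(v)`, `c - k` on the `c` common neighbours and
          -- `-c` elsewhere; the correction `-k` cancels the surplus `c(2d - n)`.
          x : Fin n → ℤ
          x u = + 2 * c * h u + (- k) * m u + (- c) * 1ℤ
          upper : ∀ u → 0ℤ ≤ c - x u
          upper u = by (nn {2} ⊗ c≥0 ⊗ ind≤1 (adj w u) ⊕ high ⊗ (ind≥0 (adj v u) ⊗ ind≥0 (adj w u)))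
            (let t = h u; s = m u in (solve 4 (λ c k t s →
                # 2 :* c :* (# 1 :- t) :+ k :* s
                := c :- (# 2 :* c :* t :+ (:- k) :* s :+ (:- c) :* # 1)) refl c k t s))
          lower : ∀ u → 0ℤ ≤ c + x u
          lower u = by ((c≥0 ⊕ codeg≥ v) ⊗ ind≥0 (adj w u) ⊕ high ⊗ (ind≤1 (adj v u) ⊗ ind≥0 (adj w u)))
            (let t = h u; s = a v u in (solve 4 (λ c k t s →
                (c :+ (c :- k)) :* t :+ k :* ((# 1 :- s) :* t)
                := c :+ (# 2 :* c :* t :+ (:- k) :* (s :* t) :+ (:- c) :* # 1)) refl c k t s))
          balanced : sum x ≡ 0ℤ
          balanced = trans (sum-lin (+ 2 * c) (- k) (- c) h m 𝟏) (trans (cong₂ (λ p q → + 2 * c * p + (- k) * c + (- c) * q) (regular w) sum-𝟏)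
            (let m = N in (solve 3 (λ c d m → # 2 :* c :* d :+ (:- (# 2 :* d :- m)) :* c :+ (:- c) :* m := # 0) refl c d m)))
          Bmm : B m m ≡ 0ℤ
          Bmm = sum-zero _ zero-term
            where
            zero-term : ∀ u → m u * 𝐀 m u ≡ 0ℤ
            zero-term u with adj v u in vu | adj w u in wu
            ... | false | b = trans (cong (_* 𝐀 m u) (0* (ind b))) (0* (𝐀 m u))
            ... | true | false = trans (cong (_* 𝐀 m u) (1* 0ℤ)) (0* (𝐀 m u))
            ... | true | true = trans (cong (1ℤ * 1ℤ *_) (sum-zero _ nothing)) ((solve 0 (# 1 :* # 1 :* # 0 := # 0) refl))
              where
              nothing : ∀ y → a u y * m y ≡ 0ℤ
              nothing y with adj u y in uy | adj v y in vy | adj w y in wy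
              ... | false | b | b′ = 0* (ind b * ind b′)
              ... | true | false | b′ = trans (1* (0ℤ * ind b′)) (0* (ind b′))
              ... | true | true | false = trans (1* (1ℤ * 0ℤ)) (1* 0ℤ)
              ... | true | true | true = ⊥-elim (K₄-free wv wu wy vu vy uy)
          Bhm : B h m ≡ S
          Bhm = trans (B-sym h m) (sum-cong-≗ λ u → lem (a v u) (h u) (𝐀 h u))
            where
            lem : ∀ p q r → p * q * r ≡ p * (q * r)
            lem = solve 3 (λ p q r → p :* q :* r := p :* (q :* r)) refl
          tested : 0ℤ ≤ + 9 * (c * T - k * S) - N * N * c
          tested = cancel-pos c>0 (cancel-pos (pos {3}) (by
            (subst (λ t → 0ℤ ≤ + 9 * t + + 9 * d * N * c * c - + 4 * N * N * c * c)
              (B-square-at (+ 2 * c) (- k) (- c) h m 𝟏 refl Bmm (trans (B-𝟏 𝟏) (cong (d *_) sum-𝟏)) Bhm B-h-𝟏 (B-𝟏 m))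
              (quadratic-bound c c>0 x upper lower balanced))
            (let m = N in (solve 5 (λ c d m T S →
                # 9 :* (# 2 :* c :* (# 2 :* c) :* T :+ (:- (# 2 :* d :- m)) :* (:- (# 2 :* d :- m)) :* # 0
                :+ (:- c) :* (:- c) :* (d :* m) :+ # 2 :* (# 2 :* c) :* (:- (# 2 :* d :- m)) :* S
                :+ # 2 :* (# 2 :* c) :* (:- c) :* (d :* d) :+ # 2 :* (:- (# 2 :* d :- m)) :* (:- c) :* (d :* c))
                :+ # 9 :* d :* m :* c :* c :- # 4 :* m :* m :* c :* c
                := # 4 :* (c :* (# 9 :* (c :* T :- (# 2 :* d :- m) :* S) :- m :* m :* c))) refl c d m T S))))

      -- Pairs of independent sets in a neighbourhood.

      data Class : Set where
        𝒜 𝒞 𝒟 𝒵 : Class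

      𝒜? : ∀ c → Dec (c ≡ 𝒜)
      𝒜? 𝒜 = yes refl
      𝒜? 𝒞 = no λ ()
      𝒜? 𝒟 = no λ ()
      𝒜? 𝒵 = no λ ()

      𝒞? : ∀ c → Dec (c ≡ 𝒞)
      𝒞? 𝒜 = no λ ()
      𝒞? 𝒞 = yes refl
      𝒞? 𝒟 = no λ ()
      𝒞? 𝒵 = no λ ()

      𝒟? : ∀ c → Dec (c ≡ 𝒟)
      𝒟? 𝒜 = no λ ()
      𝒟? 𝒞 = no λ ()
      𝒟? 𝒟 = yes refl
      𝒟? 𝒵 = no λ ()

      -- Disjoint independent sets 𝒜 and 𝒞 in the neighbourhood of w; 𝒟 is the rest of the
      -- neighbourhood and 𝒵 its complement.
      record Configuration : Set where
        field
          w        : Fin n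
          class    : Fin n → Class
          inside   : ∀ v → class v ≢ 𝒵 → adj w v ≡ true
          outside  : ∀ v → class v ≡ 𝒵 → adj w v ≡ false
          𝒜-indep : ∀ u v → class u ≡ 𝒜 → class v ≡ 𝒜 → adj u v ≡ false
          𝒞-indep : ∀ u v → class u ≡ 𝒞 → class v ≡ 𝒞 → adj u v ≡ false

      is𝒜 is𝒞 is𝒟 is𝒜𝒞 : Class → ℤ
      is𝒜 c = ind (does (𝒜? c))
      is𝒞 c = ind (does (𝒞? c))
      is𝒟 c = ind (does (𝒟? c))
      is𝒜𝒞 c = is𝒜 c + is𝒞 c

      is𝒜≥0 : ∀ c → 0ℤ ≤ is𝒜 c
      is𝒜≥0 c = ind≥0 (does (𝒜? c))

      is𝒞≥0 : ∀ c → 0ℤ ≤ is𝒞 c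
      is𝒞≥0 c = ind≥0 (does (𝒞? c))

      is𝒟≥0 : ∀ c → 0ℤ ≤ is𝒟 c
      is𝒟≥0 c = ind≥0 (does (𝒟? c))

      is𝒜𝒞≤1 : ∀ c → 0ℤ ≤ 1ℤ - is𝒜𝒞 c
      is𝒜𝒞≤1 𝒜 = nn
      is𝒜𝒞≤1 𝒞 = nn
      is𝒜𝒞≤1 𝒟 = nn
      is𝒜𝒞≤1 𝒵 = nn

      size : Configuration → ℤ
      size X = sum (is𝒜 ∘ class) + sum (is𝒞 ∘ class)
        where open Configuration X

      size≤N : ∀ X → 0ℤ ≤ N - size X
      size≤N X = by (sum-mono (is𝒜𝒞 ∘ class) 𝟏 (is𝒜𝒞≤1 ∘ class))
        (cong₂ _-_ sum-𝟏 (∑-distrib-+ (is𝒜 ∘ class) (is𝒞 ∘ class)))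
        where open Configuration X

      -- With `𝒜` and `𝒞` empty, this starts the ascent to a maximal configuration.
      star : Fin n → Configuration
      star w = record
        { w = w ; class = cls ; inside = ins ; outside = outs
        ; 𝒜-indep = λ u v p → ⊥-elim (no𝒜 u p) ; 𝒞-indep = λ u v p → ⊥-elim (no𝒞 u p) }
        where
        cls : Fin n → Class
        cls v = if adj w v then 𝒟 else 𝒵
        ins : ∀ v → cls v ≢ 𝒵 → adj w v ≡ true
        ins v p with adj w v
        ... | true  = refl
        ... | false = ⊥-elim (p refl)
        outs : ∀ v → cls v ≡ 𝒵 → adj w v ≡ false
        outs v p with adj w v
        ... | false = refl
        no𝒜 : ∀ v → cls v ≢ 𝒜
        no𝒜 v p with adj w v
        no𝒜 v () | true
        no𝒜 v () | false
        no𝒞 : ∀ v → cls v ≢ 𝒞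
        no𝒞 v p with adj w v
        no𝒞 v () | true
        no𝒞 v () | false

      module Triangle {w x y : Fin n} (wx : adj w x ≡ true) (wy : adj w y ≡ true) (xy : adj x y ≡ true) where

        cls : Fin n → Class
        cls v with adj w v | adj x v | adj y v
        ... | false | _     | _     = 𝒵
        ... | true  | true  | _     = 𝒜
        ... | true  | false | true  = 𝒞
        ... | true  | false | false = 𝒟

        cls-𝒜 : ∀ v → cls v ≡ 𝒜 → adj w v ≡ true × adj x v ≡ true
        cls-𝒜 v p with adj w v | adj x v | adj y v
        cls-𝒜 v () | false | _     | _
        cls-𝒜 v p  | true  | true  | _ = refl , refl
        cls-𝒜 v () | true  | false | true
        cls-𝒜 v () | true  | false | false

        cls-𝒞 : ∀ v → cls v ≡ 𝒞 → adj w v ≡ true × adj y v ≡ true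
        cls-𝒞 v p with adj w v | adj x v | adj y v
        cls-𝒞 v () | false | _     | _
        cls-𝒞 v () | true  | true  | _
        cls-𝒞 v p  | true  | false | true = refl , refl
        cls-𝒞 v () | true  | false | false

        inside : ∀ v → cls v ≢ 𝒵 → adj w v ≡ true
        inside v p with adj w v
        ... | true  = refl
        ... | false = ⊥-elim (p refl)

        outside : ∀ v → cls v ≡ 𝒵 → adj w v ≡ false
        outside v p with adj w v | adj x v | adj y v
        outside v p  | false | _     | _     = refl
        outside v () | true  | true  | _
        outside v () | true  | false | true
        outside v () | true  | false | false

        config : Configuration
        config = record
          { w = w ; class = cls ; inside = inside ; outside = outside
          ; 𝒜-indep = λ u v p q → let (wu , xu) = cls-𝒜 u p; (wv , xv) = cls-𝒜 v q in
              Bool.¬-not λ uv → K₄-free wx wu wv xu xv uv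
          ; 𝒞-indep = λ u v p q → let (wu , yu) = cls-𝒞 u p; (wv , yv) = cls-𝒞 v q in
              Bool.¬-not λ uv → K₄-free wy wu wv yu yv uv }

        -- `cls` gives `𝒜` precedence, but a vertex eligible for both sets would form a `K₄` with
        -- the triangle, so `𝒞` loses nothing.
        size-config : size config ≡ codeg w x + codeg w y
        size-config = cong₂ _+_ (sum-cong-≗ eq𝒜) (sum-cong-≗ eq𝒞)
          where
          eq𝒜 : ∀ v → is𝒜 (cls v) ≡ a w v * a x v
          eq𝒜 v with adj w v | adj x v | adj y v
          ... | false | b     | _     = sym (0* (ind b))
          ... | true  | true  | _     = sym (1* 1ℤ)
          ... | true  | false | true  = sym (1* 0ℤ)
          ... | true  | false | false = sym (1* 0ℤ)
          eq𝒞 : ∀ v → is𝒞 (cls v) ≡ a w v * a y v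
          eq𝒞 v with adj w v in wv | adj x v in xv | adj y v in yv
          ... | false | _     | b     = sym (0* (ind b))
          ... | true  | true  | false = sym (1* 0ℤ)
          ... | true  | true  | true  = ⊥-elim (K₄-free wx wy wv xy xv yv)
          ... | true  | false | true  = sym (1* 1ℤ)
          ... | true  | false | false = sym (1* 0ℤ)

      -- Consequences of maximality and the case `2d < n`.

      module Maximal (X : Configuration) (maximal : ∀ Y → 0ℤ ≤ size X - size Y) where

        open Configuration X
        open Neighbourhood w

        α γ ω : Fin n → ℤ
        α = is𝒜 ∘ class
        γ = is𝒞 ∘ class
        ω = is𝒟 ∘ class

        σ A C D : ℤ
        σ = size X
        A = sum α
        C = sum γ
        D = sum ω

        α≥0 : ∀ v → 0ℤ ≤ α v
        α≥0 = is𝒜≥0 ∘ class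
        γ≥0 : ∀ v → 0ℤ ≤ γ v
        γ≥0 = is𝒞≥0 ∘ class
        ω≥0 : ∀ v → 0ℤ ≤ ω v
        ω≥0 = is𝒟≥0 ∘ class

        A≥0 : 0ℤ ≤ A
        A≥0 = sum-≥0 α α≥0
        C≥0 : 0ℤ ≤ C
        C≥0 = sum-≥0 γ γ≥0
        D≥0 : 0ℤ ≤ D
        D≥0 = sum-≥0 ω ω≥0

        h-split : ∀ v → h v ≡ 1ℤ * α v + 1ℤ * γ v + 1ℤ * ω v
        h-split v with class v in e
        ... | 𝒜 = trans (cong ind (inside v (via-≢ e λ ())))
          (solve 0 (# 1 := # 1 :* # 1 :+ # 1 :* # 0 :+ # 1 :* # 0) refl)
        ... | 𝒞 = trans (cong ind (inside v (via-≢ e λ ())))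
          (solve 0 (# 1 := # 1 :* # 0 :+ # 1 :* # 1 :+ # 1 :* # 0) refl)
        ... | 𝒟 = trans (cong ind (inside v (via-≢ e λ ())))
          (solve 0 (# 1 := # 1 :* # 0 :+ # 1 :* # 0 :+ # 1 :* # 1) refl)
        ... | 𝒵 = trans (cong ind (outside v e)) (solve 0 (# 0 := # 1 :* # 0 :+ # 1 :* # 0 :+ # 1 :* # 0) refl)

        d-split : d ≡ A + C + D
        d-split = trans (sym (regular w)) (trans (sum-cong-≗ h-split) (trans (sum-lin 1ℤ 1ℤ 1ℤ α γ ω)
          (solve 3 (λ A C D → # 1 :* A :+ # 1 :* C :+ # 1 :* D := A :+ C :+ D) refl A C D)))

        adj-h : ∀ {v} → h v ≡ 1ℤ → adj w v ≡ true
        adj-h {v} e with adj w v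
        adj-h e  | true  = refl
        adj-h () | false

        supported : (f : Class → ℤ) → f 𝒵 ≡ 0ℤ → ∀ v → adj w v ≡ false → f (class v) ≡ 0ℤ
        supported f e v wv with class v in c
        ... | 𝒵 = e
        ... | 𝒜 = ⊥-elim (true≢false (inside v (via-≢ c λ ())) wv)
        ... | 𝒞 = ⊥-elim (true≢false (inside v (via-≢ c λ ())) wv)
        ... | 𝒟 = ⊥-elim (true≢false (inside v (via-≢ c λ ())) wv)

        -- The triangle is arbitrary and need not contain `w`, since `X` is maximal among the
        -- configurations at all base vertices.
        codeg-sum : ∀ {u x y} → adj u x ≡ true → adj u y ≡ true → adj x y ≡ true →
          0ℤ ≤ σ - (codeg u x + codeg u y)
        codeg-sum ux uy xy = subst (λ t → 0ℤ ≤ σ - t) (Triangle.size-config ux uy xy) (maximal (Triangle.config ux uy xy))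

        𝐀h-codeg : ∀ v → 𝐀 h v ≡ codeg w v
        𝐀h-codeg v = sum-cong-≗ λ x → *-comm′ (a v x) (a w x)

        degree-sum-h : ∀ {x y} → adj w x ≡ true → adj w y ≡ true → adj x y ≡ true → 0ℤ ≤ σ - 𝐀 h x - 𝐀 h y
        degree-sum-h {x} {y} wx wy xy = by (codeg-sum wx wy xy) (trans (cong₂ (λ p q → σ - (p + q)) (sym (𝐀h-codeg x)) (sym (𝐀h-codeg y)))
          (let p = 𝐀 h x; q = 𝐀 h y in (solve 3 (λ σ p q → σ :- (p :+ q) := σ :- p :- q) refl σ p q)))

        -- Of the three codegrees in the triangle `wxy`, the two at `y` sum to at most `σ`, while
        -- all three sum to at least `3d - n`.
        codeg-lower : ∀ {x y} → adj w x ≡ true → adj w y ≡ true → adj x y ≡ true → 0ℤ ≤ 𝐀 h x - (+ 3 * d - N - σ)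
        codeg-lower {x} {y} wx wy xy = by (triangle-codeg w x y ⊕ codeg-sum (symᵃ wy) (symᵃ xy) wx)
          (trans (let p = codeg w x; q = codeg y w; r = codeg y x; m = N in
              (solve 6 (λ d m σ p q r →
                  p :+ q :+ r :- (# 3 :* d :- m) :+ (σ :- (q :+ r))
                  := p :- (# 3 :* d :- m :- σ)) refl d m σ p q r))
            (cong (_- (+ 3 * d - N - σ)) (sym (𝐀h-codeg x))))

        -- For an edge inside `N(w)` the degrees of its ends there are codegrees of a triangle at
        -- `w`, so their sum is at most `σ` and `degree-sum` applies.
        2T≤dσ : 0ℤ ≤ d * σ - + 2 * T
        2T≤dσ = subst (λ t → 0ℤ ≤ t * σ - + 2 * T) (regular w) (degree-sum h σ h01 (A≥0 ⊕ C≥0)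
          λ x y hx hy xy → degree-sum-h (adj-h hx) (adj-h hy) xy)
          where
          h01 : ∀ v → (h v ≡ 0ℤ) ⊎ (h v ≡ 1ℤ)
          h01 v with adj w v
          ... | true  = inj₂ refl
          ... | false = inj₁ refl

        𝐀α-𝒜 : ∀ {v} → class v ≡ 𝒜 → 𝐀 α v ≡ 0ℤ
        𝐀α-𝒜 {v} cv = sum-zero _ zero-term
          where
          zero-term : ∀ u → a v u * α u ≡ 0ℤ
          zero-term u with class u in cu
          ... | 𝒜 = trans (cong (λ b → ind b * 1ℤ) (𝒜-indep v u cv cu)) (0* 1ℤ)
          ... | 𝒞 = trans (*-comm′ (a v u) 0ℤ) (0* (a v u))
          ... | 𝒟 = trans (*-comm′ (a v u) 0ℤ) (0* (a v u))
          ... | 𝒵 = trans (*-comm′ (a v u) 0ℤ) (0* (a v u))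

        B-αα : B α α ≡ 0ℤ
        B-αα = sum-zero _ zero-term
          where
          zero-term : ∀ v → α v * 𝐀 α v ≡ 0ℤ
          zero-term v with class v in cv
          ... | 𝒜 = trans (cong (1ℤ *_) (𝐀α-𝒜 cv)) (1* 0ℤ)
          ... | 𝒞 = 0* (𝐀 α v)
          ... | 𝒟 = 0* (𝐀 α v)
          ... | 𝒵 = 0* (𝐀 α v)

        B-γγ : B γ γ ≡ 0ℤ
        B-γγ = sum-zero _ zero-term
          where
          𝐀γ : ∀ v → class v ≡ 𝒞 → ∀ u → a v u * γ u ≡ 0ℤ
          𝐀γ v cv u with class u in cu
          ... | 𝒞 = trans (cong (λ b → ind b * 1ℤ) (𝒞-indep v u cv cu)) (0* 1ℤ)
          ... | 𝒜 = trans (*-comm′ (a v u) 0ℤ) (0* (a v u))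
          ... | 𝒟 = trans (*-comm′ (a v u) 0ℤ) (0* (a v u))
          ... | 𝒵 = trans (*-comm′ (a v u) 0ℤ) (0* (a v u))
          zero-term : ∀ v → γ v * 𝐀 γ v ≡ 0ℤ
          zero-term v with class v in cv
          ... | 𝒞 = trans (cong (1ℤ *_) (sum-zero _ (𝐀γ v cv))) (1* 0ℤ)
          ... | 𝒜 = 0* (𝐀 γ v)
          ... | 𝒟 = 0* (𝐀 γ v)
          ... | 𝒵 = 0* (𝐀 γ v)

        T-split : T ≡ + 2 * B α γ + + 2 * B ω α + + 2 * B ω γ + B ω ω
        T-split = trans (B-cong h-split h-split) (trans (B-square-at 1ℤ 1ℤ 1ℤ α γ ω B-αα B-γγ refl refl (B-sym α ω) (B-sym γ ω))
          (let p = B α γ; q = B ω α; r = B ω γ; s = B ω ω in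
            (solve 4 (λ p q r s →
                # 1 :* # 1 :* # 0 :+ # 1 :* # 1 :* # 0 :+ # 1 :* # 1 :* s
                :+ # 2 :* # 1 :* # 1 :* p :+ # 2 :* # 1 :* # 1 :* q
                :+ # 2 :* # 1 :* # 1 :* r
                := # 2 :* p :+ # 2 :* q :+ # 2 :* r :+ s) refl p q r s)))

        𝐀h-split : ∀ v → 𝐀 h v ≡ 𝐀 α v + 𝐀 γ v + 𝐀 ω v
        𝐀h-split v = trans (𝐀-cong h-split v) (trans (𝐀-lin 1ℤ 1ℤ 1ℤ α γ ω v)
          (let p = 𝐀 α v; q = 𝐀 γ v; r = 𝐀 ω v in (solve 3 (λ p q r → # 1 :* p :+ # 1 :* q :+ # 1 :* r := p :+ q :+ r) refl p q r)))

        low-degree-contradiction : 0ℤ < N - + 2 * d → ⊥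
        low-degree-contradiction low = low-degree-arithmetic N d T N>0 low (low-degree-triangles (<⇒≤ low))
          (by (cut ⊕ nn {9} ⊗ T-bound ⊕ nn {18} ⊗ 2T≤dσ)
            (trans (let b = B α γ; m = N in (solve 6 (λ d T D σ b m →
                # 9 :* d :* m :- # 4 :* m :* m :- # 18 :* b
                :+ # 9 :* (# 2 :* b :- T :+ # 2 :* d :* D)
                :+ # 18 :* (d :* σ :- # 2 :* T)
                := # 9 :* d :* m :- # 4 :* m :* m :- # 9 :* (# 5 :* T :- # 2 :* d :* (σ :+ D))) refl d T D σ b m))
              (cong (λ t → + 9 * d * N - + 4 * N * N - + 9 * (+ 5 * T - + 2 * d * t)) (sym d-split))))
          where
          N>0 : 0ℤ < N
          N>0 = by⁺ (nn {2} ⊗ <⇒≤ d>0 ⊕⁺ low) (let m = N in (solve 2 (λ d m → # 2 :* d :+ (m :- # 2 :* d) := m) refl d m))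
          -- Edges of `N(w)` not running between `𝒜` and `𝒞` meet `𝒟`, and each vertex of `𝒟` has
          -- degree at most `d`.
          T-bound : 0ℤ ≤ + 2 * B α γ - T + + 2 * d * D
          T-bound = by (sum-≥0 _ λ v → ω≥0 v ⊗ (nn {2} ⊗ 𝐀≤d h (λ u → ind≤1 (adj w u)) v ⊕ 𝐀≥0 ω ω≥0 v))
            (trans (sum-cong-≗ λ v → trans (cong (λ t → ω v * (+ 2 * (d - t) + 𝐀 ω v)) (𝐀h-split v))
                (lem (ω v) (𝐀 α v) (𝐀 γ v) (𝐀 ω v)))
              (trans (sum-lin (- (+ 2)) (- (+ 2)) 1ℤ (λ v → ω v * 𝐀 α v) (λ v → ω v * 𝐀 γ v) (λ v → + 2 * d * ω v + (- 1ℤ) * (ω v * 𝐀 ω v) + 0ℤ * ω v))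
                (trans (cong (λ t → (- (+ 2)) * B ω α + (- (+ 2)) * B ω γ + 1ℤ * t) (sum-lin (+ 2 * d) (- 1ℤ) 0ℤ ω (λ v → ω v * 𝐀 ω v) ω))
                  (trans (let p = B α γ; q = B ω α; r = B ω γ; s = B ω ω in
                      (solve 6 (λ p q r s d D →
                          (:- (# 2)) :* q :+ (:- (# 2)) :* r :+ # 1 :* (# 2 :* d :* D :+ (:- # 1) :* s
                          :+ # 0 :* D) := # 2 :* p :- (# 2 :* p :+ # 2 :* q :+ # 2 :* r :+ s)
                          :+ # 2 :* d :* D) refl p q r s d D))
                    (cong (λ t → + 2 * B α γ - t + + 2 * d * D) (sym T-split))))))
            where
            lem : ∀ o p q r → o * (+ 2 * (d - (p + q + r)) + r) ≡ (- (+ 2)) * (o * p) + (- (+ 2)) * (o * q) + 1ℤ * (+ 2 * d * o + (- 1ℤ) * (o * r) + 0ℤ * o)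
            lem o p q r = (solve 5 (λ d o p q r →
                o :* (# 2 :* (d :- (p :+ q :+ r)) :+ r)
                := (:- (# 2)) :* (o :* p) :+ (:- (# 2)) :* (o :* q)
                :+ # 1 :* (# 2 :* d :* o :+ (:- # 1) :* (o :* r) :+ # 0 :* o)) refl d o p q r)
          u y : Fin n → ℤ
          u v = 1ℤ * α v + 1ℤ * γ v + 0ℤ * γ v
          y v = 1ℤ * α v + (- 1ℤ) * γ v + 0ℤ * γ v
          sum-u : sum u ≡ A + C
          sum-u = trans (sum-lin 1ℤ 1ℤ 0ℤ α γ γ) (solve 2 (λ A C → # 1 :* A :+ # 1 :* C :+ # 0 :* C := A :+ C) refl A C)
          sum-y : sum y ≡ A - C
          sum-y = trans (sum-lin 1ℤ (- 1ℤ) 0ℤ α γ γ) (solve 2 (λ A C → # 1 :* A :+ (:- # 1) :* C :+ # 0 :* C := A :- C) refl A C)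
          z>0 : 0ℤ < N - sum u
          z>0 = subst (λ t → 0ℤ < N - t) (sym sum-u) (by⁺ (<⇒≤ d>0 ⊕ D≥0 ⊕⁺ low)
            (trans (cong (λ t → t + D + (N - + 2 * t)) d-split) (let m = N in (solve 4 (λ A C D m → A :+ C :+ D :+ D :+ (m :- # 2 :* (A :+ C :+ D)) := m :- (A :+ C)) refl A C D m))))
          cases : ∀ v → (u v ≡ 1ℤ) × (0ℤ ≤ 1ℤ - y v) × (0ℤ ≤ 1ℤ + y v) ⊎ (u v ≡ 0ℤ) × (y v ≡ 0ℤ)
          cases v with class v
          ... | 𝒜 = inj₁ ((solve 0 (# 1 :* # 1 :+ # 1 :* # 0 :+ # 0 :* # 0 := # 1) refl)
                  , by ≤-refl (solve 0 (# 0 := # 1 :- (# 1 :* # 1 :+ (:- # 1) :* # 0 :+ # 0 :* # 0)) refl)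
                  , by (nn {2}) (solve 0 (# 2 := # 1 :+ (# 1 :* # 1 :+ (:- # 1) :* # 0 :+ # 0 :* # 0)) refl))
          ... | 𝒞 = inj₁ ((solve 0 (# 1 :* # 0 :+ # 1 :* # 1 :+ # 0 :* # 1 := # 1) refl)
                  , by (nn {2}) (solve 0 (# 2 := # 1 :- (# 1 :* # 0 :+ (:- # 1) :* # 1 :+ # 0 :* # 1)) refl)
                  , by ≤-refl (solve 0 (# 0 := # 1 :+ (# 1 :* # 0 :+ (:- # 1) :* # 1 :+ # 0 :* # 1)) refl))
          ... | 𝒟 = inj₂ ((solve 0 (# 1 :* # 0 :+ # 1 :* # 0 :+ # 0 :* # 0 := # 0) refl) , (solve 0 (# 1 :* # 0 :+ (:- # 1) :* # 0 :+ # 0 :* # 0 := # 0) refl))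
          ... | 𝒵 = inj₂ ((solve 0 (# 1 :* # 0 :+ # 1 :* # 0 :+ # 0 :* # 0 := # 0) refl) , (solve 0 (# 1 :* # 0 :+ (:- # 1) :* # 0 :+ # 0 :* # 0 := # 0) refl))
          2A≤N : 0ℤ ≤ (N - sum u) * 1ℤ - sum y
          2A≤N = by (<⇒≤ low ⊕ nn {2} ⊗ (C≥0 ⊕ D≥0)) (trans (cong (λ t → N - + 2 * t + + 2 * (C + D)) d-split)
            (trans (let m = N in (solve 4 (λ A C D m →
                m :- # 2 :* (A :+ C :+ D) :+ # 2 :* (C :+ D)
                := (m :- (A :+ C)) :* # 1 :- (A :- C)) refl A C D m))
              (cong₂ (λ p q → (N - p) * 1ℤ - q) (sym sum-u) (sym sum-y))))
          2C≤N : 0ℤ ≤ (N - sum u) * 1ℤ + sum y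
          2C≤N = by (<⇒≤ low ⊕ nn {2} ⊗ (A≥0 ⊕ D≥0)) (trans (cong (λ t → N - + 2 * t + + 2 * (A + D)) d-split)
            (trans (let m = N in (solve 4 (λ A C D m →
                m :- # 2 :* (A :+ C :+ D) :+ # 2 :* (A :+ D)
                := (m :- (A :+ C)) :* # 1 :+ (A :- C)) refl A C D m))
              (cong₂ (λ p q → (N - p) * 1ℤ + q) (sym sum-u) (sym sum-y))))
          Byy : B y y ≡ - (+ 2) * B α γ
          Byy = trans (B-square-at 1ℤ (- 1ℤ) 0ℤ α γ γ B-αα B-γγ B-γγ refl refl B-γγ)
            (let b = B α γ in (solve 1 (λ b →
                # 1 :* # 1 :* # 0 :+ (:- # 1) :* (:- # 1) :* # 0
                :+ # 0 :* # 0 :* # 0 :+ # 2 :* # 1 :* (:- # 1) :* b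
                :+ # 2 :* # 1 :* # 0 :* b :+ # 2 :* (:- # 1) :* # 0 :* # 0
                := (:- (# 2)) :* b) refl b))
          -- `B (α - γ) (α + γ)` is `B α α - B γ γ`, and both sets are independent. Cutting `𝒜 ∪ 𝒞`
          -- rather than all of `N(w)` thus makes the `η²` term of `cut-bound` vanish.
          Byu : B y u ≡ 0ℤ
          Byu = trans (B-linˡ 1ℤ (- 1ℤ) 0ℤ α γ γ u) (trans (cong₂ (λ p q → 1ℤ * p + (- 1ℤ) * q + 0ℤ * q)
              (trans (B-linʳ 1ℤ 1ℤ 0ℤ α γ γ α) (cong (λ t → 1ℤ * t + 1ℤ * B α γ + 0ℤ * B α γ) B-αα))
              (trans (B-linʳ 1ℤ 1ℤ 0ℤ α γ γ γ) (cong₂ (λ s t → 1ℤ * s + 1ℤ * t + 0ℤ * t) (B-sym γ α) B-γγ)))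
            (let b = B α γ in (solve 1 (λ b →
                # 1 :* (# 1 :* # 0 :+ # 1 :* b :+ # 0 :* b)
                :+ (:- # 1) :* (# 1 :* b :+ # 1 :* # 0 :+ # 0 :* # 0)
                :+ # 0 :* (# 1 :* b :+ # 1 :* # 0 :+ # 0 :* # 0)
                := # 0) refl b)))
          cut : 0ℤ ≤ + 9 * d * N - + 4 * N * N - + 18 * B α γ
          cut = cancel-pos (*-pos d>0 z>0) (by
            (subst₂ (λ p q → 0ℤ ≤ + 9 * (d * (N - sum u) * p + q * q) - d * (N - sum u) * 1ℤ * 1ℤ * (+ 4 * N * N - + 9 * d * N)) Byy Byu
              (cut-bound 1ℤ pos u y z>0 cases 2A≤N 2C≤N))
            (let b = B α γ; m = N; s = sum u in (solve 4 (λ d m s b →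
                # 9 :* (d :* (m :- s) :* ((:- (# 2)) :* b) :+ # 0 :* # 0)
                :- d :* (m :- s) :* # 1 :* # 1 :* (# 4 :* m :* m :- # 9 :* d :* m)
                := d :* (m :- s) :* (# 9 :* d :* m :- # 4 :* m :* m :- # 18 :* b)) refl d m s b)))

        -- A vertex of 𝒟 without neighbours in 𝒜 could be moved to 𝒜.
        𝒜-neighbour : ∀ x → class x ≡ 𝒟 → ∃[ y ] (class y ≡ 𝒜) × (adj x y ≡ true)
        𝒜-neighbour x cx with Fin.any? (λ y → (𝒜? (class y)) ×-dec (adj x y Bool.≟ true))
        ... | yes p = p
        ... | no none = ⊥-elim (clash (maximal larger) (pos {0}) (trans (cong (λ t → size X - t + 1ℤ) size-larger)
                (let s = size X in (solve 1 (λ s → s :- (s :+ # 1) :+ # 1 := # 0) refl s))))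
          where
          isolated : ∀ y → class y ≡ 𝒜 → adj x y ≡ false
          isolated y cy = Bool.¬-not λ xy → none (y , cy , xy)
          class⁺ : Fin n → Class
          class⁺ v = if does (x Fin.≟ v) then 𝒜 else class v
          inside⁺ : ∀ v → class⁺ v ≢ 𝒵 → adj w v ≡ true
          inside⁺ v p with x Fin.≟ v
          ... | yes refl = inside x (via-≢ cx λ ())
          ... | no _ = inside v p
          outside⁺ : ∀ v → class⁺ v ≡ 𝒵 → adj w v ≡ false
          outside⁺ v p with x Fin.≟ v
          outside⁺ v () | yes refl
          ... | no _ = outside v p
          𝒜⁺ : ∀ u v → class⁺ u ≡ 𝒜 → class⁺ v ≡ 𝒜 → adj u v ≡ false
          𝒜⁺ u v p q with x Fin.≟ u | x Fin.≟ v
          ... | yes refl | yes refl = adj-irrefl x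
          ... | yes refl | no _     = isolated v q
          ... | no _     | yes refl = trans (adj-sym u x) (isolated u p)
          ... | no _     | no _     = 𝒜-indep u v p q
          𝒞⁺ : ∀ u v → class⁺ u ≡ 𝒞 → class⁺ v ≡ 𝒞 → adj u v ≡ false
          𝒞⁺ u v p q with x Fin.≟ u | x Fin.≟ v
          𝒞⁺ u v () q | yes refl | _
          𝒞⁺ u v p () | no _ | yes refl
          ... | no _     | no _     = 𝒞-indep u v p q
          larger : Configuration
          larger = record { w = w ; class = class⁺ ; inside = inside⁺ ; outside = outside⁺ ; 𝒜-indep = 𝒜⁺ ; 𝒞-indep = 𝒞⁺ }
          sum-α⁺ : sum (is𝒜 ∘ class⁺) ≡ A + 1ℤ
          sum-α⁺ = trans (sum-cong-≗ eq) (trans (∑-distrib-+ α (δ x)) (cong (λ t → A + t) (trans (sym (⟨⟩-𝟏 (δ x))) (sum-δ x 𝟏))))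
            where
            eq : ∀ v → is𝒜 (class⁺ v) ≡ α v + δ x v
            eq v with x Fin.≟ v
            ... | yes refl = sym (trans (cong₂ _+_ (cong is𝒜 cx) (δ-diag x)) refl)
            ... | no x≢v   = sym (trans (cong (λ t → α v + t) (δ-off x≢v)) (+-identityʳ (α v)))
          sum-γ⁺ : sum (is𝒞 ∘ class⁺) ≡ C
          sum-γ⁺ = sum-cong-≗ eq
            where
            eq : ∀ v → is𝒞 (class⁺ v) ≡ γ v
            eq v with x Fin.≟ v
            ... | yes refl = sym (cong is𝒞 cx)
            ... | no _     = refl
          size-larger : size larger ≡ size X + 1ℤ
          size-larger = trans (cong₂ _+_ sum-α⁺ sum-γ⁺) (solve 2 (λ A C → A :+ # 1 :+ C := A :+ C :+ # 1) refl A C)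

        adj-𝒜 : ∀ {v} → class v ≡ 𝒜 → adj w v ≡ true
        adj-𝒜 {v} cv = inside v (via-≢ cv λ ())

        adj-𝒟 : ∀ {v} → class v ≡ 𝒟 → adj w v ≡ true
        adj-𝒟 {v} cv = inside v (via-≢ cv λ ())

        -- A neighbour `y` of `x` in `𝒜` has at least `3d - n - σ` neighbours in `N(w)`. They avoid
        -- `𝒜`, which is independent, and the neighbours of `x`, so they must fit into what `x`
        -- leaves of `𝒞` and `𝒟`.
        𝒞𝒟-pressure : ∀ x → class x ≡ 𝒟 → 0ℤ ≤ C - 𝐀 γ x + (D - 𝐀 ω x) - (+ 3 * d - N - σ)
        𝒞𝒟-pressure x cx with 𝒜-neighbour x cx
        ... | y , cy , xy = by (codeg-lower (adj-𝒜 cy) (adj-𝒟 cx) (symᵃ xy)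
            ⊕ disjoint-nbrs (adj-𝒟 cx) (adj-𝒜 cy) xy γ γ≥0 (supported is𝒞 refl)
            ⊕ disjoint-nbrs (adj-𝒟 cx) (adj-𝒜 cy) xy ω ω≥0 (supported is𝒟 refl))
          (trans (cong (λ t → t - c₁ + (C - 𝐀 γ x - 𝐀 γ y) + (D - 𝐀 ω x - 𝐀 ω y))
              (trans (𝐀h-split y) (cong (λ t → t + 𝐀 γ y + 𝐀 ω y) (𝐀α-𝒜 cy))))
            (let p = 𝐀 γ x; q = 𝐀 γ y; r = 𝐀 ω x; s = 𝐀 ω y in
              (solve 7 (λ C D c₁ p q r s →
                  # 0 :+ q :+ s :- c₁ :+ (C :- p :- q) :+ (D :- r :- s)
                  := C :- p :+ (D :- r) :- c₁) refl C D c₁ p q r s)))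
          where
          c₁ = + 3 * d - N - σ

        codeg-lower-𝒟 : ∀ x → class x ≡ 𝒟 → 0ℤ ≤ 𝐀 h x - (+ 3 * d - N - σ)
        codeg-lower-𝒟 x cx with 𝒜-neighbour x cx
        ... | y , cy , xy = codeg-lower (adj-𝒟 cx) (adj-𝒜 cy) xy

        𝐀≤sum : ∀ f → (∀ v → 0ℤ ≤ f v) → ∀ u → 0ℤ ≤ sum f - 𝐀 f u
        𝐀≤sum f f≥0 u = sum-mono _ f λ v → by (ind≤1 (adj u v) ⊗ f≥0 v)
          (let x = a u v; y = f v in (solve 2 (λ x y → (# 1 :- x) :* y := y :- x :* y) refl x y))

        -- If `𝒜` were empty, `𝒟` would be empty too, since its vertices have neighbours in `𝒜`;
        -- then `N(w) = 𝒞` would be independent.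
        𝒜-vertex : 0ℤ < T → ∃[ y ] class y ≡ 𝒜
        𝒜-vertex T>0 with Fin.any? (λ y → 𝒜? (class y))
        ... | yes p = p
        ... | no none = ⊥-elim (<-irrefl (sym T≡0) T>0)
          where
          α≡0 : ∀ v → α v ≡ 0ℤ
          α≡0 v with class v in cv
          ... | 𝒜 = ⊥-elim (none (v , cv))
          ... | 𝒞 = refl
          ... | 𝒟 = refl
          ... | 𝒵 = refl
          ω≡0 : ∀ v → ω v ≡ 0ℤ
          ω≡0 v with class v in cv
          ... | 𝒜 = refl
          ... | 𝒞 = refl
          ... | 𝒵 = refl
          ... | 𝒟 = ⊥-elim (none (let (y , cy , _) = 𝒜-neighbour v cv in y , cy))
          vanish : ∀ f g → (∀ v → f v ≡ 0ℤ) → B f g ≡ 0ℤ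
          vanish f g p = sum-zero _ λ v → trans (cong (_* 𝐀 g v) (p v)) (0* (𝐀 g v))
          T≡0 : T ≡ 0ℤ
          T≡0 = trans T-split (trans (cong₂ (λ p q → + 2 * p + + 2 * q + + 2 * B ω γ + B ω ω) (vanish α γ α≡0) (vanish ω α ω≡0))
            (trans (cong₂ (λ p q → + 2 * 0ℤ + + 2 * 0ℤ + + 2 * p + q) (vanish ω γ ω≡0) (vanish ω ω ω≡0))
              (solve 0 (# 2 :* # 0 :+ # 2 :* # 0 :+ # 2 :* # 0 :+ # 0 := # 0) refl)))

        -- A vertex of `𝒜` with a neighbour in `N(w)` has at least `3d - n - σ = 2d - n + D` of
        -- them, all in `𝒞` or `𝒟`, and at most `D` lie in `𝒟`. Without such a neighbour its
        -- codegree 0 forces `2d ≤ n`.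
        𝒞-large : 0ℤ < T → 0ℤ ≤ + 2 * d - N → 0ℤ ≤ C - (+ 2 * d - N)
        𝒞-large T>0 high with 𝒜-vertex T>0
        ... | y , cy with Fin.any? (λ x → (adj w x Bool.≟ true) ×-dec (adj y x Bool.≟ true))
        ...   | yes (x , wx , yx) = by (codeg-lower (adj-𝒜 cy) wx yx ⊕ 𝐀≤sum γ γ≥0 y ⊕ 𝐀≤sum ω ω≥0 y)
            (trans (cong₂ (λ s t → s - (+ 3 * t - N - (A + C)) + (C - 𝐀 γ y) + (D - 𝐀 ω y))
                (trans (𝐀h-split y) (cong (λ t → t + 𝐀 γ y + 𝐀 ω y) (𝐀α-𝒜 cy))) d-split)
              (trans (let p = 𝐀 γ y; q = 𝐀 ω y; m = N in (solve 6 (λ A C D m p q →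
                  # 0 :+ p :+ q :- (# 3 :* (A :+ C :+ D) :- m :- (A :+ C))
                  :+ (C :- p) :+ (D :- q)
                  := C :- (# 2 :* (A :+ C :+ D) :- m)) refl A C D m p q))
                (cong (λ t → C - (+ 2 * t - N)) (sym d-split))))
        ...   | no none = by (C≥0 ⊕ codeg≥ y) (trans (cong (λ t → C + (t - (+ 2 * d - N))) (sum-zero _ vanish))
              (let k = + 2 * d - N in (solve 2 (λ C k → C :+ (# 0 :- k) := C :- k) refl C k)))
          where
          vanish : ∀ x → a y x * h x ≡ 0ℤ
          vanish x with adj y x in yx | adj w x in wx
          ... | false | b     = 0* (ind b)
          ... | true  | false = 1* 0ℤ
          ... | true  | true  = ⊥-elim (none (x , wx , yx))

      swapᶜ : Class → Class
      swapᶜ 𝒜 = 𝒞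
      swapᶜ 𝒞 = 𝒜
      swapᶜ 𝒟 = 𝒟
      swapᶜ 𝒵 = 𝒵

      swapᶜ-involutive : ∀ c → swapᶜ (swapᶜ c) ≡ c
      swapᶜ-involutive 𝒜 = refl
      swapᶜ-involutive 𝒞 = refl
      swapᶜ-involutive 𝒟 = refl
      swapᶜ-involutive 𝒵 = refl

      swap-≡ : ∀ {c c′} → swapᶜ c ≡ c′ → c ≡ swapᶜ c′
      swap-≡ {c} p = trans (sym (swapᶜ-involutive c)) (cong swapᶜ p)

      is𝒜-swap : ∀ c → is𝒜 (swapᶜ c) ≡ is𝒞 c
      is𝒜-swap 𝒜 = refl
      is𝒜-swap 𝒞 = refl
      is𝒜-swap 𝒟 = refl
      is𝒜-swap 𝒵 = refl

      is𝒞-swap : ∀ c → is𝒞 (swapᶜ c) ≡ is𝒜 c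
      is𝒞-swap 𝒜 = refl
      is𝒞-swap 𝒞 = refl
      is𝒞-swap 𝒟 = refl
      is𝒞-swap 𝒵 = refl

      is𝒟-swap : ∀ c → is𝒟 (swapᶜ c) ≡ is𝒟 c
      is𝒟-swap 𝒜 = refl
      is𝒟-swap 𝒞 = refl
      is𝒟-swap 𝒟 = refl
      is𝒟-swap 𝒵 = refl

      -- Exchanging the two sets preserves the size, hence maximality, and so transfers the bounds
      -- for `𝒞` to `𝒜`.
      swap : Configuration → Configuration
      swap X = record
        { w = w ; class = swapᶜ ∘ class
        ; inside = λ v p → inside v λ e → p (cong swapᶜ e)
        ; outside = λ v p → outside v (swap-≡ p)
        ; 𝒜-indep = λ u v p q → 𝒞-indep u v (swap-≡ p) (swap-≡ q)
        ; 𝒞-indep = λ u v p q → 𝒜-indep u v (swap-≡ p) (swap-≡ q) }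
        where open Configuration X

      size-swap : ∀ X → size (swap X) ≡ size X
      size-swap X = trans (cong₂ _+_ (sum-cong-≗ (is𝒜-swap ∘ class)) (sum-cong-≗ (is𝒞-swap ∘ class)))
        (+-comm (sum (is𝒞 ∘ class)) (sum (is𝒜 ∘ class)))
        where open Configuration X

      -- The case `n ≤ 2d` with `3d < 2n`.

      module HighDegree (X : Configuration) (maximal : ∀ Y → 0ℤ ≤ size X - size Y)
        (high : 0ℤ ≤ + 2 * d - N) (k>0 : 0ℤ < + 2 * N - + 3 * d) where

        open Configuration X
        open Neighbourhood w
        open Maximal X maximal
        private module Swapped = Maximal (swap X) (λ Y → subst (λ t → 0ℤ ≤ t - size Y) (sym (size-swap X)) (maximal Y))

        -- `z` is the number of non-neighbours of `w`, `M` the number of non-adjacent pairs in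
        -- `𝒜 × 𝒞`; `K` is the degree bound of `degree≤K` and doubles as the scale of the test
        -- vector.
        z K M : ℤ
        z = N - d
        K = + 2 * N - + 3 * d - D
        M = A * C - B α γ

        z>0 : 0ℤ < z
        z>0 = cancel-pos⁺ (pos {1}) (by⁺ (<⇒≤ k>0 ⊕⁺ d>0) (let m = N in (solve 2 (λ d m → # 2 :* m :- # 3 :* d :+ d := # 2 :* (m :- d)) refl d m)))

        N>0 : 0ℤ < N
        N>0 = by⁺ (<⇒≤ z>0 ⊕⁺ d>0) (let m = N in (solve 2 (λ d m → m :- d :+ d := m) refl d m))

        triangles : 0ℤ ≤ + 9 * T * z - N * N * d
        triangles = high-degree-triangles high

        T>0 : 0ℤ < T
        T>0 = 0<-by-contradiction λ r → clash (triangles ⊕ nn {9} ⊗ r ⊗ <⇒≤ z>0) (*-pos (*-pos N>0 N>0) d>0)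
          (let m = N in (solve 3 (λ d m T →
              # 9 :* T :* (m :- d) :- m :* m :* d :+ # 9 :* (:- T) :* (m :- d)
              :+ m :* m :* d := # 0) refl d m T))

        𝒜𝒟-pressure : ∀ x → class x ≡ 𝒟 → 0ℤ ≤ A - 𝐀 α x + (D - 𝐀 ω x) - (+ 3 * d - N - σ)
        𝒜𝒟-pressure x cx = subst₂ (λ p q → 0ℤ ≤ p - 𝐀 α x + (D - 𝐀 ω x) - (+ 3 * d - N - q))
            (sum-cong-≗ (is𝒞-swap ∘ class)) (size-swap X)
          (subst₂ (λ p q → 0ℤ ≤ Swapped.C - p + (D - q) - (+ 3 * d - N - Swapped.σ))
            (𝐀-cong (is𝒞-swap ∘ class) x) (𝐀-cong (is𝒟-swap ∘ class) x)
            (subst (λ t → 0ℤ ≤ Swapped.C - 𝐀 Swapped.γ x + (t - 𝐀 Swapped.ω x) - (+ 3 * d - N - Swapped.σ))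
              (sum-cong-≗ (is𝒟-swap ∘ class)) (Swapped.𝒞𝒟-pressure x (cong swapᶜ cx))))

        𝒜-large : 0ℤ ≤ A - (+ 2 * d - N)
        𝒜-large = subst (λ t → 0ℤ ≤ t - (+ 2 * d - N)) (sum-cong-≗ (is𝒞-swap ∘ class)) (Swapped.𝒞-large T>0 high)

        p q r : Fin n → ℤ
        p = 𝐀 α
        q = 𝐀 γ
        r = 𝐀 ω

        p≥0 : ∀ v → 0ℤ ≤ p v
        p≥0 = 𝐀≥0 α α≥0
        q≥0 : ∀ v → 0ℤ ≤ q v
        q≥0 = 𝐀≥0 γ γ≥0
        r≥0 : ∀ v → 0ℤ ≤ r v
        r≥0 = 𝐀≥0 ω ω≥0

        degree≤K : ∀ x → class x ≡ 𝒟 → 0ℤ ≤ K - (p x + q x + + 2 * r x)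
        degree≤K x cx = by (𝒞𝒟-pressure x cx ⊕ 𝒜𝒟-pressure x cx)
          (trans (cong (λ t → C - q x + (D - r x) - (+ 3 * t - N - (A + C)) + (A - p x + (D - r x) - (+ 3 * t - N - (A + C)))) d-split)
            (trans (let s = p x; t = q x; u = r x; m = N in (solve 7 (λ A C D m s t u →
                C :- t :+ (D :- u) :- (# 3 :* (A :+ C :+ D) :- m :- (A :+ C))
                :+ (A :- s :+ (D :- u) :- (# 3 :* (A :+ C :+ D) :- m :- (A :+ C)))
                := # 2 :* m :- # 3 :* (A :+ C :+ D) :- D :- (s :+ t :+ # 2 :* u)) refl A C D m s t u))
              (cong (λ t → + 2 * N - + 3 * t - D - (p x + q x + + 2 * r x)) (sym d-split))))

        degree-lower : ∀ x → class x ≡ 𝒟 → 0ℤ ≤ p x + q x + r x - (+ 2 * d - N + D)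
        degree-lower x cx = by (codeg-lower-𝒟 x cx)
          (trans (cong₂ (λ s t → s - (+ 3 * t - N - (A + C))) (𝐀h-split x) d-split)
            (trans (let s = p x + q x + r x; m = N in (solve 5 (λ A C D m s →
                s :- (# 3 :* (A :+ C :+ D) :- m :- (A :+ C))
                := s :- (# 2 :* (A :+ C :+ D) :- m :+ D)) refl A C D m s))
              (cong (λ t → p x + q x + r x - (+ 2 * t - N + D)) (sym d-split))))

        D-cases : D ≡ 0ℤ ⊎ (0ℤ < D) × (∃[ x ] class x ≡ 𝒟)
        D-cases with Fin.any? (λ x → 𝒟? (class x)) | D ≟ 0ℤ
        ... | _ | yes e = inj₁ e
        ... | yes x | no e = inj₂ (≤∧≢⇒< D≥0 (e ∘ sym) , x)
        ... | no none | no e = ⊥-elim (e (sum-zero ω ω≡0))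
          where
          ω≡0 : ∀ v → ω v ≡ 0ℤ
          ω≡0 v with class v in cv
          ... | 𝒜 = refl
          ... | 𝒞 = refl
          ... | 𝒵 = refl
          ... | 𝒟 = ⊥-elim (none (v , cv))

        K>0 : 0ℤ < K
        K>0 with D-cases
        ... | inj₁ e = by⁺ k>0 (trans (let k = + 2 * N - + 3 * d in (solve 1 (λ k → k := k :- # 0) refl k)) (cong (λ t → + 2 * N - + 3 * d - t) (sym e)))
        ... | inj₂ (D>0 , x , cx) = by⁺ (degree≤K x cx ⊕ r≥0 x ⊕ degree-lower x cx ⊕ high ⊕⁺ D>0)
          (let s = p x; t = q x; u = r x; k = K; m = N in (solve 7 (λ D d m k s t u →
              k :- (s :+ t :+ # 2 :* u) :+ u :+ (s :+ t :+ u :- (# 2 :* d :- m :+ D))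
              :+ (# 2 :* d :- m) :+ D
              := k) refl D d m k s t u))

        -- A single vertex of `𝒟` suffices: its number of neighbours in `N(w)` lies between
        -- `2d - n + D` and `K = 2n - 3d - D`.
        D-bound : D ≡ 0ℤ ⊎ (0ℤ < D) × (0ℤ ≤ + 3 * N - + 5 * d - + 2 * D)
        D-bound with D-cases
        ... | inj₁ e = inj₁ e
        ... | inj₂ (D>0 , x , cx) = inj₂ (D>0 , by (degree≤K x cx ⊕ r≥0 x ⊕ degree-lower x cx)
          (let s = p x; t = q x; u = r x; m = N in (solve 6 (λ D d m s t u →
              # 2 :* m :- # 3 :* d :- D :- (s :+ t :+ # 2 :* u)
              :+ u :+ (s :+ t :+ u :- (# 2 :* d :- m :+ D))
              := # 3 :* m :- # 5 :* d :- # 2 :* D) refl D d m s t u)))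

        -- K₄-freeness: no edges between the neighbours of x in 𝒜 and those in 𝒞.
        product-bound : ∀ x → class x ≡ 𝒟 → 0ℤ ≤ M - p x * q x
        product-bound x cx = by (sum-≥0 _ λ u → sum-≥0 _ (term u))
          (trans (sum-cong-≗ inner) (trans (sum-lin C (- 1ℤ) (- q x) α (λ u → α u * q u) (λ u → a x u * α u))
            (let b = B α γ; s = p x; t = q x in (solve 5 (λ A C b s t → C :* A :+ (:- # 1) :* b :+ (:- t) :* s := A :* C :- b :- s :* t) refl A C b s t))))
          where
          lem₁ : ∀ s t e f → 0ℤ ≤ 0ℤ * s + (- 0ℤ) * (t * s) + (- (e * 0ℤ)) * (f * s)
          lem₁ s t e f = by ≤-refl (solve 4 (λ s t e f → # 0 := # 0 :* s :+ (:- # 0) :* (t :* s) :+ (:- (e :* # 0)) :* (f :* s)) refl s t e f)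
          lem₂ : ∀ t e f → 0ℤ ≤ 1ℤ * 0ℤ + (- 1ℤ) * (t * 0ℤ) + (- (e * 1ℤ)) * (f * 0ℤ)
          lem₂ t e f = by ≤-refl (solve 3 (λ t e f →
              # 0 := # 1 :* # 0 :+ (:- # 1) :* (t :* # 0)
              :+ (:- (e :* # 1)) :* (f :* # 0)) refl t e f)
          term : ∀ u v → 0ℤ ≤ α u * γ v + (- α u) * (a u v * γ v) + (- (a x u * α u)) * (a x v * γ v)
          term u v with class u in cu | class v in cv
          ... | 𝒞 | c = lem₁ (is𝒞 c) (a u v) (a x u) (a x v)
          ... | 𝒟 | c = lem₁ (is𝒞 c) (a u v) (a x u) (a x v)
          ... | 𝒵 | c = lem₁ (is𝒞 c) (a u v) (a x u) (a x v)
          ... | 𝒜 | 𝒜 = lem₂ (a u v) (a x u) (a x v)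
          ... | 𝒜 | 𝒟 = lem₂ (a u v) (a x u) (a x v)
          ... | 𝒜 | 𝒵 = lem₂ (a u v) (a x u) (a x v)
          ... | 𝒜 | 𝒞 with adj u v in uv | adj x u in xu | adj x v in xv
          ...   | false | e | true = by (ind≤1 e) (let s = ind e in (solve 1 (λ s →
              # 1 :- s := # 1 :* # 1 :+ (:- # 1) :* (# 0 :* # 1)
              :+ (:- (s :* # 1)) :* (# 1 :* # 1)) refl s))
          ...   | false | e | false = by (nn {1}) (let s = ind e in (solve 1 (λ s →
              # 1 := # 1 :* # 1 :+ (:- # 1) :* (# 0 :* # 1)
              :+ (:- (s :* # 1)) :* (# 0 :* # 1)) refl s))
          ...   | true | false | f = by ≤-refl (let s = ind f in (solve 1 (λ s →
              # 0 := # 1 :* # 1 :+ (:- # 1) :* (# 1 :* # 1)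
              :+ (:- (# 0 :* # 1)) :* (s :* # 1)) refl s))
          ...   | true | true | false = by ≤-refl (solve 0 (
              # 0 := # 1 :* # 1 :+ (:- # 1) :* (# 1 :* # 1)
              :+ (:- (# 1 :* # 1)) :* (# 0 :* # 1)) refl)
          ...   | true | true | true = ⊥-elim (K₄-free (adj-𝒟 cx) (adj-𝒜 cu)
                    (inside v (via-≢ cv λ ())) xu xv uv)
          inner : ∀ u → sum (λ v → α u * γ v + (- α u) * (a u v * γ v) + (- (a x u * α u)) * (a x v * γ v))
            ≡ C * α u + (- 1ℤ) * (α u * q u) + (- q x) * (a x u * α u)
          inner u = trans (sum-lin (α u) (- α u) (- (a x u * α u)) γ (λ v → a u v * γ v) (λ v → a x v * γ v))
            (let s = α u; t = q u; e = a x u * α u; f = q x in (solve 5 (λ C s t e f →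
                s :* C :+ (:- s) :* t :+ (:- e) :* f
                := C :* s :+ (:- # 1) :* (s :* t) :+ (:- f) :* e) refl C s t e f))

        -- `P` and `b` count the edges from `𝒟` to `𝒜 ∪ 𝒞` and from `𝒜` to `𝒞`, `β` is twice the
        -- number inside `𝒟`, and `V` measures how unevenly `𝒟` is attached to `𝒜` and `𝒞`.
        P V b β : ℤ
        P = B ω α + B ω γ
        V = sum λ v → ω v * ((p v - q v) * (p v - q v))
        b = B α γ
        β = B ω ω

        over-𝒟 : (f : Fin n → ℤ) → (∀ x → class x ≡ 𝒟 → 0ℤ ≤ f x) → 0ℤ ≤ sum λ v → ω v * f v
        over-𝒟 f bound = sum-≥0 _ term
          where
          term : ∀ v → 0ℤ ≤ ω v * f v
          term v with class v in cv
          ... | 𝒜 = by ≤-refl (sym (0* (f v)))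
          ... | 𝒞 = by ≤-refl (sym (0* (f v)))
          ... | 𝒵 = by ≤-refl (sym (0* (f v)))
          ... | 𝒟 = nn {1} ⊗ bound v cv

        -- As `(p - q)² = (p + q)² - 4pq` and `pq ≤ M`, unevenness is at least quadratic in `p + q`.
        -- The square linearises this at the tangent point `p + q = K/2`, so that only the sum `P`
        -- enters.
        V-bound : 0ℤ ≤ D * K * K + + 16 * D * M - + 4 * K * P + + 4 * V
        V-bound = by (over-𝒟 _ λ x cx → sq≥0 (K - + 2 * (p x + q x)) ⊕ nn {16} ⊗ product-bound x cx)
          (trans (sum-cong-≗ λ v → lem (ω v) (p v) (q v))
            (trans (sum-lin (K * K + + 16 * M) (- (+ 4 * K)) 1ℤ ω (λ v → ω v * p v)
                     (λ v → (- (+ 4 * K)) * (ω v * q v) + + 4 * (ω v * ((p v - q v) * (p v - q v))) + 0ℤ * ω v))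
              (trans (cong (λ t → (K * K + + 16 * M) * D + (- (+ 4 * K)) * B ω α + 1ℤ * t)
                  (sum-lin (- (+ 4 * K)) (+ 4) 0ℤ (λ v → ω v * q v) (λ v → ω v * ((p v - q v) * (p v - q v))) ω))
                (let k = K; m = M; s = B ω α; t = B ω γ; v = V in (solve 6 (λ D k m s t v →
                    (k :* k :+ # 16 :* m) :* D :+ (:- (# 4 :* k)) :* s
                    :+ # 1 :* ((:- (# 4 :* k)) :* t :+ # 4 :* v :+ # 0 :* D)
                    := D :* k :* k :+ # 16 :* D :* m :- # 4 :* k :* (s :+ t)
                    :+ # 4 :* v) refl D k m s t v)))))
          where
          lem : ∀ o s t → o * ((K - + 2 * (s + t)) * (K - + 2 * (s + t)) + + 16 * (M - s * t))
            ≡ (K * K + + 16 * M) * o + (- (+ 4 * K)) * (o * s) + 1ℤ * ((- (+ 4 * K)) * (o * t) + + 4 * (o * ((s - t) * (s - t))) + 0ℤ * o)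
          lem o s t = let k = K; m = M in (solve 5 (λ k m o s t →
              o :* ((k :- # 2 :* (s :+ t)) :* (k :- # 2 :* (s :+ t)) :+ # 16 :* (m :- s :* t))
              := (k :* k :+ # 16 :* m) :* o :+ (:- (# 4 :* k)) :* (o :* s)
              :+ # 1 :* ((:- (# 4 :* k)) :* (o :* t) :+ # 4 :* (o :* ((s :- t) :* (s :- t)))
              :+ # 0 :* o)) refl k m o s t)

        -- The slack `3r` is given away so that exactly `2P + β` appears, the part of
        -- `T = 2b + 2P + β` that involves `𝒟`.
        P-bound : 0ℤ ≤ + 2 * K * D - + 2 * P - β
        P-bound = by (over-𝒟 _ λ x cx → nn {2} ⊗ degree≤K x cx ⊕ nn {3} ⊗ r≥0 x)
          (trans (sum-cong-≗ λ v → lem (ω v) (p v) (q v) (r v))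
            (trans (sum-lin (+ 2 * K) (- (+ 2)) 1ℤ ω (λ v → ω v * p v) (λ v → (- (+ 2)) * (ω v * q v) + (- 1ℤ) * (ω v * r v) + 0ℤ * ω v))
              (trans (cong (λ t → + 2 * K * D + (- (+ 2)) * B ω α + 1ℤ * t)
                  (sum-lin (- (+ 2)) (- 1ℤ) 0ℤ (λ v → ω v * q v) (λ v → ω v * r v) ω))
                (let k = K; s = B ω α; t = B ω γ; u = β in (solve 5 (λ D k s t u →
                    # 2 :* k :* D :+ (:- (# 2)) :* s :+ # 1 :* ((:- (# 2)) :* t :+ (:- # 1) :* u
                    :+ # 0 :* D) := # 2 :* k :* D :- # 2 :* (s :+ t)
                    :- u) refl D k s t u)))))
          where
          lem : ∀ o s t u → o * (+ 2 * (K - (s + t + + 2 * u)) + + 3 * u)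
            ≡ + 2 * K * o + (- (+ 2)) * (o * s) + 1ℤ * ((- (+ 2)) * (o * t) + (- 1ℤ) * (o * u) + 0ℤ * o)
          lem o s t u = let k = K in (solve 5 (λ k o s t u →
              o :* (# 2 :* (k :- (s :+ t :+ # 2 :* u)) :+ # 3 :* u)
              := # 2 :* k :* o :+ (:- (# 2)) :* (o :* s)
              :+ # 1 :* ((:- (# 2)) :* (o :* t) :+ (:- # 1) :* (o :* u) :+ # 0 :* o)) refl k o s t u)

        -- Mantel's theorem: `N(w)`, and with it `𝒟`, spans no triangle.
        2β≤D² : 0ℤ ≤ D * D - + 2 * β
        2β≤D² = degree-sum ω D ω01 D≥0 λ x y ωx ωy xy →
          disjoint-nbrs (adj-𝒟 (ω-class x ωx)) (adj-𝒟 (ω-class y ωy)) xy ω ω≥0 (supported is𝒟 refl)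
          where
          ω01 : ∀ v → (ω v ≡ 0ℤ) ⊎ (ω v ≡ 1ℤ)
          ω01 v with class v
          ... | 𝒜 = inj₁ refl
          ... | 𝒞 = inj₁ refl
          ... | 𝒟 = inj₂ refl
          ... | 𝒵 = inj₁ refl
          ω-class : ∀ v → ω v ≡ 1ℤ → class v ≡ 𝒟
          ω-class v e with class v
          ω-class v () | 𝒜
          ω-class v () | 𝒞
          ω-class v e  | 𝒟 = refl
          ω-class v () | 𝒵

        -- The cut separates 𝒜 from 𝒞; a vertex of 𝒟 leans away from its majority side.
        g y : Fin n → ℤ
        g v = ω v * (q v - p v)
        y v = K * α v + (- K) * γ v + 1ℤ * g v

        |q-p|≤K : ∀ x → class x ≡ 𝒟 → (0ℤ ≤ K - (q x - p x)) × (0ℤ ≤ K + (q x - p x))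
        |q-p|≤K x cx =
            by (degree≤K x cx ⊕ nn {2} ⊗ r≥0 x ⊕ nn {2} ⊗ p≥0 x)
              (let k = K; s = p x; t = q x; u = r x in (solve 4 (λ k s t u → k :- (s :+ t :+ # 2 :* u) :+ # 2 :* u :+ # 2 :* s := k :- (t :- s)) refl k s t u))
          , by (degree≤K x cx ⊕ nn {2} ⊗ r≥0 x ⊕ nn {2} ⊗ q≥0 x)
              (let k = K; s = p x; t = q x; u = r x in (solve 4 (λ k s t u → k :- (s :+ t :+ # 2 :* u) :+ # 2 :* u :+ # 2 :* t := k :+ (t :- s)) refl k s t u))

        leaning : ∀ s → (∀ x → class x ≡ 𝒟 → 0ℤ ≤ K + s * (q x - p x)) → ∀ v → 0ℤ ≤ K * ω v + s * g v + 0ℤ * g v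
        leaning s bound v with class v in cv
        ... | 𝒜 = by ≤-refl (let k = K; e = q v - p v in (solve 3 (λ k s e → # 0 := k :* # 0 :+ s :* (# 0 :* e) :+ # 0 :* (# 0 :* e)) refl k s e))
        ... | 𝒞 = by ≤-refl (let k = K; e = q v - p v in (solve 3 (λ k s e → # 0 := k :* # 0 :+ s :* (# 0 :* e) :+ # 0 :* (# 0 :* e)) refl k s e))
        ... | 𝒵 = by ≤-refl (let k = K; e = q v - p v in (solve 3 (λ k s e → # 0 := k :* # 0 :+ s :* (# 0 :* e) :+ # 0 :* (# 0 :* e)) refl k s e))
        ... | 𝒟 = by (bound v cv) (let k = K; e = q v - p v in (solve 3 (λ k s e → k :+ s :* e := k :* # 1 :+ s :* (# 1 :* e) :+ # 0 :* (# 1 :* e)) refl k s e))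

        Kω-g≥0 : ∀ v → 0ℤ ≤ K * ω v + (- 1ℤ) * g v + 0ℤ * g v
        Kω-g≥0 = leaning (- 1ℤ) λ x cx → by (proj₁ (|q-p|≤K x cx))
          (let k = K; e = q x - p x in (solve 2 (λ k e → k :- e := k :+ (:- # 1) :* e) refl k e))

        Kω+g≥0 : ∀ v → 0ℤ ≤ K * ω v + 1ℤ * g v + 0ℤ * g v
        Kω+g≥0 = leaning 1ℤ λ x cx → by (proj₂ (|q-p|≤K x cx))
          (let k = K; e = q x - p x in (solve 2 (λ k e → k :+ e := k :+ # 1 :* e) refl k e))

        -- `g` is at most `K` in absolute value on `𝒟`, so `Kω - g` and `Kω + g` are nonnegative,
        -- and in their pairing the mixed terms cancel.
        Bgg≤ : 0ℤ ≤ K * K * β - B g g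
        Bgg≤ = by (sum-≥0 _ λ v → Kω-g≥0 v ⊗ 𝐀≥0 (λ u → K * ω u + 1ℤ * g u + 0ℤ * g u) Kω+g≥0 v)
          (trans (B-linˡ K (- 1ℤ) 0ℤ ω g g (λ u → K * ω u + 1ℤ * g u + 0ℤ * g u))
            (trans (cong₂ (λ s t → K * s + (- 1ℤ) * t + 0ℤ * t) (B-linʳ K 1ℤ 0ℤ ω g g ω)
                (trans (B-linʳ K 1ℤ 0ℤ ω g g g) (cong (λ t → K * t + 1ℤ * B g g + 0ℤ * B g g) (B-sym g ω))))
              (let k = K; s = β; t = B ω g; u = B g g in (solve 4 (λ k s t u →
                  k :* (k :* s :+ # 1 :* t :+ # 0 :* t) :+ (:- # 1) :* (k :* t :+ # 1 :* u
                  :+ # 0 :* u) :+ # 0 :* (k :* t :+ # 1 :* u :+ # 0 :* u)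
                  := k :* k :* s :- u) refl k s t u))))

        -- The weights `q - p` make the edges between `𝒟` and `𝒜 ∪ 𝒞` contribute exactly `-2KV`.
        Byy : B y y ≡ B g g - + 2 * K * K * b - + 2 * K * V
        Byy = trans (B-square K (- K) 1ℤ α γ g) (trans
            (cong₂ (λ s t → K * K * s + (- K) * (- K) * t + 1ℤ * 1ℤ * B g g + + 2 * K * (- K) * b + + 2 * K * 1ℤ * B α g + + 2 * (- K) * 1ℤ * B γ g) B-αα B-γγ)
            (trans (let k = K; b = b; s = B g g; t = B α g; u = B γ g in (solve 5 (λ k b s t u →
                k :* k :* # 0 :+ (:- k) :* (:- k) :* # 0 :+ # 1 :* # 1 :* s
                :+ # 2 :* k :* (:- k) :* b :+ # 2 :* k :* # 1 :* t
                :+ # 2 :* (:- k) :* # 1 :* u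
                := s :- # 2 :* k :* k :* b :- # 2 :* k :* (u :- t)) refl k b s t u))
              (cong (λ t → B g g - + 2 * K * K * b - + 2 * K * t) (trans (cong₂ _-_ (B-sym γ g) (B-sym α g))
                (trans (sym (sum-diff (λ v → g v * p v) (λ v → g v * q v)))
                  (sum-cong-≗ λ v → lem (ω v) (p v) (q v)))))))
          where
          lem : ∀ o s t → o * (t - s) * t - o * (t - s) * s ≡ o * ((s - t) * (s - t))
          lem = solve 3 (λ o s t →
              o :* (t :- s) :* t :- o :* (t :- s) :* s
              := o :* ((s :- t) :* (s :- t))) refl

        η : ℤ
        η = B y h

        -- The edges between `𝒜` and `𝒞` cancel out of `η`, so it is a sum over `𝒟` and vanishes
        -- when `𝒟` is empty.
        η-sum : η ≡ sum λ v → ω v * ((p v - q v) * (K - (p v + q v + r v)))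
        η-sum = trans (B-linˡ K (- K) 1ℤ α γ g h) (trans
            (cong₂ (λ s t → K * s + (- K) * t + 1ℤ * B g h) (trans (B-cong {f = α} (λ _ → refl) h-split) (B-linʳ 1ℤ 1ℤ 1ℤ α γ ω α))
               (trans (B-cong {f = γ} (λ _ → refl) h-split) (B-linʳ 1ℤ 1ℤ 1ℤ α γ ω γ)))
            (trans (cong₂ (λ s t → K * (1ℤ * s + 1ℤ * b + 1ℤ * B α ω) + (- K) * (1ℤ * B γ α + 1ℤ * t + 1ℤ * B γ ω) + 1ℤ * B g h) B-αα B-γγ)
            (trans (cong₂ (λ s t → K * (1ℤ * 0ℤ + 1ℤ * b + 1ℤ * s) + (- K) * (1ℤ * t + 1ℤ * 0ℤ + 1ℤ * B γ ω) + 1ℤ * B g h) (B-sym α ω) (B-sym γ α))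
            (trans (cong (λ s → K * (1ℤ * 0ℤ + 1ℤ * b + 1ℤ * B ω α) + (- K) * (1ℤ * b + 1ℤ * 0ℤ + 1ℤ * s) + 1ℤ * B g h) (B-sym γ ω))
            (trans (let k = K; b = b; s = B ω α; t = B ω γ; u = B g h in (solve 5 (λ k b s t u →
                k :* (# 1 :* # 0 :+ # 1 :* b :+ # 1 :* s)
                :+ (:- k) :* (# 1 :* b :+ # 1 :* # 0 :+ # 1 :* t)
                :+ # 1 :* u := k :* s :+ (:- k) :* t :+ # 1 :* u) refl k b s t u))
            (trans (sym (sum-lin K (- K) 1ℤ (λ v → ω v * p v) (λ v → ω v * q v) (λ v → g v * 𝐀 h v)))
              (sum-cong-≗ λ v → trans (cong (λ t → K * (ω v * p v) + (- K) * (ω v * q v) + 1ℤ * (g v * t)) (𝐀h-split v))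
                (lem (ω v) (p v) (q v) (r v)))))))))
          where
          lem : ∀ o s t u → K * (o * s) + (- K) * (o * t) + 1ℤ * (o * (t - s) * (s + t + u)) ≡ o * ((s - t) * (K - (s + t + u)))
          lem o s t u = let k = K in (solve 5 (λ k o s t u →
              k :* (o :* s) :+ (:- k) :* (o :* t) :+ # 1 :* (o :* (t :- s) :* (s :+ t :+ u))
              := o :* ((s :- t) :* (k :- (s :+ t :+ u)))) refl k o s t u)

        -- With `s = p + q + r ≤ K`, each summand is at most `s(K - s) ≤ K²/4` in absolute value.
        η-bound : (0ℤ ≤ D * (K * K) - + 4 * η) × (0ℤ ≤ D * (K * K) + + 4 * η)
        η-bound = by (over-𝒟 _ upper) (trans (sum-cong-≗ λ v → lem₁ (ω v) (e v))
                    (trans (sum-lin (K * K) (- (+ 4)) 0ℤ ω (λ v → ω v * e v) ω) (trans (cong (λ t → K * K * D + (- (+ 4)) * t + 0ℤ * D) (sym η-sum))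
                      (let s = η; k = K in (solve 3 (λ D s k →
                          k :* k :* D :+ (:- (# 4)) :* s :+ # 0 :* D
                          := D :* (k :* k) :- # 4 :* s) refl D s k)))))
                , by (over-𝒟 _ lower) (trans (sum-cong-≗ λ v → lem₂ (ω v) (e v))
                    (trans (sum-lin (K * K) (+ 4) 0ℤ ω (λ v → ω v * e v) ω) (trans (cong (λ t → K * K * D + + 4 * t + 0ℤ * D) (sym η-sum))
                      (let s = η; k = K in (solve 3 (λ D s k → k :* k :* D :+ # 4 :* s :+ # 0 :* D := D :* (k :* k) :+ # 4 :* s) refl D s k)))))
          where
          e : Fin n → ℤ
          e v = (p v - q v) * (K - (p v + q v + r v))
          lem₁ : ∀ o s → o * (K * K - + 4 * s) ≡ K * K * o + (- (+ 4)) * (o * s) + 0ℤ * o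
          lem₁ o s = let k = K in (solve 3 (λ k o s →
              o :* (k :* k :- # 4 :* s)
              := k :* k :* o :+ (:- (# 4)) :* (o :* s) :+ # 0 :* o) refl k o s)
          lem₂ : ∀ o s → o * (K * K + + 4 * s) ≡ K * K * o + + 4 * (o * s) + 0ℤ * o
          lem₂ o s = let k = K in (solve 3 (λ k o s →
              o :* (k :* k :+ # 4 :* s)
              := k :* k :* o :+ # 4 :* (o :* s) :+ # 0 :* o) refl k o s)
          slack : ∀ x → class x ≡ 𝒟 → 0ℤ ≤ K - (p x + q x + r x)
          slack x cx = by (degree≤K x cx ⊕ r≥0 x) (let k = K; s = p x; t = q x; u = r x in
            (solve 4 (λ k s t u → k :- (s :+ t :+ # 2 :* u) :+ u := k :- (s :+ t :+ u)) refl k s t u))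
          upper : ∀ x → class x ≡ 𝒟 → 0ℤ ≤ K * K - + 4 * ((p x - q x) * (K - (p x + q x + r x)))
          upper x cx = by (sq≥0 (K - + 2 * (p x + q x + r x)) ⊕ nn {4} ⊗ (nn {2} ⊗ q≥0 x ⊕ r≥0 x) ⊗ slack x cx)
            (let k = K; s = p x; t = q x; u = r x in (solve 4 (λ k s t u →
                (k :- # 2 :* (s :+ t :+ u)) :* (k :- # 2 :* (s :+ t :+ u))
                :+ # 4 :* (# 2 :* t :+ u) :* (k :- (s :+ t :+ u))
                := k :* k :- # 4 :* ((s :- t) :* (k :- (s :+ t :+ u)))) refl k s t u))
          lower : ∀ x → class x ≡ 𝒟 → 0ℤ ≤ K * K + + 4 * ((p x - q x) * (K - (p x + q x + r x)))
          lower x cx = by (sq≥0 (K - + 2 * (p x + q x + r x)) ⊕ nn {4} ⊗ (nn {2} ⊗ p≥0 x ⊕ r≥0 x) ⊗ slack x cx)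
            (let k = K; s = p x; t = q x; u = r x in (solve 4 (λ k s t u →
                (k :- # 2 :* (s :+ t :+ u)) :* (k :- # 2 :* (s :+ t :+ u))
                :+ # 4 :* (# 2 :* s :+ u) :* (k :- (s :+ t :+ u))
                := k :* k :+ # 4 :* ((s :- t) :* (k :- (s :+ t :+ u)))) refl k s t u))

        sum-y : sum y ≡ K * A - K * C + sum g
        sum-y = trans (sum-lin K (- K) 1ℤ α γ g) (let k = K; s = sum g in (solve 4 (λ k A C s → k :* A :+ (:- k) :* C :+ # 1 :* s := k :* A :- k :* C :+ s) refl k A C s))

        y-bounded : ∀ v → (h v ≡ 1ℤ) × (0ℤ ≤ K - y v) × (0ℤ ≤ K + y v) ⊎ (h v ≡ 0ℤ) × (y v ≡ 0ℤ)
        y-bounded v with class v in cv | h-split v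
        ... | 𝒜 | e = inj₁ (trans e (solve 0 (# 1 :* # 1 :+ # 1 :* # 0 :+ # 1 :* # 0 := # 1) refl)
            , by ≤-refl (let k = K; s = q v - p v in (solve 2 (λ k s → # 0 := k :- (k :* # 1 :+ (:- k) :* # 0 :+ # 1 :* (# 0 :* s))) refl k s))
            , by (nn {2} ⊗ <⇒≤ K>0) (let k = K; s = q v - p v in (solve 2 (λ k s → # 2 :* k := k :+ (k :* # 1 :+ (:- k) :* # 0 :+ # 1 :* (# 0 :* s))) refl k s)))
        ... | 𝒞 | e = inj₁ (trans e (solve 0 (# 1 :* # 0 :+ # 1 :* # 1 :+ # 1 :* # 0 := # 1) refl)
            , by (nn {2} ⊗ <⇒≤ K>0) (let k = K; s = q v - p v in (solve 2 (λ k s → # 2 :* k := k :- (k :* # 0 :+ (:- k) :* # 1 :+ # 1 :* (# 0 :* s))) refl k s))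
            , by ≤-refl (let k = K; s = q v - p v in (solve 2 (λ k s → # 0 := k :+ (k :* # 0 :+ (:- k) :* # 1 :+ # 1 :* (# 0 :* s))) refl k s)))
        ... | 𝒟 | e = inj₁ (trans e (solve 0 (# 1 :* # 0 :+ # 1 :* # 0 :+ # 1 :* # 1 := # 1) refl)
            , by (proj₁ (|q-p|≤K v cv)) (let k = K; s = q v - p v in (solve 2 (λ k s → k :- s := k :- (k :* # 0 :+ (:- k) :* # 0 :+ # 1 :* (# 1 :* s))) refl k s))
            , by (proj₂ (|q-p|≤K v cv)) (let k = K; s = q v - p v in (solve 2 (λ k s → k :+ s := k :+ (k :* # 0 :+ (:- k) :* # 0 :+ # 1 :* (# 1 :* s))) refl k s)))
        ... | 𝒵 | e = inj₂ (trans e (solve 0 (# 1 :* # 0 :+ # 1 :* # 0 :+ # 1 :* # 0 := # 0) refl)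
            , (let k = K; s = q v - p v in (solve 2 (λ k s → k :* # 0 :+ (:- k) :* # 0 :+ # 1 :* (# 0 :* s) := # 0) refl k s)))

        KD-g≥0 : 0ℤ ≤ K * D - sum g
        KD-g≥0 = by (sum-≥0 _ Kω-g≥0) (trans (sum-lin K (- 1ℤ) 0ℤ ω g g)
          (let k = K; s = sum g in (solve 3 (λ k D s → k :* D :+ (:- # 1) :* s :+ # 0 :* s := k :* D :- s) refl k D s)))

        KD+g≥0 : 0ℤ ≤ K * D + sum g
        KD+g≥0 = by (sum-≥0 _ Kω+g≥0) (trans (sum-lin K 1ℤ 0ℤ ω g g)
          (let k = K; s = sum g in (solve 3 (λ k D s → k :* D :+ # 1 :* s :+ # 0 :* s := k :* D :+ s) refl k D s)))

        -- The sum of `y` is at most `K(A - C + D) = K(d - 2C)`, and `C ≥ 2d - n` with `n ≤ 2d`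
        -- gives `d - 2C ≤ n - d`.
        s≤zK : 0ℤ ≤ (N - sum h) * K - sum y
        s≤zK = by (<⇒≤ K>0 ⊗ (nn {2} ⊗ 𝒞-large T>0 high ⊕ high) ⊕ KD-g≥0)
          (trans (cong (λ t → K * (+ 2 * (C - (+ 2 * t - N)) + (+ 2 * t - N)) + (K * D - sum g)) d-split)
          (trans (let k = K; s = sum g; m = N in (solve 6 (λ k A C D s m →
              k :* (# 2 :* (C :- (# 2 :* (A :+ C :+ D) :- m)) :+ (# 2 :* (A :+ C :+ D) :- m))
              :+ (k :* D :- s) := (m :- (A :+ C :+ D)) :* k
              :- (k :* A :- k :* C :+ s)) refl k A C D s m))
            (cong₂ (λ s t → (N - s) * K - t) (sym (trans (regular w) d-split)) (sym sum-y))))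

        -s≤zK : 0ℤ ≤ (N - sum h) * K + sum y
        -s≤zK = by (<⇒≤ K>0 ⊗ (nn {2} ⊗ 𝒜-large ⊕ high) ⊕ KD+g≥0)
          (trans (cong (λ t → K * (+ 2 * (A - (+ 2 * t - N)) + (+ 2 * t - N)) + (K * D + sum g)) d-split)
          (trans (let k = K; s = sum g; m = N in (solve 6 (λ k A C D s m →
              k :* (# 2 :* (A :- (# 2 :* (A :+ C :+ D) :- m)) :+ (# 2 :* (A :+ C :+ D) :- m))
              :+ (k :* D :+ s) := (m :- (A :+ C :+ D)) :* k
              :+ (k :* A :- k :* C :+ s)) refl k A C D s m))
            (cong₂ (λ s t → (N - s) * K + t) (sym (trans (regular w) d-split)) (sym sum-y))))

        cut : 0ℤ ≤ + 9 * (d * z * B y y + η * η) - d * z * K * K * (+ 4 * N * N - + 9 * d * N)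
        cut = subst (λ t → 0ℤ ≤ + 9 * (d * (N - t) * B y y + η * η) - d * (N - t) * K * K * (+ 4 * N * N - + 9 * d * N)) (regular w)
          (cut-bound K K>0 h y (subst (λ t → 0ℤ < N - t) (sym (regular w)) z>0) y-bounded s≤zK -s≤zK)

        K²≤dz : 0ℤ ≤ d * z - K * K
        K²≤dz = by ((nn {2} ⊗ high ⊕ D≥0) ⊗ <⇒≤ z>0 ⊕ <⇒≤ K>0 ⊗ (high ⊕ D≥0))
          (let m = N in (solve 3 (λ d m D →
              (# 2 :* (# 2 :* d :- m) :+ D) :* (m :- d)
              :+ (# 2 :* m :- # 3 :* d :- D) :* (# 2 :* d :- m :+ D)
              := d :* (m :- d) :- (# 2 :* m :- # 3 :* d :- D) :* (# 2 :* m :- # 3 :* d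
              :- D)) refl d m D))

        -- Only `d`, `D`, `K` and `T` may survive: `V-bound` removes `V`, `AC ≤ (A + C)²/4` with
        -- `A + C = d - D` removes the sizes, and `b`, `P`, `β` are collected into `T`, with excess
        -- covered by `P-bound` and Mantel.
        form-bound : 0ℤ ≤ K * (D * (+ 8 * K * K + + 32 * (d - D) * (d - D) - + 64 * T + + 128 * D * K) + + 16 * K * D * D - + 16 * K * T)
                          - + 16 * B y y
        form-bound = by (nn {16} ⊗ Bgg≤ ⊕ nn {8} ⊗ <⇒≤ K>0 ⊗ V-bound ⊕ nn {16} ⊗ sq≥0 K ⊗ 2β≤D²
            ⊕ nn {32} ⊗ D≥0 ⊗ <⇒≤ K>0 ⊗ sq≥0 (A - C) ⊕ nn {64} ⊗ D≥0 ⊗ <⇒≤ K>0 ⊗ P-bound)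
          (trans (let k = K; b = b; s = B ω α; t = B ω γ; β = β; v = V; g = B g g in (solve 10 (λ k D A C b s t β v g →
              # 16 :* (k :* k :* β :- g) :+ # 8 :* k :* (D :* k :* k :+ # 16 :* D :* (A :* C :- b)
              :- # 4 :* k :* (s :+ t) :+ # 4 :* v) :+ # 16 :* (k :* k) :* (D :* D
              :- # 2 :* β) :+ # 32 :* D :* k :* ((A :- C) :* (A :- C))
              :+ # 64 :* D :* k :* (# 2 :* k :* D :- # 2 :* (s :+ t) :- β)
              := k :* (D :* (# 8 :* k :* k :+ # 32 :* (A :+ C :+ D :- D) :* (A :+ C :+ D :- D) :- # 64 :* (# 2 :* b
              :+ # 2 :* s :+ # 2 :* t :+ β) :+ # 128 :* D :* k) :+ # 16 :* k :* D :* D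
              :- # 16 :* k :* (# 2 :* b :+ # 2 :* s :+ # 2 :* t :+ β))
              :- # 16 :* (g :- # 2 :* k :* k :* b :- # 2 :* k :* v)) refl k D A C b s t β v g))
            (trans (cong (λ t → K * (D * (+ 8 * K * K + + 32 * (t - D) * (t - D) - + 64 * T′ + + 128 * D * K) + + 16 * K * D * D - + 16 * K * T′) - + 16 * B′) (sym d-split))
              (cong₂ (λ s t → K * (D * (+ 8 * K * K + + 32 * (d - D) * (d - D) - + 64 * s + + 128 * D * K) + + 16 * K * D * D - + 16 * K * s) - + 16 * t)
                (sym T-split) (sym Byy))))
          where
          T′ = + 2 * b + + 2 * B ω α + + 2 * B ω γ + β
          B′ = B g g - + 2 * K * K * b - + 2 * K * V

        contradiction : ⊥
        contradiction = high-degree-arithmetic N d D T N>0 d>0 D≥0 high k>0 (<⇒≤ K>0) (<⇒≤ z>0) D-bound triangles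
          (subst (λ t → 0ℤ ≤ d * t - + 2 * T) (trans (solve 3 (λ A C D → A :+ C := A :+ C :+ D :- D) refl A C D) (cong (_- D) (sym d-split))) 2T≤dσ)
          (cancel-pos K>0 (cancel-pos (*-pos d>0 z>0) (by
            (nn {9} ⊗ (<⇒≤ d>0 ⊗ <⇒≤ z>0) ⊗ form-bound
              -- The two bounds on `η` multiply to `16η² ≤ D²K⁴`, and `K² ≤ dz` makes this
              -- `dz D²K²`; it raises the coefficient 16 of `K D²` to 17.
              ⊕ nn {9} ⊗ (sq≥0 (D * K) ⊗ K²≤dz ⊕ proj₁ η-bound ⊗ proj₂ η-bound) ⊕ nn {16} ⊗ cut)
            (let k = K; y = B y y; e = η; z = z; m = N in (solve 8 (λ d D T k y e z m →
                # 9 :* (d :* z) :* (k :* (D :* (# 8 :* k :* k :+ # 32 :* (d :- D) :* (d :- D) :- # 64 :* T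
                :+ # 128 :* D :* k) :+ # 16 :* k :* D :* D :- # 16 :* k :* T) :- # 16 :* y)
                :+ # 9 :* (D :* k :* (D :* k) :* (d :* z :- k :* k) :+ (D :* (k :* k) :- # 4 :* e) :* (D :* (k :* k)
                :+ # 4 :* e)) :+ # 16 :* (# 9 :* (d :* z :* y :+ e :* e) :- d :* z :* k :* k :* (# 4 :* m :* m
                :- # 9 :* d :* m)) := d :* z :* (k :* (# 9 :* (D :* (# 8 :* k :* k :+ # 32 :* (d :- D) :* (d
                :- D) :- # 64 :* T :+ # 128 :* D :* k) :+ # 17 :* k :* D :* D :- # 16 :* k :* T) :- # 16 :* k :* (# 4 :* m :* m
                :- # 9 :* d :* m)))) refl d D T k y e z m)))))

      no-maximal : 0ℤ < + 2 * N - + 3 * d → ∀ X → (∀ Y → 0ℤ ≤ size X - size Y) → ⊥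
      no-maximal k>0 X maximal with 0ℤ ≤? + 2 * d - N
      ... | yes high = HighDegree.contradiction X maximal high k>0
      ... | no low   = Maximal.low-degree-contradiction X maximal
        (by⁺ (neg-mono-< (≰⇒> low)) (let m = N in (solve 2 (λ d m → :- (# 2 :* d :- m) := m :- # 2 :* d) refl d m)))

      -- Sizes never exceed `n`, so `k` bounds how often a configuration can still be replaced by a
      -- larger one before a maximal one is reached.
      no-configuration : 0ℤ < + 2 * N - + 3 * d → ∀ k X → 0ℤ ≤ + k - (N - size X) → ⊥
      no-configuration k>0 k X fuel = no-maximal k>0 X λ Y → 0≤-by-contradiction (improve k fuel Y)
        where
        improve : ∀ k → 0ℤ ≤ + k - (N - size X) → ∀ Y → 0ℤ < - (size X - size Y) → ⊥
        improve ℕ.zero fuel Y larger = clash (fuel ⊕ size≤N Y) larger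
          (let m = N; s = size X; t = size Y in (solve 3 (λ m s t → # 0 :- (m :- s) :+ (m :- t) :+ (:- (s :- t)) := # 0) refl m s t))
        improve (ℕ.suc k) fuel Y larger = no-configuration k>0 k Y
          (by (fuel ⊕ i≤j⇒0≤j-i (i<j⇒suc[i]≤j larger))
            (let m = N; s = size X; t = size Y; k = + k in (solve 4 (λ m s t k → # 1 :+ k :- (m :- s) :+ (:- (s :- t) :- (# 1 :+ # 0)) := k :- (m :- t)) refl m s t k)))

      turán-degree : Fin n → 0ℤ ≤ + 3 * d - + 2 * N
      turán-degree v = 0≤-by-contradiction λ r → no-configuration
        (by⁺ r (let m = N in (solve 2 (λ d m → :- (# 3 :* d :- # 2 :* m) := # 2 :* m :- # 3 :* d) refl d m))) n (star v)
        (by (sum-≥0 _ (is𝒜≥0 ∘ class) ⊕ sum-≥0 _ (is𝒞≥0 ∘ class)) (let m = N; s = size (star v) in (solve 2 (λ m s → s := m :- (m :- s)) refl m s)))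
        where open Configuration (star v)

-- Structure of the graph once `3d ≥ 2n`.

module TuránGraphs where

  open import Data.Bool using (Bool; true; false; _∨_; if_then_else_)
  import Data.Bool.Properties as Bool
  open import Data.Empty using (⊥; ⊥-elim)
  open import Data.Fin as Fin using (Fin; zero; suc; punchIn)
  open import Data.Fin.Patterns using (0F; 1F; 2F)
  open import Data.Fin.Permutation using (Permutation; insert; insert-punchIn; _⟨$⟩ʳ_) renaming (id to idₚ)
  import Data.Fin.Properties as Fin
  open import Data.Integer hiding (suc; _*_; pos)
  open import Data.Integer.Properties
  open import Data.Nat as ℕ using (ℕ; ⌊_/2⌋)
  open import Data.Nat.Divisibility using (_∣_; divides)
  import Data.Nat.Properties as ℕ
  open import Data.Product using (_×_; _,_; ∃-syntax; Σ-syntax; proj₁; proj₂)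
  open import Data.Sum using (_⊎_; inj₁; inj₂)
  open import Function using (_∘_)
  open import Relation.Binary.PropositionalEquality hiding (J)
  open import Relation.Nullary using (yes; no; does)
  open import Relation.Nullary.Decidable using (_×-dec_; dec-true)
  open IntegerIdentities
  open Inequalities
  open QuadraticForms
  open Halves
  open MinimumDegree

  bit : Bool → ℕ
  bit b = if b then 1 else 0

  count-cong : ∀ {n} {b b′ : Fin n → Bool} → (∀ v → b v ≡ b′ v) → count b ≡ count b′
  count-cong {ℕ.zero}  p = refl
  count-cong {ℕ.suc n} p = cong₂ ℕ._+_ (cong bit (p zero)) (count-cong (p ∘ suc))

  count-punchIn : ∀ {n} (b : Fin (ℕ.suc n) → Bool) j → count b ≡ bit (b j) ℕ.+ count (b ∘ punchIn j)
  count-punchIn b zero = refl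
  count-punchIn {ℕ.suc n} b (suc j) = trans (cong (bit (b zero) ℕ.+_) (count-punchIn (b ∘ suc) j))
    (+-swap (bit (b zero)) (bit (b (suc j))) (count (b ∘ suc ∘ punchIn j)))
    where
    +-swap : ∀ x y z → x ℕ.+ (y ℕ.+ z) ≡ y ℕ.+ (x ℕ.+ z)
    +-swap x y z = trans (sym (ℕ.+-assoc x y z)) (trans (cong (ℕ._+ z) (ℕ.+-comm x y)) (ℕ.+-assoc y x z))

  count-witness : ∀ {n} (b : Fin n → Bool) {k} → count b ≡ ℕ.suc k → ∃[ j ] b j ≡ true
  count-witness {ℕ.suc n} b p with b zero in e
  ... | true  = zero , e
  ... | false = let (j , q) = count-witness (b ∘ suc) p in suc j , q

  select : ∀ {n} (b : Fin n → Bool) j → j ℕ.≤ count b → ∃[ b′ ] count b′ ≡ j × (∀ v → b′ v ≡ true → b v ≡ true)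
  select {ℕ.zero} b j j≤0 = (λ ()) , sym (ℕ.n≤0⇒n≡0 j≤0) , λ ()
  select {ℕ.suc n} b ℕ.zero j≤ = (λ _ → false) , none n , λ _ ()
    where
    none : ∀ n → count {n} (λ _ → false) ≡ 0
    none ℕ.zero    = refl
    none (ℕ.suc n) = none n
  select {ℕ.suc n} b (ℕ.suc j) j≤ with b zero in e
  ... | true  = let (b′ , p , q) = select (b ∘ suc) j (ℕ.≤-pred j≤)
                in (λ { zero → true ; (suc v) → b′ v }) , cong ℕ.suc p , λ { zero _ → e ; (suc v) r → q v r }
  ... | false = let (b′ , p , q) = select (b ∘ suc) (ℕ.suc j) j≤
                in (λ { zero → false ; (suc v) → b′ v }) , p , λ { zero () ; (suc v) r → q v r }

  fibre : ∀ {n r} → (Fin n → Fin r) → Fin r → Fin n → Bool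
  fibre c i v = does (c v Fin.≟ i)

  fibre-⇒ : ∀ {n r} (c : Fin n → Fin r) i v → fibre c i v ≡ true → c v ≡ i
  fibre-⇒ c i v p with c v Fin.≟ i
  ... | yes q = q
  fibre-⇒ c i v () | no _

  -- The first vertex is sent to any `j` of its colour; removing both keeps all fibre sizes equal,
  -- and the recursion permutes the rest.
  relabel : ∀ {n r} (c c′ : Fin n → Fin r) → (∀ i → count (fibre c i) ≡ count (fibre c′ i)) →
    Σ[ π ∈ Permutation n n ] (∀ v → c v ≡ c′ (π ⟨$⟩ʳ v))
  relabel {ℕ.zero} c c′ eq = idₚ , λ ()
  relabel {ℕ.suc n} c c′ eq with count-witness (fibre c′ (c zero))
    (trans (sym (eq (c zero))) (cong (λ b → bit b ℕ.+ count (fibre (c ∘ suc) (c zero))) (dec-true (c zero Fin.≟ c zero) refl)))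
  ... | j , fj = insert zero j π , matches
    where
    c′j : c′ j ≡ c zero
    c′j = fibre-⇒ c′ (c zero) j fj
    rest : ∀ i → count (fibre (c ∘ suc) i) ≡ count (fibre (c′ ∘ punchIn j) i)
    rest i = ℕ.+-cancelˡ-≡ (bit (fibre c i zero)) _ _ (trans (eq i) (trans (count-punchIn (fibre c′ i) j)
      (cong (λ x → bit (does (x Fin.≟ i)) ℕ.+ count (fibre (c′ ∘ punchIn j) i)) c′j)))
    recursive = relabel (c ∘ suc) (c′ ∘ punchIn j) rest
    π = proj₁ recursive
    matches : ∀ v → c v ≡ c′ (insert zero j π ⟨$⟩ʳ v)
    matches zero    = sym c′j
    matches (suc v) = trans (proj₂ recursive v) (cong c′ (sym (insert-punchIn zero j π v)))

  ind-∨ : ∀ p q → (p ≡ true → q ≡ true → ⊥) → ind (p ∨ q) ≡ 1ℤ * ind p + 1ℤ * ind q + 0ℤ * ind q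
  ind-∨ true  true  disjoint = ⊥-elim (disjoint refl refl)
  ind-∨ true  false _ = (solve 0 (# 1 := # 1 :* # 1 :+ # 1 :* # 0 :+ # 0 :* # 0) refl)
  ind-∨ false true  _ = (solve 0 (# 1 := # 1 :* # 0 :+ # 1 :* # 1 :+ # 0 :* # 1) refl)
  ind-∨ false false _ = (solve 0 (# 0 := # 1 :* # 0 :+ # 1 :* # 0 :+ # 0 :* # 0) refl)

  vanishing-sum : ∀ {n} (f : Fin n → ℤ) → (∀ v → 0ℤ ≤ f v) → sum f ≡ 0ℤ → ∀ v → f v ≡ 0ℤ
  vanishing-sum f f≥0 Σ≡0 v = ≤-antisym (subst (f v ≤_) Σ≡0 (subst (_≤ sum f) (sum-δ v f)
    (0≤i-j⇒j≤i (sum-mono (λ u → δ v u * f u) f term)))) (f≥0 v)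
    where
    term : ∀ u → 0ℤ ≤ f u - δ v u * f u
    term u with v Fin.≟ u
    ... | yes refl = by ≤-refl (trans (let t = f v in (solve 1 (λ t → # 0 := t :- # 1 :* t) refl t)) (cong (λ s → f v - s * f v) (sym (δ-diag v))))
    ... | no v≢u   = by (f≥0 u) (trans (let t = f u in (solve 1 (λ t → t := t :- # 0 :* t) refl t)) (cong (λ s → f u - s * f u) (sym (δ-off v≢u))))

  module Extremal {n} (adj : Fin n → Fin n → Bool) (adj-sym : ∀ u v → adj u v ≡ adj v u)
    (adj-irrefl : ∀ u → adj u u ≡ false)
    (K₄-free : ∀ {w x y z} → adj w x ≡ true → adj w y ≡ true → adj w z ≡ true →
       adj x y ≡ true → adj x z ≡ true → adj y z ≡ true → ⊥)
    (d : ℤ) (regular : ∀ u → sum (ind ∘ adj u) ≡ d)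
    (x₀ : Fin n) (dense : 0ℤ ≤ + 3 * d - + 2 * + n) (N>0 : 0ℤ < + n) where

    open Regular adj adj-sym adj-irrefl K₄-free d regular

    d>0 : 0ℤ < d
    d>0 = cancel-pos⁺ (pos {2}) (by⁺ (dense ⊕⁺ *-pos (pos {1}) N>0) (let m = N in (solve 2 (λ d m → # 3 :* d :- # 2 :* m :+ # 2 :* m := # 3 :* d) refl d m)))

    neighbour : ∀ v → ∃[ u ] adj v u ≡ true
    neighbour v with Fin.any? (λ u → adj v u Bool.≟ true)
    ... | yes p = p
    ... | no none = ⊥-elim (<-irrefl (trans (sym (sum-zero (ind ∘ adj v) vanish)) (regular v)) d>0)
      where
      vanish : ∀ u → ind (adj v u) ≡ 0ℤ
      vanish u = cong ind (Bool.¬-not λ e → none (u , e))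

    common-neighbour : ∀ u v → ∃[ x ] adj u x ≡ true × adj v x ≡ true
    common-neighbour u v with Fin.any? (λ x → (adj u x Bool.≟ true) ×-dec (adj v x Bool.≟ true))
    ... | yes p = p
    ... | no none = ⊥-elim (clash (sum-≥0 _ λ x → ind≤1 (adj u x) ⊗ ind≤1 (adj v x)) 2d>N
      (trans (cong₂ _+_ (trans (sum-cong-≗ term) (trans (sum-lin 1ℤ (- 1ℤ) (- 1ℤ) 𝟏 (a u) (a v))
          (trans (cong₂ (λ p q → 1ℤ * p + (- 1ℤ) * q + (- 1ℤ) * sum (a v)) sum-𝟏 (regular u)) (cong (λ t → 1ℤ * N + (- 1ℤ) * d + (- 1ℤ) * t) (regular v))))) refl)
        (let m = N in (solve 2 (λ d m → # 1 :* m :+ (:- # 1) :* d :+ (:- # 1) :* d :+ (# 2 :* d :- m) := # 0) refl d m))))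
      where
      2d>N : 0ℤ < + 2 * d - N
      2d>N = cancel-pos⁺ (pos {2}) (by⁺ (nn {2} ⊗ dense ⊕⁺ N>0) (let m = N in (solve 2 (λ d m → # 2 :* (# 3 :* d :- # 2 :* m) :+ m := # 3 :* (# 2 :* d :- m)) refl d m)))
      term : ∀ x → (1ℤ - a u x) * (1ℤ - a v x) ≡ 1ℤ * 1ℤ + (- 1ℤ) * a u x + (- 1ℤ) * a v x
      term x with adj u x in ux | adj v x in vx
      ... | true | true   = ⊥-elim (none (x , ux , vx))
      ... | false | b     = let t = ind b in (solve 1 (λ t →
          (# 1 :- # 0) :* (# 1 :- t)
          := # 1 :* # 1 :+ (:- # 1) :* # 0 :+ (:- # 1) :* t) refl t)
      ... | true | false  = (solve 0 (
          (# 1 :- # 1) :* (# 1 :- # 0)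
          := # 1 :* # 1 :+ (:- # 1) :* # 1 :+ (:- # 1) :* # 0) refl)

    module _ {x y z} (xy : adj x y ≡ true) (xz : adj x z ≡ true) (yz : adj y z ≡ true) where

      at-most-two : ∀ v → 0ℤ ≤ + 2 - a x v - a y v - a z v
      at-most-two v with adj x v in xv | adj y v in yv | adj z v in zv
      ... | true  | true  | true  = ⊥-elim (K₄-free xy xz xv yz yv zv)
      ... | true  | true  | false = nn
      ... | true  | false | true  = nn
      ... | true  | false | false = nn
      ... | false | true  | true  = nn
      ... | false | true  | false = nn
      ... | false | false | true  = nn
      ... | false | false | false = nn

      total : sum (λ v → + 2 - a x v - a y v - a z v) ≡ + 2 * N - + 3 * d
      total = trans (sum-cong-≗ λ v → lem (a x v) (a y v) (a z v))
        (trans (sum-lin (- 1ℤ) (- 1ℤ) 1ℤ (a x) (a y) (λ v → + 2 * 1ℤ + (- 1ℤ) * a z v + 0ℤ * 1ℤ))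
          (trans (cong₂ (λ p q → (- 1ℤ) * p + (- 1ℤ) * q + 1ℤ * sum (λ v → + 2 * 1ℤ + (- 1ℤ) * a z v + 0ℤ * 1ℤ)) (regular x) (regular y))
            (trans (cong (λ t → (- 1ℤ) * d + (- 1ℤ) * d + 1ℤ * t) (trans (sum-lin (+ 2) (- 1ℤ) 0ℤ 𝟏 (a z) 𝟏)
                (cong₂ (λ p q → + 2 * p + (- 1ℤ) * q + 0ℤ * p) sum-𝟏 (regular z))))
              (let m = N in (solve 2 (λ d m →
                  (:- # 1) :* d :+ (:- # 1) :* d :+ # 1 :* (# 2 :* m :+ (:- # 1) :* d
                  :+ # 0 :* m) := # 2 :* m :- # 3 :* d) refl d m)))))
        where
        lem : ∀ p q r → + 2 - p - q - r ≡ (- 1ℤ) * p + (- 1ℤ) * q + 1ℤ * (+ 2 * 1ℤ + (- 1ℤ) * r + 0ℤ * 1ℤ)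
        lem = solve 3 (λ p q r →
            # 2 :- p :- q :- r := (:- # 1) :* p :+ (:- # 1) :* q
            :+ # 1 :* (# 2 :* # 1 :+ (:- # 1) :* r :+ # 0 :* # 1)) refl

      3d≡2N : + 2 * N - + 3 * d ≡ 0ℤ
      3d≡2N = ≤-antisym (0≤i-j⇒j≤i (by dense (let m = N in (solve 2 (λ d m → # 3 :* d :- # 2 :* m := # 0 :- (# 2 :* m :- # 3 :* d)) refl d m))))
        (subst (0ℤ ≤_) total (sum-≥0 _ at-most-two))

      -- By `K₄`-freeness a vertex sees at most two vertices of the triangle. The total deficiency
      -- `2n - 3d` is at most 0, so every vertex sees exactly two.
      not-two-missing : ∀ v → adj x v ≡ false → adj y v ≡ false → ⊥
      not-two-missing v xv yv = clash (ind≤1 (adj z v)) (pos {0}) (trans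
        (let t = a z v in (solve 1 (λ t → # 1 :- t :+ # 1 := # 2 :- # 0 :- # 0 :- t) refl t))
        (trans (cong₂ (λ p q → + 2 - ind p - ind q - a z v) (sym xv) (sym yv))
          (vanishing-sum _ at-most-two (trans total 3d≡2N) v)))

    corner : Fin 3 → Fin n
    corner 0F = x₀
    corner 1F = proj₁ (neighbour x₀)
    corner 2F = proj₁ (common-neighbour x₀ (corner 1F))

    corner-adj : ∀ i j → i ≢ j → adj (corner i) (corner j) ≡ true
    corner-adj 0F 0F p = ⊥-elim (p refl)
    corner-adj 0F 1F p = proj₂ (neighbour x₀)
    corner-adj 0F 2F p = proj₁ (proj₂ (common-neighbour x₀ (corner 1F)))
    corner-adj 1F 0F p = symᵃ (proj₂ (neighbour x₀))
    corner-adj 1F 1F p = ⊥-elim (p refl)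
    corner-adj 1F 2F p = proj₂ (proj₂ (common-neighbour x₀ (corner 1F)))
    corner-adj 2F 0F p = symᵃ (proj₁ (proj₂ (common-neighbour x₀ (corner 1F))))
    corner-adj 2F 1F p = symᵃ (proj₂ (proj₂ (common-neighbour x₀ (corner 1F))))
    corner-adj 2F 2F p = ⊥-elim (p refl)

    third : ∀ (i j : Fin 3) → i ≢ j → ∃[ k ] i ≢ k × j ≢ k
    third 0F 0F p = ⊥-elim (p refl)
    third 0F 1F p = 2F , (λ ()) , (λ ())
    third 0F 2F p = 1F , (λ ()) , (λ ())
    third 1F 0F p = 2F , (λ ()) , (λ ())
    third 1F 1F p = ⊥-elim (p refl)
    third 1F 2F p = 0F , (λ ()) , (λ ())
    third 2F 0F p = 1F , (λ ()) , (λ ())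
    third 2F 1F p = 0F , (λ ()) , (λ ())
    third 2F 2F p = ⊥-elim (p refl)

    colour-of : ∀ v → ∃[ i ] adj (corner i) v ≡ false
    colour-of v with adj (corner 0F) v in e₀ | adj (corner 1F) v in e₁ | adj (corner 2F) v in e₂
    ... | false | _     | _     = 0F , e₀
    ... | true  | false | _     = 1F , e₁
    ... | true  | true  | false = 2F , e₂
    ... | true  | true  | true  = ⊥-elim (K₄-free (corner-adj 0F 1F λ ()) (corner-adj 0F 2F λ ()) e₀ (corner-adj 1F 2F λ ()) e₁ e₂)

    colour : Fin n → Fin 3
    colour v = proj₁ (colour-of v)

    colour-unique : ∀ v i → adj (corner i) v ≡ false → i ≡ colour v
    colour-unique v i e with i Fin.≟ colour v
    ... | yes p = p
    ... | no p  = let (k , ik , jk) = third i (colour v) p in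
      ⊥-elim (not-two-missing (corner-adj i (colour v) p) (corner-adj i k ik) (corner-adj (colour v) k jk) v e (proj₂ (colour-of v)))

    colour-adj : ∀ v i → colour v ≢ i → adj (corner i) v ≡ true
    colour-adj v i p with adj (corner i) v in e
    ... | true  = refl
    ... | false = ⊥-elim (p (sym (colour-unique v i e)))

    -- Both vertices are adjacent to the two corners other than that of their colour, so an edge
    -- between them would complete a `K₄`.
    same-colour : ∀ u v → colour u ≡ colour v → adj u v ≡ false
    same-colour u v e = Bool.¬-not λ uv → two-others (colour u) (colour-adj u) (λ i p → colour-adj v i (p ∘ trans e)) uv
      where
      two-others : ∀ i → (∀ j → i ≢ j → adj (corner j) u ≡ true) → (∀ j → i ≢ j → adj (corner j) v ≡ true) → adj u v ≡ true → ⊥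
      two-others 0F p q uv = K₄-free (corner-adj 1F 2F λ ()) (p 1F λ ()) (q 1F λ ()) (p 2F λ ()) (q 2F λ ()) uv
      two-others 1F p q uv = K₄-free (corner-adj 0F 2F λ ()) (p 0F λ ()) (q 0F λ ()) (p 2F λ ()) (q 2F λ ()) uv
      two-others 2F p q uv = K₄-free (corner-adj 0F 1F λ ()) (p 0F λ ()) (q 0F λ ()) (p 1F λ ()) (q 1F λ ()) uv

    -- `u` forms a triangle with the corner of `v`'s colour and the third corner. If `v` were not
    -- adjacent to `u`, it would miss two vertices of that triangle.
    different-colour : ∀ u v → colour u ≢ colour v → adj u v ≡ true
    different-colour u v p with adj u v in e
    ... | true  = refl
    ... | false = let (k , ik , jk) = third (colour u) (colour v) p in
      ⊥-elim (not-two-missing (symᵃ (colour-adj u (colour v) p)) (symᵃ (colour-adj u k ik)) (corner-adj (colour v) k jk) v e (proj₂ (colour-of v)))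

    -- Each colour class is the set of non-neighbours of its corner, the corner included.
    class-size : ∀ i → + count (fibre colour i) ≡ N - d
    class-size i = trans (sym (sum-ind (fibre colour i))) (trans (sum-cong-≗ term)
      (trans (sum-diff (a (corner i)) 𝟏) (cong₂ _-_ sum-𝟏 (regular (corner i)))))
      where
      term : ∀ v → ind (fibre colour i v) ≡ 1ℤ - a (corner i) v
      term v with colour v Fin.≟ i
      ... | yes refl = cong (λ b → 1ℤ - ind b) (sym (proj₂ (colour-of v)))
      ... | no p     = cong (λ b → 1ℤ - ind b) (sym (colour-adj v i p))

    m : ℕ
    m = count (fibre colour 0F)

    class-size′ : ∀ i → count (fibre colour i) ≡ m
    class-size′ i = +-injective (trans (class-size i) (sym (class-size 0F)))

    n≡m*3 : n ≡ m ℕ.* 3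
    n≡m*3 = +-injective (trans (i-j≡0⇒i≡j N (+ 3 * + m) (trans (cong (λ t → N - + 3 * t) (class-size 0F))
        (trans (let m = N in (solve 2 (λ d m → m :- # 3 :* (m :- d) := # 0 :- (# 2 :* m :- # 3 :* d)) refl d m))
          (cong (λ t → 0ℤ - t) (3d≡2N (corner-adj 0F 1F λ ()) (corner-adj 0F 2F λ ()) (corner-adj 1F 2F λ ()))))))
      (trans (trans (let m = + m in (solve 1 (λ m → # 3 :* m := m :* # 3) refl m)) (*≡ (+ m) (+ 3))) (sym (pos-* m 3))))

    module _ (sparse : ∀ (b : Fin n → Bool) → count b ≡ ⌊ n /2⌋ →
                0ℤ ≤ + 9 * B (ind ∘ b) (ind ∘ b) - N * N) where

      -- For n = 3 (2j + 1), one class together with j vertices of another is too sparse.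
      m-not-odd : ∀ j → m ≡ ℕ.suc (j ℕ.+ j) → ⊥
      m-not-odd j m≡ = clash (sparse b b-half ⊕ nn {18} ⊗ B₀₁-bound) (*-pos (pos {8}) (pos {j ℕ.+ j}))
        (trans (cong₂ (λ s t → + 9 * s - t * t + + 18 * (+ m * + j - B s₀ s₁) + + 9 * + ℕ.suc (j ℕ.+ j)) B-b N≡)
          (trans (cong (λ t → + 9 * (+ 2 * B s₀ s₁) - + 3 * (1ℤ + + 2 * J) * (+ 3 * (1ℤ + + 2 * J)) + + 18 * (t * J - B s₀ s₁) + + 9 * + ℕ.suc (j ℕ.+ j)) M≡)
            (let x = B s₀ s₁ in (solve 2 (λ x J →
                # 9 :* (# 2 :* x) :- # 3 :* (# 1 :+ # 2 :* J) :* (# 3 :* (# 1 :+ # 2 :* J))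
                :+ # 18 :* ((# 1 :+ # 2 :* J) :* J :- x) :+ # 9 :* (# 1 :+ (J :+ J))
                := # 0) refl x J))))
        where
        J = + j
        chosen = select (fibre colour 1F) j (subst (j ℕ.≤_) (sym (trans (class-size′ 1F) m≡)) (ℕ.≤-trans (ℕ.m≤m+n j j) (ℕ.n≤1+n _)))
        b₁ b : Fin n → Bool
        b₁ = proj₁ chosen
        b v = fibre colour 0F v ∨ b₁ v
        s₀ s₁ : Fin n → ℤ
        s₀ = ind ∘ fibre colour 0F
        s₁ = ind ∘ b₁
        b₁-colour : ∀ v → b₁ v ≡ true → colour v ≡ 1F
        b₁-colour v e = fibre-⇒ colour 1F v (proj₂ (proj₂ chosen) v e)
        M≡ : + m ≡ 1ℤ + + 2 * J
        M≡ = trans (cong +_ m≡) (solve 1 (λ J → # 1 :+ (J :+ J) := # 1 :+ # 2 :* J) refl J)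
        N≡ : N ≡ + 3 * (1ℤ + + 2 * J)
        N≡ = trans (cong +_ n≡m*3) (trans (pos-* m 3) (trans (sym (*≡ (+ m) (+ 3))) (trans (cong (_* + 3) M≡) (solve 1 (λ J → (# 1 :+ # 2 :* J) :* # 3 := # 3 :* (# 1 :+ # 2 :* J)) refl J))))
        b-split : ∀ v → ind (b v) ≡ 1ℤ * s₀ v + 1ℤ * s₁ v + 0ℤ * s₁ v
        b-split v = ind-∨ (fibre colour 0F v) (b₁ v) λ p q →
          0≢1 (trans (sym (fibre-⇒ colour 0F v p)) (b₁-colour v q))
          where
          0≢1 : _≢_ {A = Fin 3} 0F 1F
          0≢1 ()
        monochromatic : ∀ i (f : Fin n → Bool) → (∀ v → f v ≡ true → colour v ≡ i) → B (ind ∘ f) (ind ∘ f) ≡ 0ℤ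
        monochromatic i f mono = sum-zero _ outer
          where
          inner : ∀ u → f u ≡ true → ∀ v → a u v * ind (f v) ≡ 0ℤ
          inner u fu v with f v in fv
          ... | false = trans (*-comm′ (a u v) 0ℤ) (0* (a u v))
          ... | true  = trans (cong (λ t → ind t * 1ℤ) (same-colour u v (trans (mono u fu) (sym (mono v fv))))) (0* 1ℤ)
          outer : ∀ u → ind (f u) * 𝐀 (ind ∘ f) u ≡ 0ℤ
          outer u with f u in fu
          ... | false = 0* (𝐀 (ind ∘ f) u)
          ... | true  = trans (cong (1ℤ *_) (sum-zero _ (inner u fu))) (1* 0ℤ)
        B-b : B (ind ∘ b) (ind ∘ b) ≡ + 2 * B s₀ s₁
        B-b = trans (B-cong b-split b-split) (trans (B-square-at 1ℤ 1ℤ 0ℤ s₀ s₁ s₁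
            (monochromatic 0F (fibre colour 0F) (fibre-⇒ colour 0F)) B₁₁ B₁₁ refl refl B₁₁)
          (let x = B s₀ s₁ in (solve 1 (λ x →
              # 1 :* # 1 :* # 0 :+ # 1 :* # 1 :* # 0 :+ # 0 :* # 0 :* # 0
              :+ # 2 :* # 1 :* # 1 :* x :+ # 2 :* # 1 :* # 0 :* x
              :+ # 2 :* # 1 :* # 0 :* # 0
              := # 2 :* x) refl x)))
          where B₁₁ = monochromatic 1F b₁ b₁-colour
        sum-s₁ : sum s₁ ≡ J
        sum-s₁ = trans (sum-ind b₁) (cong +_ (proj₁ (proj₂ chosen)))
        B₀₁-bound : 0ℤ ≤ + m * J - B s₀ s₁
        B₀₁-bound = by (sum-mono (λ v → s₀ v * 𝐀 s₁ v) (λ v → s₀ v * J) λ v →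
            by (ind≥0 (fibre colour 0F v) ⊗ sum-mono (λ u → a v u * s₁ u) s₁ λ u → by (ind≤1 (adj v u) ⊗ ind≥0 (b₁ u))
                 (let x = a v u; y = s₁ u in (solve 2 (λ x y → (# 1 :- x) :* y := y :- x :* y) refl x y)))
              (trans (cong (λ t → s₀ v * (t - 𝐀 s₁ v)) sum-s₁) (let x = s₀ v; y = 𝐀 s₁ v in (solve 3 (λ J x y → x :* (J :- y) := x :* J :- x :* y) refl J x y))))
          (cong (_- B s₀ s₁) (trans (sum-*ʳ J s₀) (cong (_* J) (sum-ind (fibre colour 0F)))))
        b-count : count b ≡ m ℕ.+ j
        b-count = +-injective (trans (sym (sum-ind b)) (trans (sum-cong-≗ b-split) (trans (sum-lin 1ℤ 1ℤ 0ℤ s₀ s₁ s₁)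
          (trans (cong₂ (λ p q → 1ℤ * p + 1ℤ * q + 0ℤ * q) (sum-ind (fibre colour 0F)) sum-s₁)
            (let x = + m in (solve 2 (λ x J → # 1 :* x :+ # 1 :* J :+ # 0 :* J := x :+ J) refl x J))))))
        b-half : count b ≡ ⌊ n /2⌋
        b-half = trans b-count (half-unique n (m ℕ.+ j) (by (nn {1}) eq) (by⁺ (pos {0}) (trans (solve 1 (λ J → # 1 := # 2 :- # 1) refl J) (cong (λ t → + 2 - t) eq))))
          where
          eq : 1ℤ ≡ N - + 2 * + (m ℕ.+ j)
          eq = trans (solve 1 (λ J → # 1 := # 3 :* (# 1 :+ # 2 :* J) :- # 2 :* (# 1 :+ # 2 :* J :+ J)) refl J)
            (cong₂ (λ s t → s - + 2 * (t + J)) (sym N≡) (sym M≡))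

      6∣n : 6 ∣ n
      6∣n with parity m
        where
        parity : ∀ k → (∃[ j ] k ≡ j ℕ.+ j) ⊎ (∃[ j ] k ≡ ℕ.suc (j ℕ.+ j))
        parity ℕ.zero = inj₁ (0 , refl)
        parity (ℕ.suc k) with parity k
        ... | inj₁ (j , e) = inj₂ (j , cong ℕ.suc e)
        ... | inj₂ (j , e) = inj₁ (ℕ.suc j , trans (cong ℕ.suc e) (cong ℕ.suc (sym (ℕ.+-suc j j))))
      ... | inj₁ (j , e) = divides j (trans n≡m*3 (trans (cong (ℕ._* 3) e)
        (trans (ℕ.*-distribʳ-+ 3 j j) (sym (ℕ.*-distribˡ-+ j 3 3)))))
      ... | inj₂ (j , e) = ⊥-elim (m-not-odd j e)

-- Translation from graphs, subsets and rationals to integer forms.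

module Graphs where

  open import Data.Bool using (Bool; true; false; _∧_)
  import Data.Bool.Properties as Bool
  open import Data.Empty using (⊥; ⊥-elim)
  open import Data.Fin as Fin using (Fin; zero; suc)
  open import Data.Fin.Patterns using (0F; 1F; 2F; 3F)
  import Data.Fin.Properties as Fin
  open import Data.Fin.Subset using (Subset; ∣_∣)
  open import Data.Fin.Subset.Properties using (_∈?_)
  import Data.Integer as ℤ
  open import Data.Integer hiding (suc; _*_; pos; ∣_∣; _/_)
  open import Data.Integer.Properties
  open import Data.List as List using (List; []; _∷_; filter; length; map; _++_; allFin; cartesianProduct)
  open import Data.Nat as ℕ using (ℕ; ⌊_/2⌋)
  open import Data.Nat.Divisibility using (_∣_)
  import Data.Nat.Properties as ℕ
  open import Data.Product using (_×_; _,_; proj₁; proj₂)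
  open import Data.Vec as Vec using ([]; _∷_; tabulate)
  open import Data.Rational.Unnormalised as ℚᵘ using (_/_)
  import Data.Rational.Unnormalised.Properties as ℚᵘ
  open import Function using (Inverse; _∘_; id; _⇔_; mk⇔; Injective)
  open import Relation.Binary.PropositionalEquality hiding (J)
  open import Relation.Nullary using (Dec; yes; no; does)
  open import Relation.Nullary.Decidable using (_×-dec_; dec-true; dec-false)
  open import Level using (0ℓ)
  open import Relation.Unary using (Pred; Decidable)
  open import Defs
  open IntegerIdentities
  open Inequalities
  open QuadraticForms
  open Halves
  open MinimumDegree
  open TuránGraphs

  does-⇒ : ∀ {ℓ} {A : Set ℓ} (a? : Dec A) → does a? ≡ true → A
  does-⇒ (yes a) _ = a

  ∣tabulate∣ : ∀ {n} (b : Fin n → Bool) → ∣ tabulate b ∣ ≡ count b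
  ∣tabulate∣ {ℕ.zero}  b = refl
  ∣tabulate∣ {ℕ.suc n} b with b zero
  ... | true  = cong ℕ.suc (∣tabulate∣ (b ∘ suc))
  ... | false = ∣tabulate∣ (b ∘ suc)

  does-∈?-tabulate : ∀ {n} (b : Fin n → Bool) v → does (v ∈? tabulate b) ≡ b v
  does-∈?-tabulate b zero with b zero
  ... | true  = refl
  ... | false = refl
  does-∈?-tabulate b (suc v) = does-∈?-tabulate (b ∘ suc) v

  sumᴸ : {A : Set} → (A → ℤ) → List A → ℤ
  sumᴸ f []       = 0ℤ
  sumᴸ f (x ∷ xs) = f x + sumᴸ f xs

  sumᴸ-++ : {A : Set} (f : A → ℤ) (xs ys : List A) → sumᴸ f (xs ++ ys) ≡ sumᴸ f xs + sumᴸ f ys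
  sumᴸ-++ f []       ys = sym (+-identityˡ _)
  sumᴸ-++ f (x ∷ xs) ys = trans (cong (λ t → f x + t) (sumᴸ-++ f xs ys)) (sym (+-assoc (f x) (sumᴸ f xs) (sumᴸ f ys)))

  sumᴸ-map : {A C : Set} (f : C → ℤ) (g : A → C) (xs : List A) → sumᴸ f (map g xs) ≡ sumᴸ (f ∘ g) xs
  sumᴸ-map f g []       = refl
  sumᴸ-map f g (x ∷ xs) = cong (λ t → f (g x) + t) (sumᴸ-map f g xs)

  sumᴸ-tabulate : {A : Set} (f : A → ℤ) {n : ℕ} (g : Fin n → A) → sumᴸ f (List.tabulate g) ≡ sum (f ∘ g)
  sumᴸ-tabulate f {ℕ.zero}  g = refl
  sumᴸ-tabulate f {ℕ.suc n} g = cong (λ t → f (g zero) + t) (sumᴸ-tabulate f (g ∘ suc))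

  sumᴸ-product : {A C : Set} (f : A × C → ℤ) (xs : List A) (ys : List C) →
    sumᴸ f (cartesianProduct xs ys) ≡ sumᴸ (λ x → sumᴸ (λ y → f (x , y)) ys) xs
  sumᴸ-product f []       ys = refl
  sumᴸ-product f (x ∷ xs) ys = trans (sumᴸ-++ f (map (x ,_) ys) (cartesianProduct xs ys))
    (cong₂ _+_ (sumᴸ-map f (x ,_) ys) (sumᴸ-product f xs ys))

  length-filter₂ : {A : Set} {P Q : Pred A 0ℓ} (P? : Decidable P) (Q? : Decidable Q) (xs : List A) →
    + length (filter Q? (filter P? xs)) ≡ sumᴸ (λ x → ind (does (P? x) ∧ does (Q? x))) xs
  length-filter₂ P? Q? [] = refl
  length-filter₂ P? Q? (x ∷ xs) with does (P? x)
  ... | false = trans (length-filter₂ P? Q? xs) (sym (+-identityˡ _))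
  ... | true with does (Q? x)
  ...   | false = trans (length-filter₂ P? Q? xs) (sym (+-identityˡ _))
  ...   | true  = cong (λ t → 1ℤ + t) (length-filter₂ P? Q? xs)

  module _ {n} (G : Graph n) where
    open Graph G

    adj : Fin n → Fin n → Bool
    adj u v = does (u ~? v)

    adj-sym : ∀ u v → adj u v ≡ adj v u
    adj-sym u v with u ~? v | v ~? u
    ... | yes _ | yes _ = refl
    ... | no _  | no _  = refl
    ... | yes p | no q  = ⊥-elim (q (~-sym p))
    ... | no p  | yes q = ⊥-elim (p (~-sym q))

    adj-irrefl : ∀ u → adj u u ≡ false
    adj-irrefl u = dec-false (u ~? u) (~-irrefl refl)

    adj-K₄-free : K₄-Free G → ∀ {w x y z} → adj w x ≡ true → adj w y ≡ true → adj w z ≡ true →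
      adj x y ≡ true → adj x z ≡ true → adj y z ≡ true → ⊥
    adj-K₄-free K₄-free {w} {x} {y} {z} wx wy wz xy xz yz = K₄-free (f , injective , λ {i} {j} → hom i j)
      where
      f : Fin 4 → Fin n
      f 0F = w
      f 1F = x
      f 2F = y
      f 3F = z
      edge : ∀ {u v} → adj u v ≡ true → u ~ v
      edge {u} {v} = does-⇒ (u ~? v)
      hom : ∀ i j → i ≢ j → f i ~ f j
      hom 0F 0F p = ⊥-elim (p refl)
      hom 0F 1F p = edge wx
      hom 0F 2F p = edge wy
      hom 0F 3F p = edge wz
      hom 1F 0F p = ~-sym (edge wx)
      hom 1F 1F p = ⊥-elim (p refl)
      hom 1F 2F p = edge xy
      hom 1F 3F p = edge xz
      hom 2F 0F p = ~-sym (edge wy)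
      hom 2F 1F p = ~-sym (edge xy)
      hom 2F 2F p = ⊥-elim (p refl)
      hom 2F 3F p = edge yz
      hom 3F 0F p = ~-sym (edge wz)
      hom 3F 1F p = ~-sym (edge xz)
      hom 3F 2F p = ~-sym (edge yz)
      hom 3F 3F p = ⊥-elim (p refl)
      injective : Injective _≡_ _≡_ f
      injective {i} {j} e with i Fin.≟ j
      ... | yes p = p
      ... | no p  = ⊥-elim (~-irrefl e (hom i j p))

    row-sum : ∀ v → sum (ind ∘ adj v) ≡ + degree G v
    row-sum v = trans (sum-ind (adj v)) (cong +_ (sym (∣tabulate∣ (adj v))))

    spanned : (Fin n → Bool) → Fin n → Fin n → ℤ
    spanned b u v = ind ((does (u Fin.<? v) ∧ adj u v) ∧ (b u ∧ b v))

    spannedEdges-sum : ∀ b → + spannedEdges G (tabulate b) ≡ sum λ u → sum λ v → spanned b u v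
    spannedEdges-sum b = trans
      (length-filter₂ (λ (u , v) → u Fin.<? v ×-dec u ~? v) (λ (u , v) → u ∈? tabulate b ×-dec v ∈? tabulate b)
        (cartesianProduct (allFin n) (allFin n)))
      (trans (sumᴸ-product _ (allFin n) (allFin n))
        (trans (sumᴸ-tabulate _ {n} id) (sum-cong-≗ λ u → trans (sumᴸ-tabulate _ {n} id) (sum-cong-≗ λ v →
          cong₂ (λ p q → ind ((does (u Fin.<? v) ∧ adj u v) ∧ (p ∧ q))) (does-∈?-tabulate b u) (does-∈?-tabulate b v)))))

    a′ : Fin n → Fin n → ℤ
    a′ u v = ind (adj u v)

    open Form a′ (λ u v → cong ind (adj-sym u v))

    -- Each edge is listed once in spannedEdges and twice in B.
    2spannedEdges≤B : ∀ b → 0ℤ ≤ B (ind ∘ b) (ind ∘ b) - + 2 * + spannedEdges G (tabulate b)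
    2spannedEdges≤B b = by (sum-≥0 _ λ u → sum-≥0 _ (term u))
      (trans (sum-cong-≗ λ u → inner u)
        (trans (sum-lin 1ℤ (- 1ℤ) (- 1ℤ) (λ u → s u * 𝐀 s u) (λ u → sum (spanned b u)) (λ u → sum λ v → spanned b v u))
          (trans (cong₂ (λ p q → 1ℤ * B s s + (- 1ℤ) * p + (- 1ℤ) * q) (sym (spannedEdges-sum b))
              (trans (sym (∑-comm (spanned b))) (sym (spannedEdges-sum b))))
            (let x = B s s; e = + spannedEdges G (tabulate b) in (solve 2 (λ x e → # 1 :* x :+ (:- # 1) :* e :+ (:- # 1) :* e := x :- # 2 :* e) refl x e)))))
      where
      s : Fin n → ℤ
      s = ind ∘ b
      inner : ∀ u → sum (λ v → s u * (a′ u v * s v) - spanned b u v - spanned b v u)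
        ≡ 1ℤ * (s u * 𝐀 s u) + (- 1ℤ) * sum (spanned b u) + (- 1ℤ) * sum (λ v → spanned b v u)
      inner u = trans (sum-cong-≗ λ v → lem (s u * (a′ u v * s v)) (spanned b u v) (spanned b v u))
        (trans (sum-lin 1ℤ (- 1ℤ) (- 1ℤ) (λ v → s u * (a′ u v * s v)) (spanned b u) (λ v → spanned b v u))
          (cong (λ t → 1ℤ * t + (- 1ℤ) * sum (spanned b u) + (- 1ℤ) * sum (λ v → spanned b v u)) (sum-*ˡ (s u) (λ v → a′ u v * s v))))
        where
        lem : ∀ p q r → p - q - r ≡ 1ℤ * p + (- 1ℤ) * q + (- 1ℤ) * r
        lem = solve 3 (λ p q r → p :- q :- r := # 1 :* p :+ (:- # 1) :* q :+ (:- # 1) :* r) refl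
      bools : ∀ l l′ e p q → (l ≡ true → l′ ≡ true → ⊥) →
        0ℤ ≤ ind p * (ind e * ind q) - ind ((l ∧ e) ∧ (p ∧ q)) - ind ((l′ ∧ e) ∧ (q ∧ p))
      bools l l′ false p q _ rewrite Bool.∧-zeroʳ l | Bool.∧-zeroʳ l′ =
        by ≤-refl (let x = ind p; y = ind q in (solve 2 (λ x y → # 0 := x :* (# 0 :* y) :- # 0 :- # 0) refl x y))
      bools l l′ true false q _ rewrite Bool.∧-zeroʳ (l ∧ true) | Bool.∧-zeroʳ q | Bool.∧-zeroʳ (l′ ∧ true) =
        by ≤-refl (let y = ind q in (solve 1 (λ y → # 0 := # 0 :* (# 1 :* y) :- # 0 :- # 0) refl y))
      bools l l′ true true false _ rewrite Bool.∧-zeroʳ (l ∧ true) | Bool.∧-zeroʳ (l′ ∧ true) =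
        by ≤-refl (solve 0 (# 0 := # 1 :* (# 1 :* # 0) :- # 0 :- # 0) refl)
      bools true true true true true excl = ⊥-elim (excl refl refl)
      bools true false true true true _ = by ≤-refl (solve 0 (# 0 := # 1 :* (# 1 :* # 1) :- # 1 :- # 0) refl)
      bools false true true true true _ = by ≤-refl (solve 0 (# 0 := # 1 :* (# 1 :* # 1) :- # 0 :- # 1) refl)
      bools false false true true true _ = by (nn {1}) (solve 0 (# 1 := # 1 :* (# 1 :* # 1) :- # 0 :- # 0) refl)
      term : ∀ u v → 0ℤ ≤ s u * (a′ u v * s v) - spanned b u v - spanned b v u
      term u v = subst (λ e → 0ℤ ≤ s u * (a′ u v * s v) - spanned b u v - ind ((does (v Fin.<? u) ∧ e) ∧ (b v ∧ b u))) (adj-sym u v)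
        (bools (does (u Fin.<? v)) (does (v Fin.<? u)) (adj u v) (b u) (b v) λ p q →
          ℕ.<-asym (does-⇒ (u Fin.<? v) p) (does-⇒ (v Fin.<? u) q))

    sparse-halves : (∀ (S : Subset n) → ∣ S ∣ ≡ ⌊ n /2⌋ → (+ (n ℕ.^ 2)) / 18 ℚᵘ.≤ (+ spannedEdges G S) / 1) →
      ∀ (b : Fin n → Bool) → count b ≡ ⌊ n /2⌋ → 0ℤ ≤ + 9 * B (ind ∘ b) (ind ∘ b) - + n * + n
    sparse-halves hyp b half = by (nn {9} ⊗ 2spannedEdges≤B b ⊕ i≤j⇒0≤j-i bound)
      (let x = B (ind ∘ b) (ind ∘ b); e = + spannedEdges G (tabulate b); m = + n in
        (solve 3 (λ x e m → # 9 :* (x :- # 2 :* e) :+ (e :* # 18 :- m :* m) := # 9 :* x :- m :* m) refl x e m))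
      where
      bound : + n * + n ≤ + spannedEdges G (tabulate b) * + 18
      -- Unnormalised rationals are compared by cross-multiplication, so the hypothesis already
      -- contains this inequality between integers.
      bound = subst₂ _≤_
        (trans (*-identityʳ (+ (n ℕ.^ 2))) (trans (pos-* n (n ℕ.* 1)) (trans (cong (λ k → + n ℤ.* + k) (ℕ.*-identityʳ n)) (sym (*≡ (+ n) (+ n))))))
        (sym (*≡ (+ spannedEdges G (tabulate b)) (+ 18)))
        (ℚᵘ.drop-*≤* (hyp (tabulate b) (trans (∣tabulate∣ b) half)))

  -- Three further vertices add one to each residue class; for a concrete class this holds by
  -- computation.
  T₃-part-size : ∀ {n} m → n ≡ m ℕ.* 3 → ∀ i → count (fibre (part₃ n) i) ≡ m
  T₃-part-size ℕ.zero refl i = refl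
  T₃-part-size (ℕ.suc m) refl i = trans (step i) (cong ℕ.suc (T₃-part-size m refl i))
    where
    step : ∀ i → count (fibre (part₃ (3 ℕ.+ m ℕ.* 3)) i) ≡ ℕ.suc (count (fibre (part₃ (m ℕ.* 3)) i))
    step 0F = refl
    step 1F = refl
    step 2F = refl

  module _ {n} (G : Graph n) (K₄-free : K₄-Free G) (d : ℕ) (degree≡d : ∀ v → degree G v ≡ d) (x₀ : Fin n) where

    open Graph G

    private
      regular : ∀ v → sum (ind ∘ adj G v) ≡ + d
      regular v = trans (row-sum G v) (cong +_ (degree≡d v))

    open Regular (adj G) (adj-sym G) (adj-irrefl G) (adj-K₄-free G K₄-free) (+ d) regular

    turán-graph : (∀ (b : Fin n → Bool) → count b ≡ ⌊ n /2⌋ → 0ℤ ≤ + 9 * B (ind ∘ b) (ind ∘ b) - + n * + n) →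
      (6 ∣ n) × (G ≅ T₃ n)
    turán-graph sparse = 6∣n sparse , π , same-edges
      where
      N>0 : 0ℤ < + n
      N>0 = +<+ (ℕ.≤-<-trans ℕ.z≤n (Fin.toℕ<n x₀))
      d>0 : 0ℤ < + d
      -- The zero vector turns the fractional bound into `9dn ≥ 4n²`.
      d>0 = cancel-pos⁺ (pos {8}) (cancel-pos⁺ N>0 (by⁺ (fractional-bound sparse 1ℤ pos (λ _ → 0ℤ)
          ((λ _ → nn) , (λ _ → nn) , sum-zero {n} (λ _ → 0ℤ) (λ _ → refl)) ⊕⁺ *-pos (*-pos (pos {3}) N>0) N>0)
        (trans (cong (λ t → + 9 * t + + 9 * + d * + n * 1ℤ * 1ℤ - + 4 * + n * + n * 1ℤ * 1ℤ + + 4 * + n * + n)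
            (sum-zero {n} _ λ v → 0* (𝐀 (λ _ → 0ℤ) v)))
          (let e = + d; m = + n in (solve 2 (λ e m →
              # 9 :* # 0 :+ # 9 :* e :* m :* # 1 :* # 1
              :- # 4 :* m :* m :* # 1 :* # 1 :+ # 4 :* m :* m
              := m :* (# 9 :* e)) refl e m)))))
      open Extremal (adj G) (adj-sym G) (adj-irrefl G) (adj-K₄-free G K₄-free) (+ d) regular
        x₀ (Sparse.turán-degree sparse d>0 x₀) N>0
      relabelling = relabel colour (part₃ n) λ i → trans (class-size′ i) (sym (T₃-part-size m n≡m*3 i))
      π = proj₁ relabelling
      same-edges : ∀ u v → (u ~ v) ⇔ (part₃ n (Inverse.to π u) ≢ part₃ n (Inverse.to π v))
      same-edges u v = mk⇔
        (λ uv e → true≢false (dec-true (u ~? v) uv) (same-colour u v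
           (trans (proj₂ relabelling u) (trans e (sym (proj₂ relabelling v))))))
        (λ p → does-⇒ (u ~? v) (different-colour u v λ e →
           p (trans (sym (proj₂ relabelling u)) (trans e (proj₂ relabelling v)))))

open import Data.Fin.Subset using (Subset; ∣_∣)
open import Data.Integer using (+_)
open import Data.Nat using (ℕ; _≤_; _^_; ⌊_/2⌋)
open import Data.Nat.Divisibility using (_∣_)
open import Data.Product using (_×_)
open import Data.Rational.Unnormalised as ℚᵘ using (_/_)
open import Relation.Binary.PropositionalEquality using (_≡_)
open import Defs

import Data.Fin as Fin
open import Data.Product using (_,_)

theorem1p3 : ∀ (n : ℕ) → 1 ≤ n → (G : Graph n) → K₄-Free G → Regular G →
    (∀ (S : Subset n) → ∣ S ∣ ≡ ⌊ n /2⌋ → (+ (n ^ 2)) / 18 ℚᵘ.≤ (+ spannedEdges G S) / 1) →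
    (6 ∣ n) × (G ≅ T₃ n)
theorem1p3 n 1≤n G K₄-free (d , regular) sparse =
  Graphs.turán-graph G K₄-free d regular (Fin.fromℕ< 1≤n) (Graphs.sparse-halves G sparse)
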